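{- Consider the twelve points of $\mathbb{R}^4$ $A=(27,-95,120,0)$, $B=(-50,-45,101,-94)$, $C=(-9,-67,126,-35)$, $D=(195,-145,11,125)$, $E=(-40,-10,8,-65)$, $F=(232,-102,-21,198)$, $G=(-63,-25,94,-139)$, $H=(-80,45,-49,-65)$, $I=(-72,4,24,-90)$, $J=(-30,167,-154,92)$, $K=(-43,190,-199,100)$, $L=(-67,80,-61,-26)$, and let $P=\operatorname{conv}\{A,B,C,D,E,F,G,H,I,J,K,L\}$. Then $P$ is a simplicial $4$-polytope with these twelve points as vertices, and each of the following $26$ four-element sets of vertices (written as words) is the vertex set of a facet of $P$: GHKL, DGHK, FGJK, EGHI, GJKL, DFGK, GHIL, DEGH, CDFG, ACDF, ACFJ, AFJK, ACJK, BCJK, BJKL, BDEG, ABDE, ABEI, AEHI, ABHI, BCHI, CHIL, ACDG, BCKL, ABDG, BCIL. Moreover, the simplicial complex generated by these $26$ facets is a non-separating Perles piece in the boundary complex of $P$; its facet-ridge graph (two of the $26$ sets are adjacent if and only if they have exactly three elements in common) is planar, and it is not the star of a vertex of the boundary complex of $P$.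
   Context: A $4$-polytope is simplicial if all of its facets are simplices; its boundary complex is then a pure $3$-dimensional simplicial complex, whose facets are the vertex sets of the facets of $P$ and whose ridges are the $3$-element faces. The facet-ridge graph of a pure simplicial complex has the facets as vertices, two facets being adjacent when they contain a common ridge. A boundary ridge of a pure $3$-dimensional simplicial complex is a ridge contained in only one facet of that complex. A Perles piece in a simplicial $3$-sphere $\Delta$ is a subcomplex generated by a set $\mathcal{F}$ of facets of $\Delta$ such that the facet-ridge graph of the subcomplex is connected and every facet in $\mathcal{F}$ contains exactly one boundary ridge of the subcomplex. It is non-separating if the graph obtained from the facet-ridge graph of $\Delta$ by deleting the vertices in $\mathcal{F}$ is connected. The star of a vertex $v$ in $\Delta$ is the subcomplex generated by all facets of $\Delta$ containing $v$. -}

module Defs where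

open import Algebra.Bundles.Raw using (RawMonoid)
import Algebra.Definitions.RawMonoid as RawMonoidDefinitions
open import Data.Fin using (Fin; zero; suc; #_)
open import Data.Fin.Subset using (Subset; _⊆_; _∪_; ⁅_⁆; ∣_∣) renaming (_∈_ to _∈ₛ_)
open import Data.Integer as ℤ using (ℤ; +_; -_)
open import Data.List using (List; []; _∷_)
open import Data.List.Membership.Propositional using (_∈_)
open import Data.Nat as ℕ using (ℕ; suc)
import Data.Nat.Properties as ℕ
open import Data.Product using (Σ; ∃; ∃₂; ∃!; _×_; _,_; proj₁; proj₂)
open import Data.Rational as ℚ using (ℚ; 0ℚ; 1ℚ; ½)
import Data.Rational.Properties as ℚ
open import Data.Rational.Solver using (module +-*-Solver)
open import Data.Sum using (_⊎_; inj₁; inj₂)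
open import Data.Vec as Vec using (Vec; []; _∷_)
open import Data.Vec.Functional using (Vector)
open import Function.Bundles using (_⇔_)
open import Level using (0ℓ)
open import Relation.Binary.Construct.Closure.ReflexiveTransitive using (Star)
open import Relation.Binary.Core using (Rel)
open import Relation.Binary.PropositionalEquality using (_≡_; _≢_; refl; sym; trans; cong; cong₂; subst)
open import Relation.Nullary using (¬_)
open import Relation.Unary using (Pred)

------------------------------------------------------------------------
-- The real numbers: Cauchy sequences of rationals, with the setoid
-- equality _≃_ (the difference is a null sequence).

record ℝ : Set where
  constructor mkℝ
  field
    seq    : ℕ → ℚ
    cauchy : ∀ ε → 0ℚ ℚ.< ε →
             ∃ λ N → ∀ m n → N ℕ.≤ m → N ℕ.≤ n → ℚ.∣ seq m ℚ.- seq n ∣ ℚ.< ε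

open ℝ public

infix 4 _≃_ _<_ _≤_ _≄_

_≃_ : Rel ℝ 0ℓ
x ≃ y = ∀ ε → 0ℚ ℚ.< ε → ∃ λ N → ∀ n → N ℕ.≤ n → ℚ.∣ seq x n ℚ.- seq y n ∣ ℚ.< ε

_<_ : Rel ℝ 0ℓ
x < y = ∃ λ ε → 0ℚ ℚ.< ε × ∃ λ N → ∀ n → N ℕ.≤ n → seq x n ℚ.+ ε ℚ.≤ seq y n

_≤_ : Rel ℝ 0ℓ
x ≤ y = ¬ (y < x)

-- Apartness: the positive form of "x and y are different".
_≄_ : Rel ℝ 0ℓ
x ≄ y = x < y ⊎ y < x

fromℚ : ℚ → ℝ
fromℚ q = mkℝ (λ _ → q) λ ε 0<ε → 0 , λ _ _ _ _ →
  subst (ℚ._< ε) (sym (cong ℚ.∣_∣ (ℚ.+-inverseʳ q))) 0<ε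

fromℤ : ℤ → ℝ
fromℤ z = fromℚ (z ℚ./ 1)

0ℝ 1ℝ : ℝ
0ℝ = fromℚ 0ℚ
1ℝ = fromℚ 1ℚ

private
  0<½* : ∀ {ε} → 0ℚ ℚ.< ε → 0ℚ ℚ.< ½ ℚ.* ε
  0<½* {ε} 0<ε = subst (ℚ._< ½ ℚ.* ε) (ℚ.*-zeroʳ ½) (ℚ.*-monoʳ-<-pos ½ 0<ε)

  ½+½ : ∀ ε → ½ ℚ.* ε ℚ.+ ½ ℚ.* ε ≡ ε
  ½+½ ε = trans (sym (ℚ.*-distribʳ-+ ε ½ ½)) (ℚ.*-identityˡ ε)

infixl 6 _+_
infixl 7 _*_

_+_ : ℝ → ℝ → ℝ
x + y = mkℝ (λ n → seq x n ℚ.+ seq y n) λ ε 0<ε →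
  let (M , p) = cauchy x (½ ℚ.* ε) (0<½* 0<ε)
      (N , q) = cauchy y (½ ℚ.* ε) (0<½* 0<ε)
  in M ℕ.⊔ N , λ m n h k → begin-strict
    ℚ.∣ (seq x m ℚ.+ seq y m) ℚ.- (seq x n ℚ.+ seq y n) ∣
      ≡⟨ cong ℚ.∣_∣ (rearrange (seq x m) (seq y m) (seq x n) (seq y n)) ⟩
    ℚ.∣ (seq x m ℚ.- seq x n) ℚ.+ (seq y m ℚ.- seq y n) ∣
      ≤⟨ ℚ.∣p+q∣≤∣p∣+∣q∣ (seq x m ℚ.- seq x n) (seq y m ℚ.- seq y n) ⟩
    ℚ.∣ seq x m ℚ.- seq x n ∣ ℚ.+ ℚ.∣ seq y m ℚ.- seq y n ∣
      <⟨ ℚ.+-mono-< (p m n (ℕ.m⊔n≤o⇒m≤o M N h) (ℕ.m⊔n≤o⇒m≤o M N k))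
                    (q m n (ℕ.m⊔n≤o⇒n≤o M N h) (ℕ.m⊔n≤o⇒n≤o M N k)) ⟩
    ½ ℚ.* ε ℚ.+ ½ ℚ.* ε
      ≡⟨ ½+½ ε ⟩
    ε ∎
  where
  open ℚ.≤-Reasoning
  rearrange : ∀ a b c d → (a ℚ.+ b) ℚ.- (c ℚ.+ d) ≡ (a ℚ.- c) ℚ.+ (b ℚ.- d)
  rearrange = solve 4 (λ a b c d → (a :+ b) :- (c :+ d) := (a :- c) :+ (b :- d)) refl
    where open +-*-Solver

-- Each Cauchy sequence is eventually bounded in absolute value.
bound : ∀ x → ∃₂ λ B N → 0ℚ ℚ.< B × (∀ n → N ℕ.≤ n → ℚ.∣ seq x n ∣ ℚ.≤ B)
bound x = ℚ.∣ seq x N ∣ ℚ.+ 1ℚ , N , 0<B , λ n h → begin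
    ℚ.∣ seq x n ∣
      ≡⟨ cong ℚ.∣_∣ (split (seq x N) (seq x n)) ⟩
    ℚ.∣ seq x N ℚ.+ (seq x n ℚ.- seq x N) ∣
      ≤⟨ ℚ.∣p+q∣≤∣p∣+∣q∣ (seq x N) (seq x n ℚ.- seq x N) ⟩
    ℚ.∣ seq x N ∣ ℚ.+ ℚ.∣ seq x n ℚ.- seq x N ∣
      ≤⟨ ℚ.+-monoʳ-≤ ℚ.∣ seq x N ∣ (ℚ.<⇒≤ (proj₂ c n N h ℕ.≤-refl)) ⟩
    ℚ.∣ seq x N ∣ ℚ.+ 1ℚ ∎
  where
  open ℚ.≤-Reasoning
  c = cauchy x 1ℚ (ℚ.positive⁻¹ 1ℚ)
  N = proj₁ c
  0<B : 0ℚ ℚ.< ℚ.∣ seq x N ∣ ℚ.+ 1ℚ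
  0<B = ℚ.+-mono-≤-< (ℚ.0≤∣p∣ (seq x N)) (ℚ.positive⁻¹ 1ℚ)
  split : ∀ a b → b ≡ a ℚ.+ (b ℚ.- a)
  split = solve 2 (λ a b → b := a :+ (b :- a)) refl
    where open +-*-Solver

_*_ : ℝ → ℝ → ℝ
x * y = mkℝ (λ n → seq x n ℚ.* seq y n) λ ε 0<ε → cauchy* ε 0<ε (bound x) (bound y)
  where
  open ℚ.≤-Reasoning

  rearrange : ∀ a b c d → a ℚ.* b ℚ.- c ℚ.* d ≡ a ℚ.* (b ℚ.- d) ℚ.+ d ℚ.* (a ℚ.- c)
  rearrange = solve 4 (λ a b c d → a :* b :- c :* d := a :* (b :- d) :+ d :* (a :- c)) refl
    where open +-*-Solver

  scaled : ∀ B ε → 0ℚ ℚ.< B → 0ℚ ℚ.< ε → ∃ λ δ → 0ℚ ℚ.< δ × B ℚ.* δ ≡ ½ ℚ.* ε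
  scaled B ε 0<B 0<ε = (ℚ.1/ B) ℚ.* (½ ℚ.* ε) , 0<δ ,
      trans (sym (ℚ.*-assoc B (ℚ.1/ B) (½ ℚ.* ε)))
        (trans (cong (ℚ._* (½ ℚ.* ε)) (ℚ.*-inverseʳ B)) (ℚ.*-identityˡ (½ ℚ.* ε)))
    where
    instance
      B>0 : ℚ.Positive B
      B>0 = ℚ.positive 0<B
      B≢0 : ℚ.NonZero B
      B≢0 = ℚ.pos⇒nonZero B
      1/B>0 : ℚ.Positive (ℚ.1/ B)
      1/B>0 = ℚ.1/pos⇒pos B
    0<δ : 0ℚ ℚ.< (ℚ.1/ B) ℚ.* (½ ℚ.* ε)
    0<δ = subst (ℚ._< (ℚ.1/ B) ℚ.* (½ ℚ.* ε)) (ℚ.*-zeroʳ (ℚ.1/ B))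
            (ℚ.*-monoʳ-<-pos (ℚ.1/ B) (0<½* 0<ε))

  ∣*∣< : ∀ a d {B δ} → 0ℚ ℚ.< B → ℚ.∣ a ∣ ℚ.≤ B → ℚ.∣ d ∣ ℚ.< δ →
         ℚ.∣ a ℚ.* d ∣ ℚ.< B ℚ.* δ
  ∣*∣< a d {B} {δ} 0<B a≤B d<δ = begin-strict
    ℚ.∣ a ℚ.* d ∣            ≡⟨ ℚ.∣p*q∣≡∣p∣*∣q∣ a d ⟩
    ℚ.∣ a ∣ ℚ.* ℚ.∣ d ∣      ≤⟨ ℚ.*-monoʳ-≤-nonNeg ℚ.∣ d ∣ {{ℚ.nonNegative (ℚ.0≤∣p∣ d)}} a≤B ⟩
    B ℚ.* ℚ.∣ d ∣            <⟨ ℚ.*-monoʳ-<-pos B {{ℚ.positive 0<B}} d<δ ⟩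
    B ℚ.* δ                  ∎

  cauchy* : ∀ ε → 0ℚ ℚ.< ε →
            (∃₂ λ B N → 0ℚ ℚ.< B × (∀ n → N ℕ.≤ n → ℚ.∣ seq x n ∣ ℚ.≤ B)) →
            (∃₂ λ B N → 0ℚ ℚ.< B × (∀ n → N ℕ.≤ n → ℚ.∣ seq y n ∣ ℚ.≤ B)) →
            ∃ λ N → ∀ m n → N ℕ.≤ m → N ℕ.≤ n →
              ℚ.∣ seq x m ℚ.* seq y m ℚ.- seq x n ℚ.* seq y n ∣ ℚ.< ε
  cauchy* ε 0<ε (B , K , 0<B , b) (C , L , 0<C , c) =
    let (δ , 0<δ , Bδ) = scaled B ε 0<B 0<ε
        (η , 0<η , Cη) = scaled C ε 0<C 0<ε
        (M , p) = cauchy y δ 0<δ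
        (N , q) = cauchy x η 0<η
    in (K ℕ.⊔ L) ℕ.⊔ (M ℕ.⊔ N) , λ m n h k →
      let hKL = ℕ.m⊔n≤o⇒m≤o (K ℕ.⊔ L) (M ℕ.⊔ N) h
          kKL = ℕ.m⊔n≤o⇒m≤o (K ℕ.⊔ L) (M ℕ.⊔ N) k
          hMN = ℕ.m⊔n≤o⇒n≤o (K ℕ.⊔ L) (M ℕ.⊔ N) h
          kMN = ℕ.m⊔n≤o⇒n≤o (K ℕ.⊔ L) (M ℕ.⊔ N) k
          xm = seq x m
          xn = seq x n
          ym = seq y m
          yn = seq y n
      in begin-strict
        ℚ.∣ xm ℚ.* ym ℚ.- xn ℚ.* yn ∣
          ≡⟨ cong ℚ.∣_∣ (rearrange xm ym xn yn) ⟩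
        ℚ.∣ xm ℚ.* (ym ℚ.- yn) ℚ.+ yn ℚ.* (xm ℚ.- xn) ∣
          ≤⟨ ℚ.∣p+q∣≤∣p∣+∣q∣ (xm ℚ.* (ym ℚ.- yn)) (yn ℚ.* (xm ℚ.- xn)) ⟩
        ℚ.∣ xm ℚ.* (ym ℚ.- yn) ∣ ℚ.+ ℚ.∣ yn ℚ.* (xm ℚ.- xn) ∣
          <⟨ ℚ.+-mono-<
               (∣*∣< xm (ym ℚ.- yn) 0<B (b m (ℕ.m⊔n≤o⇒m≤o K L hKL))
                 (p m n (ℕ.m⊔n≤o⇒m≤o M N hMN) (ℕ.m⊔n≤o⇒m≤o M N kMN)))
               (∣*∣< yn (xm ℚ.- xn) 0<C (c n (ℕ.m⊔n≤o⇒n≤o K L kKL))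
                 (q m n (ℕ.m⊔n≤o⇒n≤o M N hMN) (ℕ.m⊔n≤o⇒n≤o M N kMN))) ⟩
        B ℚ.* δ ℚ.+ C ℚ.* η
          ≡⟨ cong₂ ℚ._+_ Bδ Cη ⟩
        ½ ℚ.* ε ℚ.+ ½ ℚ.* ε
          ≡⟨ ½+½ ε ⟩
        ε ∎

+-rawMonoid : RawMonoid 0ℓ 0ℓ
+-rawMonoid = record { Carrier = ℝ ; _≈_ = _≃_ ; _∙_ = _+_ ; ε = 0ℝ }

open RawMonoidDefinitions +-rawMonoid public using (sum)

------------------------------------------------------------------------
-- Convex geometry in ℝⁿ.  A polytope is given by a finite family
-- p : Fin m → ℝⁿ, and is the set conv p.

infix 4 _≋_ _≭_

_≋_ _≭_ : ∀ {n} → Rel (Vector ℝ n) 0ℓ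
x ≋ y = ∀ k → x k ≃ y k
x ≭ y = ∃ λ k → x k ≄ y k

origin : ∀ {n} → Vector ℝ n
origin _ = 0ℝ

dot : ∀ {n} → Vector ℝ n → Vector ℝ n → ℝ
dot c x = sum λ k → c k * x k

combination : ∀ {m n} → Vector ℝ m → Vector (Vector ℝ n) m → Vector ℝ n
combination λs p k = sum λ i → λs i * p i k

aff : ∀ {m n} → Vector (Vector ℝ n) m → Pred (Vector ℝ n) 0ℓ
aff p x = ∃ λ λs → sum λs ≃ 1ℝ × combination λs p ≋ x

conv : ∀ {m n} → Vector (Vector ℝ n) m → Pred (Vector ℝ n) 0ℓ
conv p x = ∃ λ λs → (∀ i → 0ℝ ≤ λs i) × sum λs ≃ 1ℝ × combination λs p ≋ x

-- No nonzero family of coefficients with sum zero annihilates p.  Both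
-- "nonzero" are apartness, which classically is the negation of equality
-- and constructively is the informative form.
AffinelyIndependent : ∀ {m n} → Pred (Vector (Vector ℝ n) m) 0ℓ
AffinelyIndependent p =
  ∀ μ → sum μ ≃ 0ℝ → μ ≭ origin → combination μ p ≭ origin

-- The affine hull of X has dimension d.
HasDimension : ∀ {n} → Pred (Vector ℝ n) 0ℓ → ℕ → Set
HasDimension {n} X d = Σ (Vector (Vector ℝ n) (suc d)) λ q →
  (∀ i → X (q i)) × AffinelyIndependent q × (∀ x → X x → aff q x)

IsSimplex : ∀ {n} → Pred (Vector ℝ n) 0ℓ → Set
IsSimplex {n} X = ∃ λ d → Σ (Vector (Vector ℝ n) (suc d)) λ q →
  AffinelyIndependent q × (∀ x → X x ⇔ conv q x)

module _ {m n : ℕ} (p : Vector (Vector ℝ n) m) where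

  Valid : Vector ℝ n → ℝ → Set
  Valid c b = ∀ x → conv p x → dot c x ≤ b

  -- The face of conv p cut out by a valid inequality c · x ≤ b.
  face : Vector ℝ n → ℝ → Pred (Vector ℝ n) 0ℓ
  face c b x = conv p x × dot c x ≃ b

  IsVertex : Pred (Vector ℝ n) 0ℓ
  IsVertex v = ∃₂ λ c b → Valid c b × (∀ x → face c b x ⇔ x ≋ v)

-- For full-dimensional conv p, so that its facets have codimension 1 in ℝⁿ⁺¹.
module _ {m n : ℕ} (p : Vector (Vector ℝ (suc n)) m) where

  IsPolytopeFacet : Vector ℝ (suc n) → ℝ → Set
  IsPolytopeFacet c b = Valid p c b × HasDimension (face p c b) n

  IsSimplicialPolytope : Set
  IsSimplicialPolytope =
    HasDimension (conv p) (suc n) ×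
    (∀ c b → IsPolytopeFacet c b → IsSimplex (face p c b))

  -- S is the vertex set of a facet, when p lists the vertices of conv p
  -- without repetition: the vertices of a face are those of conv p on it.
  IsFacetVertexSet : Pred (Subset m) 0ℓ
  IsFacetVertexSet S =
    ∃₂ λ c b → IsPolytopeFacet c b × (∀ i → i ∈ₛ S ⇔ face p c b (p i))

------------------------------------------------------------------------
-- Graphs, with vertices in an ambient type X.

record Graph (X : Set) : Set₁ where
  field
    Vertex   : Pred X 0ℓ
    _~_      : Rel X 0ℓ
    ~-vertex : ∀ {u v} → u ~ v → Vertex u × Vertex v
    ~-sym    : ∀ {u v} → u ~ v → v ~ u
    ~-irrefl : ∀ {u} → ¬ (u ~ u)

module _ {X : Set} (G : Graph X) where
  open Graph G

  Connected : Set
  Connected = ∃ Vertex × (∀ u v → Vertex u → Vertex v → Star _~_ u v)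

  delete : Pred X 0ℓ → Graph X
  delete F = record
    { Vertex   = λ u → Vertex u × ¬ F u
    ; _~_      = λ u v → u ~ v × ¬ F u × ¬ F v
    ; ~-vertex = λ (a , ¬u , ¬v) → (proj₁ (~-vertex a) , ¬u) , (proj₂ (~-vertex a) , ¬v)
    ; ~-sym    = λ (a , ¬u , ¬v) → ~-sym a , ¬v , ¬u
    ; ~-irrefl = λ (a , _) → ~-irrefl a
    }

-- Planarity: a drawing in ℝ² whose edges are arcs that meet only in
-- common endpoints.

UnitInterval : Pred ℝ 0ℓ
UnitInterval t = 0ℝ ≤ t × t ≤ 1ℝ

-- ∣ x - y ∣ < ε
Close : ℝ → ℝ → ℝ → Set
Close ε x y = x < y + ε × y < x + ε

record IsArc (γ : ℝ → Vector ℝ 2) (a b : Vector ℝ 2) : Set where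
  field
    continuous : ∀ s → UnitInterval s → ∀ ε → 0ℝ < ε →
                 ∃ λ δ → 0ℝ < δ ×
                   (∀ t → UnitInterval t → Close δ s t → ∀ k → Close ε (γ s k) (γ t k))
    injective  : ∀ s t → UnitInterval s → UnitInterval t → γ s ≋ γ t → s ≃ t
    start      : γ 0ℝ ≋ a
    end        : γ 1ℝ ≋ b

-- An edge is drawn once for each of its two orientations; the two curves
-- are unrelated, and discarding one of them gives a drawing of the edge.
record Planar {X : Set} (G : Graph X) : Set where
  open Graph G
  field
    point           : X → Vector ℝ 2
    arc             : X → X → ℝ → Vector ℝ 2
    point-injective : ∀ u v → Vertex u → Vertex v → point u ≋ point v → u ≡ v
    arc-isArc       : ∀ u v → u ~ v → IsArc (arc u v) (point u) (point v)
    avoids-points   : ∀ u v w → u ~ v → Vertex w →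
                      ∀ t → 0ℝ < t → t < 1ℝ → ¬ (arc u v t ≋ point w)
    avoids-arcs     : ∀ u v u′ v′ → u ~ v → u′ ~ v′ →
                      ¬ ((u ≡ u′ × v ≡ v′) ⊎ (u ≡ v′ × v ≡ u′)) →
                      ∀ s t → 0ℝ < s → s < 1ℝ → UnitInterval t →
                      ¬ (arc u v s ≋ arc u′ v′ t)

------------------------------------------------------------------------
-- Simplicial complexes on Fin n, given by their faces.

Complex : ℕ → Set₁
Complex n = Pred (Subset n) 0ℓ

generated : ∀ {n} → Pred (Subset n) 0ℓ → Complex n
generated F σ = ∃ λ S → F S × σ ⊆ S

module _ {n : ℕ} (K : Complex n) where

  Facet : Pred (Subset n) 0ℓ
  Facet S = K S × (∀ T → K T → S ⊆ T → S ≡ T)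

  -- Ridges, for pure 3-dimensional K.
  Ridge : Pred (Subset n) 0ℓ
  Ridge R = K R × ∣ R ∣ ≡ 3

  BoundaryRidge : Pred (Subset n) 0ℓ
  BoundaryRidge R = Ridge R × ∃! _≡_ λ S → Facet S × R ⊆ S

  facetRidgeGraph : Graph (Subset n)
  facetRidgeGraph = record
    { Vertex   = Facet
    ; _~_      = λ S T → Facet S × Facet T × S ≢ T ×
                         ∃ λ R → Ridge R × R ⊆ S × R ⊆ T
    ; ~-vertex = λ (s , t , _) → s , t
    ; ~-sym    = λ (s , t , s≢t , R , r , R⊆S , R⊆T) →
                   t , s , (λ t≡s → s≢t (sym t≡s)) , R , r , R⊆T , R⊆S
    ; ~-irrefl = λ (_ , _ , s≢s , _) → s≢s refl
    }

  star : Fin n → Complex n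
  star v = generated λ S → Facet S × v ∈ₛ S

-- generated F is a Perles piece in Δ.
record IsPerlesPiece {n} (Δ : Complex n) (F : Pred (Subset n) 0ℓ) : Set where
  field
    facets            : ∀ S → F S → Facet Δ S
    connected         : Connected (facetRidgeGraph (generated F))
    one-boundaryRidge : ∀ S → F S →
                        ∃! _≡_ λ R → BoundaryRidge (generated F) R × R ⊆ S

NonSeparating : ∀ {n} → Complex n → Pred (Subset n) 0ℓ → Set
NonSeparating Δ F = Connected (delete (facetRidgeGraph Δ) F)

boundaryComplex : ∀ {m n} → Vector (Vector ℝ (suc n)) m → Complex m
boundaryComplex p = generated (IsFacetVertexSet p)

------------------------------------------------------------------------
-- The twelve points and the 26 four-element sets.

coordinates : Vec (Vec ℤ 4) 12
coordinates =
  (  + 27   ∷ - + 95  ∷   + 120 ∷   + 0   ∷ []) ∷  -- A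
  (- + 50   ∷ - + 45  ∷   + 101 ∷ - + 94  ∷ []) ∷  -- B
  (- + 9    ∷ - + 67  ∷   + 126 ∷ - + 35  ∷ []) ∷  -- C
  (  + 195  ∷ - + 145 ∷   + 11  ∷   + 125 ∷ []) ∷  -- D
  (- + 40   ∷ - + 10  ∷   + 8   ∷ - + 65  ∷ []) ∷  -- E
  (  + 232  ∷ - + 102 ∷ - + 21  ∷   + 198 ∷ []) ∷  -- F
  (- + 63   ∷ - + 25  ∷   + 94  ∷ - + 139 ∷ []) ∷  -- G
  (- + 80   ∷   + 45  ∷ - + 49  ∷ - + 65  ∷ []) ∷  -- H
  (- + 72   ∷   + 4   ∷   + 24  ∷ - + 90  ∷ []) ∷  -- I
  (- + 30   ∷   + 167 ∷ - + 154 ∷   + 92  ∷ []) ∷  -- J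
  (- + 43   ∷   + 190 ∷ - + 199 ∷   + 100 ∷ []) ∷  -- K
  (- + 67   ∷   + 80  ∷ - + 61  ∷ - + 26  ∷ []) ∷  -- L
  []

points : Vector (Vector ℝ 4) 12
points i k = fromℤ (Vec.lookup (Vec.lookup coordinates i) k)

A B C D E F G H I J K L : Fin 12
A = # 0
B = # 1
C = # 2
D = # 3
E = # 4
F = # 5
G = # 6
H = # 7
I = # 8
J = # 9
K = # 10
L = # 11

word : Fin 12 → Fin 12 → Fin 12 → Fin 12 → Subset 12
word a b c d = ⁅ a ⁆ ∪ ⁅ b ⁆ ∪ ⁅ c ⁆ ∪ ⁅ d ⁆

pieceList : List (Subset 12)
pieceList =
  word G H K L ∷ word D G H K ∷ word F G J K ∷ word E G H I ∷ word G J K L ∷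
  word D F G K ∷ word G H I L ∷ word D E G H ∷ word C D F G ∷ word A C D F ∷
  word A C F J ∷ word A F J K ∷ word A C J K ∷ word B C J K ∷ word B J K L ∷
  word B D E G ∷ word A B D E ∷ word A B E I ∷ word A E H I ∷ word A B H I ∷
  word B C H I ∷ word C H I L ∷ word A C D G ∷ word B C K L ∷ word A B D G ∷
  word B C I L ∷ []

Piece : Pred (Subset 12) 0ℓ
Piece S = S ∈ pieceList

{-# OPTIONS --safe #-}

-- The 12 points are in general position, and a finite computation over ℤ
-- decides for each of the 495 four-element subsets S of them whether all other
-- points lie strictly on one side of the hyperplane spanned by S; this happens
-- for 38 subsets.  A face of dimension 3 given by arbitrary real c, b contains
-- four affinely independent points, whose barycentric coordinates form a matrix
-- of rank 4; elimination finds four distinct columns with a nonzero entry, and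
-- by complementary slackness the corresponding four of the 12 points lie on the
-- face.  If they are not one of the 38 subsets, then b − c · x, being a multiple
-- of their functional and nonnegative, vanishes at a fifth point, and the face
-- has dimension 4.  Hence the facets are the 38 subsets, all of them simplices,
-- and what is left is combinatorics of an explicit complex.  For planarity,
-- any two segments of an explicit straight-line drawing are separated by an
-- affine functional with integer coefficients.
module Submission where

open import Algebra.Bundles using (CommutativeRing)
open import Algebra.Morphism.Structures using (IsRingHomomorphism)
import Algebra.Properties.Ring as RingProperties
import Algebra.Properties.Semiring.Sum as SemiringSum
import Algebra.Solver.Ring as RingSolver
open import Algebra.Solver.Ring.AlmostCommutativeRing using (fromCommutativeRing; _-Raw-AlmostCommutative⟶_)
open import Algebra.Structures using (IsCommutativeRing)
import Data.Bool.Properties as Bool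
open import Data.Empty using (⊥-elim)
open import Data.Fin using (Fin; zero; suc; punchIn; punchOut; _↑ˡ_)
open import Data.Fin.Properties using (all?; any?; ¬∀⟶∃¬; suc-injective; 0≢1+n; punchInᵢ≢i; punchIn-punchOut; punchIn-injective; ↑ˡ-injective; injective⇒≤) renaming (_≟_ to _≟ᶠ_)
open import Data.Fin.Subset as Subset using (Subset; inside; outside; _⊆_; _∩_; _∪_; _-_; ⁅_⁆; ∣_∣; ⊥) renaming (_∈_ to _∈ₛ_; _∉_ to _∉ₛ_)
open import Data.Fin.Subset.Properties using (_∈?_; _⊆?_; ⊆-refl; ⊆-antisym; p⊆q⇒∣p∣≤∣q∣; p⊂q⇒∣p∣<∣q∣; x∈⁅x⁆; x∈⁅y⁆⇒x≡y; x∈p∪q⁺; x∈p∪q⁻; x∈p∩q⁺; p∩q⊆p; p∩q⊆q; p─q⊆p; x∈p∧x≢y⇒x∈p-y; ∉⊥; ∣⊥∣≡0; ∪-identityˡ; ∩-idem; p─⊥≡p)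
open import Data.Integer as ℤ using (ℤ; +_; -[1+_]; 0ℤ; 1ℤ)
import Data.Integer.Properties as ℤ
import Data.Integer.Solver as ℤ
open import Data.List using (List; []; _∷_; _++_; map; filter; cartesianProduct)
import Data.List.Membership.DecPropositional as DecMembership
open import Data.List.Membership.Propositional using (_∈_; _∉_; find)
open import Data.List.Membership.Propositional.Properties using (∈-++⁺ˡ; ∈-++⁺ʳ; ∈-++⁻; ∈-map⁺; ∈-filter⁺; ∈-cartesianProduct⁺)
open import Data.List.Relation.Unary.All as All using (All; []; _∷_)
open import Data.List.Relation.Unary.Any as Any using (Any; here; there)
open import Data.Maybe using (Maybe; just; nothing)
open import Data.Nat as ℕ using (ℕ; zero; suc)
import Data.Nat.Properties as ℕ
open import Data.Product using (Σ; ∃; ∃₂; ∃!; _×_; _,_; proj₁; proj₂)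
open import Data.Rational as ℚ using (ℚ; 0ℚ; ½)
import Data.Rational.Properties as ℚ
import Data.Rational.Solver as ℚ
open import Data.Rational.Unnormalised as ℚᵘ using (mkℚᵘ)
import Data.Rational.Unnormalised.Properties as ℚᵘ
open import Data.Sum using (_⊎_; inj₁; inj₂; [_,_]′; fromInj₂)
open import Data.Unit using (⊤; tt)
open import Data.Vec as Vec using (Vec; []; _∷_; lookup; here; there)
open import Data.Vec.Functional as Vector using (Vector; removeAt)
import Data.Vec.Properties as Vec
open import Function using (_∘_; id)
open import Function.Bundles using (_⇔_; mk⇔; Equivalence)
open import Function.Definitions using (Injective)
open import Level using (0ℓ)
open import Relation.Binary.Construct.Closure.ReflexiveTransitive as Closure using (Star; _◅_; _◅◅_; reverse)
open import Relation.Binary.Core using (Rel)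
open import Relation.Binary.Definitions using (DecidableEquality)
open import Relation.Binary.PropositionalEquality as ≡ using (_≡_; _≢_; cong; cong₂; subst; subst₂)
open import Relation.Nullary using (¬_; Dec; yes; no; contradiction)
open import Relation.Nullary.Decidable using (_×-dec_; _⊎-dec_; _→-dec_; ¬?; map′; toWitness; decidable-stable)
open import Relation.Unary using (Pred)
open import Defs using (coordinates; pieceList; Piece; word; A; B; C; D; E; F; G; H; I; J; K; L)

-- Linear algebra and convexity over an ordered ring

-- The order of the Cauchy reals is undecidable, and this shapes the argument. A step cannot ask
-- whether a real number is zero: `x #0` means apartness, which passes from a sum or a product to
-- one of its parts, and tightness turns a refuted apartness into an equation. Case distinctions
-- rest on cotransitivity, on integers or on finite sets. In particular, the vertices on a face with
-- real `c` and `b` cannot be found by testing each point; they are read off from the weights of the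
-- points that witness its dimension. Reciprocals are available for nonzero integers only. Hence
-- elimination multiplies crosswise instead of dividing, and coordinates with respect to five of the
-- points come from a dual basis of integer normals, whose diagonal values are nonzero integers.

module IntegerCoefficients (R : CommutativeRing 0ℓ 0ℓ)
  (fromℤ : ℤ → CommutativeRing.Carrier R)
  (isHomomorphism : IsRingHomomorphism ℤ.+-*-rawRing (CommutativeRing.rawRing R) fromℤ) where

  open CommutativeRing R using (_≈_) renaming (reflexive to ≈-reflexive)
  open IsRingHomomorphism isHomomorphism

  homomorphism : ℤ.+-*-rawRing -Raw-AlmostCommutative⟶ fromCommutativeRing R
  homomorphism = record
    { ⟦_⟧ = fromℤ ; +-homo = +-homo ; *-homo = *-homo ; -‿homo = -‿homo ; 0-homo = 0#-homo ; 1-homo = 1#-homo }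

  -- Normal forms compare coefficients. Equality is decidable in ℤ but not in the ring of reals, so
  -- the solver takes its coefficients from ℤ.
  equal? : ∀ i j → Maybe (fromℤ i ≈ fromℤ j)
  equal? i j with i ℤ.≟ j
  ... | yes eq = just (≈-reflexive (cong fromℤ eq))
  ... | no  _  = nothing

  open RingSolver ℤ.+-*-rawRing (fromCommutativeRing R) homomorphism equal? public

-- `<-cotrans` is the constructive substitute for trichotomy, and `*-apartˡ` lets a factor of a
-- positive product decide its sign.
record OrderedRing : Set₁ where
  infix 4 _<_
  field
    commutativeRing : CommutativeRing 0ℓ 0ℓ
  open CommutativeRing commutativeRing public
  field
    _<_       : Carrier → Carrier → Set
    <-resp-≈  : ∀ {x y u v} → x ≈ y → u ≈ v → x < u → y < v
    <-irrefl  : ∀ x → ¬ (x < x)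
    <-trans   : ∀ {x y z} → x < y → y < z → x < z
    <-cotrans : ∀ {x y} → x < y → ∀ z → x < z ⊎ z < y
    <-tight   : ∀ {x y} → ¬ (x < y) → ¬ (y < x) → x ≈ y
    +-monoˡ-< : ∀ {x y} z → x < y → x + z < y + z
    *-pos     : ∀ {x y} → 0# < x → 0# < y → 0# < x * y
    *-apartˡ  : ∀ {x y} → 0# < x * y → x < 0# ⊎ 0# < x
    fromℤ     : ℤ → Carrier
    fromℤ-isHomomorphism : IsRingHomomorphism ℤ.+-*-rawRing rawRing fromℤ
    fromℤ-pos : ∀ {i} → 0ℤ ℤ.< i → 0# < fromℤ i
    fromℤ-inverse : ∀ {i} → i ≢ 0ℤ → ∃ λ x → fromℤ i * x ≈ 1#

module LinearAlgebra (𝓡 : OrderedRing) where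

  open OrderedRing 𝓡 hiding (zero)
  open RingProperties ring using (-0#≈0#; -‿involutive)
  open SemiringSum semiring using (sum; sum-cong-≋; sum-remove; ∑-comm; *-distribˡ-sum; *-distribʳ-sum)
  open IntegerCoefficients commutativeRing fromℤ fromℤ-isHomomorphism
  open IsRingHomomorphism fromℤ-isHomomorphism
  open import Relation.Binary.Reasoning.Setoid setoid

  -- Order and apartness

  infix 4 _≤_ _#0
  _≤_ : Carrier → Carrier → Set
  x ≤ y = ¬ (y < x)

  _#0 : Carrier → Set
  x #0 = x < 0# ⊎ 0# < x

  <0⇒-pos : ∀ {x} → x < 0# → 0# < - x
  <0⇒-pos {x} x<0 = <-resp-≈ (-‿inverseʳ x) (+-identityˡ (- x)) (+-monoˡ-< (- x) x<0)

  pos⇒-<0 : ∀ {x} → 0# < x → - x < 0#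
  pos⇒-<0 {x} 0<x = <-resp-≈ (+-identityˡ (- x)) (-‿inverseʳ x) (+-monoˡ-< (- x) 0<x)

  #0-cong : ∀ {x y} → x ≈ y → x #0 → y #0
  #0-cong x≈y (inj₁ x<0) = inj₁ (<-resp-≈ x≈y refl x<0)
  #0-cong x≈y (inj₂ 0<x) = inj₂ (<-resp-≈ refl x≈y 0<x)

  #0-neg : ∀ {x} → x #0 → (- x) #0
  #0-neg (inj₁ x<0) = inj₂ (<0⇒-pos x<0)
  #0-neg (inj₂ 0<x) = inj₁ (pos⇒-<0 0<x)

  ¬0#0 : ¬ (0# #0)
  ¬0#0 (inj₁ h) = <-irrefl 0# h
  ¬0#0 (inj₂ h) = <-irrefl 0# h

  x+y-y≈x : ∀ x y → x + y + - y ≈ x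
  x+y-y≈x = solve 2 (λ x y → x :+ y :+ :- y := x) refl

  -- Cotransitivity places `y` between `x + y` and `0#`: either `x` accounts for the distance from
  -- `x + y` to `y`, or `y` is itself away from zero.
  #0-+ : ∀ {x y} → (x + y) #0 → x #0 ⊎ y #0
  #0-+ {x} {y} (inj₁ h) with <-cotrans h y
  ... | inj₁ x+y<y = inj₁ (inj₁ (<-resp-≈ (x+y-y≈x x y) (-‿inverseʳ y) (+-monoˡ-< (- y) x+y<y)))
  ... | inj₂ y<0 = inj₂ (inj₁ y<0)
  #0-+ {x} {y} (inj₂ h) with <-cotrans h y
  ... | inj₁ 0<y = inj₂ (inj₂ 0<y)
  ... | inj₂ y<x+y = inj₁ (inj₂ (<-resp-≈ (-‿inverseʳ y) (x+y-y≈x x y) (+-monoˡ-< (- y) y<x+y)))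

  #0-*ˡ : ∀ {x y} → (x * y) #0 → x #0
  #0-*ˡ (inj₂ h) = *-apartˡ h
  #0-*ˡ {x} {y} (inj₁ h) = *-apartˡ (<-resp-≈ refl move (<0⇒-pos h))
    where
    move : - (x * y) ≈ x * - y
    move = solve 2 (λ x y → :- (x :* y) := x :* :- y) refl x y

  #0-*ʳ : ∀ {x y} → (x * y) #0 → y #0
  #0-*ʳ {x} {y} h = #0-*ˡ (#0-cong (*-comm x y) h)

  #0-* : ∀ {x y} → x #0 → y #0 → (x * y) #0
  #0-* {x} {y} (inj₁ x<0) (inj₁ y<0) = inj₂ (<-resp-≈ refl eq (*-pos (<0⇒-pos x<0) (<0⇒-pos y<0)))
    where
    eq : - x * - y ≈ x * y
    eq = solve 2 (λ x y → :- x :* :- y := x :* y) refl x y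
  #0-* {x} {y} (inj₁ x<0) (inj₂ 0<y) = #0-cong eq (#0-neg (inj₂ (*-pos (<0⇒-pos x<0) 0<y)))
    where
    eq : - (- x * y) ≈ x * y
    eq = solve 2 (λ x y → :- (:- x :* y) := x :* y) refl x y
  #0-* {x} {y} (inj₂ 0<x) (inj₁ y<0) = #0-cong eq (#0-neg (inj₂ (*-pos 0<x (<0⇒-pos y<0))))
    where
    eq : - (x * - y) ≈ x * y
    eq = solve 2 (λ x y → :- (x :* :- y) := x :* y) refl x y
  #0-* (inj₂ 0<x) (inj₂ 0<y) = inj₂ (*-pos 0<x 0<y)

  #0-sum : ∀ {n} (v : Vector Carrier n) → sum v #0 → ∃ λ i → v i #0
  #0-sum {zero}  v h = ⊥-elim (¬0#0 h)
  #0-sum {suc n} v h with #0-+ h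
  ... | inj₁ v₀#0 = zero , v₀#0
  ... | inj₂ rest = let (i , vᵢ#0) = #0-sum (v ∘ suc) rest in suc i , vᵢ#0

  -- Tightness: an equation may be proved by refuting both signs, so inside the refutation the sign
  -- is known.
  ≈0-stable : ∀ {x} → ¬ (x #0) → x ≈ 0#
  ≈0-stable h = <-tight (h ∘ inj₁) (h ∘ inj₂)

  ≈0⇒¬#0 : ∀ {x} → x ≈ 0# → ¬ (x #0)
  ≈0⇒¬#0 x≈0 h = ¬0#0 (#0-cong x≈0 h)

  *-zero-cancelʳ : ∀ {x y} → x * y ≈ 0# → y #0 → x ≈ 0#
  *-zero-cancelʳ xy≈0 y#0 = ≈0-stable λ x#0 → ≈0⇒¬#0 xy≈0 (#0-* x#0 y#0)

  x-y≈0⇒x≈y : ∀ {x y} → x + - y ≈ 0# → x ≈ y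
  x-y≈0⇒x≈y {x} {y} h = begin
    x             ≈⟨ solve 2 (λ x y → x := x :+ :- y :+ y) refl x y ⟩
    x + - y + y   ≈⟨ +-congʳ h ⟩
    0# + y        ≈⟨ +-identityˡ y ⟩
    y             ∎

  <⇒pos-difference : ∀ {x y} → x < y → 0# < y + - x
  <⇒pos-difference {x} x<y = <-resp-≈ (-‿inverseʳ x) refl (+-monoˡ-< (- x) x<y)

  pos-difference⇒< : ∀ {x y} → 0# < y + - x → x < y
  pos-difference⇒< {x} {y} h = <-resp-≈ (+-identityˡ x) eq (+-monoˡ-< x h)
    where
    eq : y + - x + x ≈ y
    eq = solve 2 (λ x y → y :+ :- x :+ x := y) refl x y

  ≤⇒nonneg-difference : ∀ {x y} → x ≤ y → 0# ≤ y + - x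
  ≤⇒nonneg-difference {x} {y} x≤y h = x≤y (pos-difference⇒< (<-resp-≈ refl eq (<0⇒-pos h)))
    where
    eq : - (y + - x) ≈ x + - y
    eq = solve 2 (λ x y → :- (y :+ :- x) := x :+ :- y) refl x y

  ≤-reflexive : ∀ {x y} → x ≈ y → x ≤ y
  ≤-reflexive x≈y y<x = <-irrefl _ (<-resp-≈ refl x≈y y<x)

  ≤-resp-≈ : ∀ {x y u v} → x ≈ y → u ≈ v → x ≤ u → y ≤ v
  ≤-resp-≈ x≈y u≈v x≤u v<y = x≤u (<-resp-≈ (sym u≈v) (sym x≈y) v<y)

  <⇒≤ : ∀ {x y} → x < y → x ≤ y
  <⇒≤ x<y y<x = <-irrefl _ (<-trans x<y y<x)

  nonneg-+ : ∀ {x y} → 0# ≤ x → 0# ≤ y → 0# ≤ x + y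
  nonneg-+ {x} {y} 0≤x 0≤y h with <-cotrans h y
  ... | inj₁ x+y<y = 0≤x (<-resp-≈ (x+y-y≈x x y) (-‿inverseʳ y) (+-monoˡ-< (- y) x+y<y))
  ... | inj₂ y<0 = 0≤y y<0

  nonneg-sum : ∀ {n} (v : Vector Carrier n) → (∀ i → 0# ≤ v i) → 0# ≤ sum v
  nonneg-sum {zero}  v h = <-irrefl 0#
  nonneg-sum {suc n} v h = nonneg-+ (h zero) (nonneg-sum (v ∘ suc) (h ∘ suc))

  -- A negative product has both factors apart from zero, so their signs are known while the
  -- negativity is being refuted.
  nonneg-* : ∀ {x y} → 0# ≤ x → 0# ≤ y → 0# ≤ x * y
  nonneg-* {x} {y} 0≤x 0≤y h with #0-*ˡ {x} {y} (inj₁ h) | #0-*ʳ {x} {y} (inj₁ h)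
  ... | inj₁ x<0 | _        = 0≤x x<0
  ... | inj₂ _   | inj₁ y<0 = 0≤y y<0
  ... | inj₂ 0<x | inj₂ 0<y = <⇒≤ (*-pos 0<x 0<y) h

  pos-+-nonneg : ∀ {x y} → 0# < x → 0# ≤ y → 0# < x + y
  pos-+-nonneg {x} {y} 0<x 0≤y with <-cotrans (<-resp-≈ (+-identityˡ y) refl (+-monoˡ-< y 0<x)) 0#
  ... | inj₁ y<0 = ⊥-elim (0≤y y<0)
  ... | inj₂ 0<x+y = 0<x+y

  pos-sum : ∀ {n} (v : Vector Carrier n) → (∀ i → 0# ≤ v i) → ∀ i → 0# < v i → 0# < sum v
  pos-sum v h zero    0<vᵢ = pos-+-nonneg 0<vᵢ (nonneg-sum (v ∘ suc) (h ∘ suc))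
  pos-sum v h (suc i) 0<vᵢ = <-resp-≈ refl (+-comm _ _)
    (pos-+-nonneg (pos-sum (v ∘ suc) (h ∘ suc) i 0<vᵢ) (h zero))

  -- Finite sums and linear combinations

  sum-cong : ∀ {n} {u v : Vector Carrier n} → (∀ i → u i ≈ v i) → sum u ≈ sum v
  sum-cong = sum-cong-≋

  sum-zero : ∀ {n} {v : Vector Carrier n} → (∀ i → v i ≈ 0#) → sum v ≈ 0#
  sum-zero {zero}  h = refl
  sum-zero {suc n} h = trans (+-cong (h zero) (sum-zero (h ∘ suc))) (+-identityˡ 0#)

  0<1# : 0# < 1#
  0<1# = <-resp-≈ refl 1#-homo (fromℤ-pos (ℤ.+<+ (ℕ.s≤s ℕ.z≤n)))

  fromℤ-#0 : ∀ {i} → i ≢ 0ℤ → fromℤ i #0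
  fromℤ-#0 {+ zero}       i≢0 = ⊥-elim (i≢0 ≡.refl)
  fromℤ-#0 {+ suc n}      i≢0 = inj₂ (fromℤ-pos (ℤ.+<+ (ℕ.s≤s ℕ.z≤n)))
  fromℤ-#0 {ℤ.-[1+ n ]} i≢0 = #0-cong (sym (-‿homo (+ suc n))) (#0-neg (inj₂ (fromℤ-pos (ℤ.+<+ (ℕ.s≤s ℕ.z≤n)))))

  fromℤ-nonneg : ∀ {i} → 0ℤ ℤ.≤ i → 0# ≤ fromℤ i
  fromℤ-nonneg {+ zero}  _ h = <-irrefl 0# (<-resp-≈ 0#-homo refl h)
  fromℤ-nonneg {+ suc n} _ = <⇒≤ (fromℤ-pos (ℤ.+<+ (ℕ.s≤s ℕ.z≤n)))

  dot : ∀ {n} → Vector Carrier n → Vector Carrier n → Carrier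
  dot c x = sum λ k → c k * x k

  combination : ∀ {m n} → Vector Carrier m → Vector (Vector Carrier n) m → Vector Carrier n
  combination μ p k = sum λ i → μ i * p i k

  dot-congʳ : ∀ {n} (c : Vector Carrier n) {x y} → (∀ k → x k ≈ y k) → dot c x ≈ dot c y
  dot-congʳ c x≋y = sum-cong λ k → *-congˡ (x≋y k)

  sum-assoc : ∀ {m n} (a : Vector Carrier m) (M : Vector (Vector Carrier n) m) (b : Vector Carrier n) →
              sum (λ i → a i * sum (λ j → M i j * b j)) ≈ sum (λ j → sum (λ i → a i * M i j) * b j)
  sum-assoc a M b = begin
    sum (λ i → a i * sum (λ j → M i j * b j))     ≈⟨ sum-cong (λ i → *-distribˡ-sum (a i) (λ j → M i j * b j)) ⟩
    sum (λ i → sum (λ j → a i * (M i j * b j)))   ≈⟨ ∑-comm (λ i j → a i * (M i j * b j)) ⟩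
    sum (λ j → sum (λ i → a i * (M i j * b j)))   ≈⟨ sum-cong (λ j → sum-cong λ i → sym (*-assoc (a i) (M i j) (b j))) ⟩
    sum (λ j → sum (λ i → a i * M i j * b j))     ≈⟨ sum-cong (λ j → sym (*-distribʳ-sum (b j) (λ i → a i * M i j))) ⟩
    sum (λ j → sum (λ i → a i * M i j) * b j)     ∎

  dot-combination : ∀ {m n} (c : Vector Carrier n) (μ : Vector Carrier m) (p : Vector (Vector Carrier n) m) →
                    dot c (combination μ p) ≈ sum (λ i → μ i * dot c (p i))
  dot-combination c μ p = begin
    sum (λ k → c k * sum (λ i → μ i * p i k))   ≈⟨ sum-cong (λ k → *-comm (c k) _) ⟩
    sum (λ k → sum (λ i → μ i * p i k) * c k)   ≈⟨ sum-assoc μ p c ⟨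
    sum (λ i → μ i * sum (λ k → p i k * c k))   ≈⟨ sum-cong (λ i → *-congˡ (sum-cong λ k → *-comm (p i k) (c k))) ⟩
    sum (λ i → μ i * dot c (p i))               ∎

  unit : ∀ {n} → Fin n → Vector Carrier n
  unit zero    zero    = 1#
  unit zero    (suc j) = 0#
  unit (suc i) zero    = 0#
  unit (suc i) (suc j) = unit i j

  dot-unit : ∀ {n} (i : Fin n) (v : Vector Carrier n) → dot (unit i) v ≈ v i
  dot-unit zero v = trans (+-cong (*-identityˡ (v zero)) (sum-zero λ j → zeroˡ (v (suc j)))) (+-identityʳ (v zero))
  dot-unit (suc i) v = trans (+-cong (zeroˡ (v zero)) (dot-unit i (v ∘ suc))) (+-identityˡ (v (suc i)))

  sum-unit : ∀ {n} (i : Fin n) → sum (unit i) ≈ 1#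
  sum-unit i = trans (sum-cong λ j → sym (*-identityʳ (unit i j))) (dot-unit i (λ _ → 1#))

  unit-nonneg : ∀ {n} (i j : Fin n) → 0# ≤ unit i j
  unit-nonneg zero    zero    = <⇒≤ 0<1#
  unit-nonneg zero    (suc j) = <-irrefl 0#
  unit-nonneg (suc i) zero    = <-irrefl 0#
  unit-nonneg (suc i) (suc j) = unit-nonneg i j

  1#0 : 1# #0
  1#0 = inj₂ 0<1#

  unit-≡ : ∀ {n} (i : Fin n) → unit i i ≈ 1#
  unit-≡ zero    = refl
  unit-≡ (suc i) = unit-≡ i

  unit-≢ : ∀ {n} (i j : Fin n) → i ≢ j → unit i j ≈ 0#
  unit-≢ zero    zero    i≢j = ⊥-elim (i≢j ≡.refl)
  unit-≢ zero    (suc j) i≢j = refl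
  unit-≢ (suc i) zero    i≢j = refl
  unit-≢ (suc i) (suc j) i≢j = unit-≢ i j (i≢j ∘ cong suc)

  sum-minus : ∀ {n} (u w : Vector Carrier n) → sum (λ i → u i + - w i) ≈ sum u + - sum w
  sum-minus {zero} u w = sym (trans (+-identityˡ _) -0#≈0#)
  sum-minus {suc n} u w = trans (+-congˡ (sum-minus (u ∘ suc) (w ∘ suc)))
    (solve 4 (λ a b x y → a :+ :- b :+ (x :+ :- y) := a :+ x :+ :- (b :+ y)) refl
      (u zero) (w zero) (sum (u ∘ suc)) (sum (w ∘ suc)))

  combination-congʳ : ∀ {m n} (μ : Vector Carrier m) (p q : Vector (Vector Carrier n) m) →
                      (∀ j t → p j t ≈ q j t) → ∀ t → combination μ p t ≈ combination μ q t
  combination-congʳ μ p q h t = sum-cong λ j → *-congˡ (h j t)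

  sum-combination : ∀ {m n} (μ : Vector Carrier m) (Λ : Vector (Vector Carrier n) m) →
                    (∀ j → sum (Λ j) ≈ 1#) → sum (combination μ Λ) ≈ sum μ
  sum-combination μ Λ ΣΛ≈1 = begin
    sum (λ i → sum (λ b → μ b * Λ b i))        ≈⟨ ∑-comm (λ i b → μ b * Λ b i) ⟩
    sum (λ b → sum (λ i → μ b * Λ b i))        ≈⟨ sum-cong (λ b → sym (*-distribˡ-sum (μ b) (Λ b))) ⟩
    sum (λ b → μ b * sum (Λ b))                ≈⟨ sum-cong (λ b → trans (*-congˡ (ΣΛ≈1 b)) (*-identityʳ (μ b))) ⟩
    sum μ                                      ∎

  dot-correct : ∀ {n} s (μ u x : Vector Carrier n) →
                sum (λ i → (μ i + - (s * u i)) * x i) ≈ dot μ x + - (s * dot u x)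
  dot-correct s μ u x = begin
    sum (λ i → (μ i + - (s * u i)) * x i)
      ≈⟨ sum-cong (λ i → solve 4 (λ m s u x → (m :+ :- (s :* u)) :* x := m :* x :+ :- (s :* (u :* x))) refl
           (μ i) s (u i) (x i)) ⟩
    sum (λ i → μ i * x i + - (s * (u i * x i)))    ≈⟨ sum-minus (λ i → μ i * x i) (λ i → s * (u i * x i)) ⟩
    dot μ x + - sum (λ i → s * (u i * x i))        ≈⟨ +-congˡ (-‿cong (*-distribˡ-sum s (λ i → u i * x i))) ⟨
    dot μ x + - (s * dot u x)                      ∎

  -- Linear independence

  Nonzero : ∀ {n} → Vector Carrier n → Set
  Nonzero v = ∃ λ i → v i #0

  LinearlyIndependent : ∀ {k n} → Vector (Vector Carrier n) k → Set
  LinearlyIndependent v = ∀ μ → Nonzero μ → Nonzero (combination μ v)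

  -- Fraction-free Gaussian elimination.
  columns : ∀ {k n} (v : Vector (Vector Carrier n) k) → LinearlyIndependent v →
            ∃ λ (e : Vector (Fin n) k) → Injective _≡_ _≡_ e × ∀ j → ∃ λ b → v b (e j) #0
  columns {zero} v indep = (λ ()) , (λ { {()} }) , λ ()
  columns {suc k} v indep = e , e-injective , e-apart
    where
    pivot : ∃ λ t → v zero t #0
    pivot with indep (unit zero) (zero , 1#0)
    ... | t , h = t , #0-cong (dot-unit zero (λ i → v i t)) h

    t₀ = proj₁ pivot
    c = v zero t₀

    -- Two-by-two determinants with the pivot. Column `t₀` of `v′` vanishes, so the recursive call
    -- cannot choose it again.
    v′ : Vector (Vector Carrier _) k
    v′ b t = c * v (suc b) t + - (v (suc b) t₀ * v zero t)

    eliminate : ∀ {m} (μ u w : Vector Carrier m) c z →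
      - sum (λ b → μ b * w b) * z + sum (λ b → c * μ b * u b) ≈ sum (λ b → μ b * (c * u b + - (w b * z)))
    eliminate {zero} μ u w c z = trans (+-identityʳ _) (trans (*-congʳ -0#≈0#) (zeroˡ z))
    eliminate {suc m} μ u w c z = trans
      (solve 7 (λ μ u w c z s t → :- (μ :* w :+ s) :* z :+ (c :* μ :* u :+ t)
                  := μ :* (c :* u :+ :- (w :* z)) :+ (:- s :* z :+ t)) refl
        (μ zero) (u zero) (w zero) c z
        (sum λ b → μ (suc b) * w (suc b)) (sum λ b → c * μ (suc b) * u (suc b)))
      (+-congˡ (eliminate (μ ∘ suc) (u ∘ suc) (w ∘ suc) c z))

    v′-indep : LinearlyIndependent v′
    v′-indep μ (j , μⱼ#0) =
      -- The relation between the reduced rows is lifted to the original ones: factor `c` on the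
      -- later rows, and on the pivot row the coefficient that collects the subtracted terms.
      let (t , h) = indep (- sum (λ b → μ b * v (suc b) t₀) Vector.∷ (λ b → c * μ b)) (suc j , #0-* (proj₂ pivot) μⱼ#0)
      in t , #0-cong (eliminate μ (λ b → v (suc b) t) (λ b → v (suc b) t₀) c (v zero t)) h

    rec = columns v′ v′-indep
    e′ = proj₁ rec

    e : Vector (Fin _) (suc k)
    e = t₀ Vector.∷ e′

    e′≢t₀ : ∀ j → e′ j ≢ t₀
    e′≢t₀ j eq with proj₂ (proj₂ rec) j
    ... | b , h rewrite eq = ≈0⇒¬#0 (trans (+-congʳ (*-comm c (v (suc b) t₀))) (-‿inverseʳ _)) h

    e-injective : Injective _≡_ _≡_ e
    e-injective {zero}  {zero}  _  = ≡.refl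
    e-injective {zero}  {suc j} eq = ⊥-elim (e′≢t₀ j (≡.sym eq))
    e-injective {suc i} {zero}  eq = ⊥-elim (e′≢t₀ i eq)
    e-injective {suc i} {suc j} eq = cong suc (proj₁ (proj₂ rec) eq)

    e-apart : ∀ j → ∃ λ b → v b (e j) #0
    e-apart zero = zero , proj₂ pivot
    -- A nonzero entry of a reduced row is a difference of two products with factors from this
    -- column, one in row `suc b` and one in the pivot row.
    e-apart (suc j) with proj₂ (proj₂ rec) j
    ... | b , h with #0-+ h
    ...   | inj₁ h₁ = suc b , #0-*ʳ h₁
    ...   | inj₂ h₂ = zero , #0-*ʳ (#0-cong (-‿involutive _) (#0-neg h₂))

  -- If a functional has a nonzero coefficient at t, vectors in its kernel
  -- remain independent after the coordinate t is dropped.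
  kernel-trivial : ∀ {n} (v : Vector (Vector Carrier n) n) → LinearlyIndependent v →
                   ∀ f → (∀ i → dot f (v i) ≈ 0#) → ∀ t → f t ≈ 0#
  kernel-trivial {suc n} v indep f f⊥v t = ≈0-stable λ fₜ#0 →
    -- `suc n` vectors would stay independent in `n` coordinates, and their columns would embed
    -- `Fin (suc n)` into `Fin n`.
    let (e , inj , _) = columns (λ i s → v i (punchIn t s)) (dropped fₜ#0)
    in ℕ.<-irrefl ≡.refl (injective⇒≤ {f = e} inj)
    where
    dropped : f t #0 → LinearlyIndependent (λ i s → v i (punchIn t s))
    dropped fₜ#0 μ μ#0 = choose (indep μ μ#0)
      where
      x = combination μ v
      fx≈0 : f t * x t + sum (removeAt (λ k → f k * x k) t) ≈ 0#
      fx≈0 = begin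
        f t * x t + sum (removeAt (λ k → f k * x k) t) ≈⟨ sum-remove (λ k → f k * x k) ⟨
        dot f x                          ≈⟨ dot-combination f μ v ⟩
        sum (λ i → μ i * dot f (v i))    ≈⟨ sum-zero (λ i → trans (*-congˡ (f⊥v i)) (zeroʳ (μ i))) ⟩
        0#                               ∎
      choose : Nonzero x → ∃ λ s → x (punchIn t s) #0
      choose (s , xₛ#0) with t ≟ᶠ s
      ... | no t≢s = punchOut t≢s , subst (λ s → x s #0) (≡.sym (punchIn-punchOut t≢s)) xₛ#0
      -- The nonzero entry is the dropped one. Then `f t * x t` is apart from zero, and since
      -- `dot f x` vanishes, some other term of the sum is too.
      ... | yes ≡.refl with #0-sum (removeAt (λ k → f k * x k) t) (#0-cong rest (#0-neg (#0-* fₜ#0 xₛ#0)))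
        where
        rest : - (f t * x t) ≈ sum (removeAt (λ k → f k * x k) t)
        rest = begin
          - (f t * x t)              ≈⟨ +-identityʳ _ ⟨
          - (f t * x t) + 0#         ≈⟨ +-congˡ fx≈0 ⟨
          - (f t * x t) + (f t * x t + sum (removeAt (λ k → f k * x k) t))
            ≈⟨ solve 2 (λ a b → :- a :+ (a :+ b) := b) refl (f t * x t) _ ⟩
          sum (removeAt (λ k → f k * x k) t) ∎
      ...   | s′ , h = s′ , #0-*ʳ h

  module _ {k n} (v f : Vector (Vector Carrier n) k)
           (diagonal : ∀ j → dot (f j) (v j) #0)
           (off-diagonal : ∀ i j → i ≢ j → dot (f j) (v i) ≈ 0#) where

    dot-dual : ∀ μ j → dot (f j) (combination μ v) ≈ μ j * dot (f j) (v j)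
    dot-dual μ j = trans (dot-combination (f j) μ v) (pick μ v f off-diagonal j)
      where
      pick : ∀ {k n} (μ : Vector Carrier k) (v f : Vector (Vector Carrier n) k) →
             (∀ i j → i ≢ j → dot (f j) (v i) ≈ 0#) → ∀ j →
             sum (λ i → μ i * dot (f j) (v i)) ≈ μ j * dot (f j) (v j)
      pick {suc k} μ v f off j = begin
        sum (λ i → μ i * dot (f j) (v i))  ≈⟨ sum-remove {i = j} (λ i → μ i * dot (f j) (v i)) ⟩
        μ j * dot (f j) (v j) + sum (removeAt (λ i → μ i * dot (f j) (v i)) j)
          ≈⟨ +-congˡ (sum-zero λ i → trans (*-congˡ (off (punchIn j i) j (punchInᵢ≢i j i))) (zeroʳ _)) ⟩
        μ j * dot (f j) (v j) + 0#         ≈⟨ +-identityʳ _ ⟩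
        μ j * dot (f j) (v j)              ∎

    -- Pairing with `f j` isolates `μ j` times a nonzero diagonal value.
    dual⇒independent : LinearlyIndependent v
    dual⇒independent μ (j , μⱼ#0) =
      let (t , h) = #0-sum (λ t → f j t * combination μ v t)
                      (#0-cong (sym (dot-dual μ j)) (#0-* μⱼ#0 (diagonal j)))
      in t , #0-*ʳ h

  -- Affine hulls, convex hulls and faces

  infix 4 _≋_
  _≋_ : ∀ {n} → Vector Carrier n → Vector Carrier n → Set
  x ≋ y = ∀ k → x k ≈ y k

  AffinelyIndependent : ∀ {m n} → Pred (Vector (Vector Carrier n) m) 0ℓ
  AffinelyIndependent p = ∀ μ → sum μ ≈ 0# → Nonzero μ → Nonzero (combination μ p)

  aff conv : ∀ {m n} → Vector (Vector Carrier n) m → Pred (Vector Carrier n) 0ℓ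
  aff p x = ∃ λ μ → sum μ ≈ 1# × combination μ p ≋ x
  conv p x = ∃ λ μ → (∀ i → 0# ≤ μ i) × sum μ ≈ 1# × combination μ p ≋ x

  -- Affine relations become linear ones: coordinate zero of a combination is the sum of its
  -- coefficients.
  homogenize : ∀ {n} → Vector Carrier n → Vector Carrier (suc n)
  homogenize x = 1# Vector.∷ x

  independent⇒affinelyIndependent : ∀ {m n} (q : Vector (Vector Carrier n) m) →
    LinearlyIndependent (homogenize ∘ q) → AffinelyIndependent q
  independent⇒affinelyIndependent q indep μ Σμ≈0 μ#0 with indep μ μ#0
  ... | zero  , h = ⊥-elim (≈0⇒¬#0 (trans (sum-cong λ i → *-identityʳ (μ i)) Σμ≈0) h)
  ... | suc k , h = k , h

  -- A relation μ between the rows with Σ μ small is corrected in one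
  -- coordinate to one with sum zero; if the correction matters, then Σ μ,
  -- which is the sum of the entries of the combined row, is nonzero.
  weights-independent : ∀ {k m n} (p : Vector (Vector Carrier n) m) (q : Vector (Vector Carrier n) (suc (suc k)))
    (Λ : Vector (Vector Carrier m) (suc (suc k))) → (∀ j → sum (Λ j) ≈ 1#) →
    (∀ j → combination (Λ j) p ≋ q j) → AffinelyIndependent q → LinearlyIndependent Λ
  weights-independent {k} p q Λ ΣΛ≈1 Λp≋q indep μ (j , μⱼ#0) = cases (indep μ′ Σμ′≈0 μ′#0)
    where
    -- The correction is made at an index other than `j`, so that `μ′ j` stays nonzero; having at
    -- least two rows provides one.
    l : Fin (suc (suc k))
    l = punchIn j zero
    s : Carrier
    s = sum μ
    μ′ : Vector Carrier (suc (suc k))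
    μ′ i = μ i + - (s * unit l i)
    Σμ′≈0 : sum μ′ ≈ 0#
    Σμ′≈0 = begin
      sum μ′                     ≈⟨ trans (sum-minus μ (λ i → s * unit l i)) (+-congˡ (-‿cong (sym (*-distribˡ-sum s (unit l))))) ⟩
      s + - (s * sum (unit l))   ≈⟨ +-congˡ (-‿cong (trans (*-congˡ (sum-unit l)) (*-identityʳ s))) ⟩
      s + - s                    ≈⟨ -‿inverseʳ s ⟩
      0#                         ∎
    μⱼ≈μ′ⱼ : μ j ≈ μ′ j
    μⱼ≈μ′ⱼ = begin
      μ j                        ≈⟨ +-identityʳ (μ j) ⟨
      μ j + 0#                   ≈⟨ +-congˡ -0#≈0# ⟨
      μ j + - 0#                 ≈⟨ +-congˡ (-‿cong (trans (*-congˡ (unit-≢ l j (punchInᵢ≢i j zero))) (zeroʳ s))) ⟨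
      μ j + - (s * unit l j)     ∎
    μ′#0 : Nonzero μ′
    μ′#0 = j , #0-cong μⱼ≈μ′ⱼ μⱼ#0
    column : ∀ i → combination μ′ Λ i ≈ combination μ Λ i + - (s * Λ l i)
    column i = trans (dot-correct s μ (unit l) (λ b → Λ b i)) (+-congˡ (-‿cong (*-congˡ (dot-unit l (λ b → Λ b i)))))
    expand : ∀ t → combination μ′ q t ≈ sum (λ i → combination μ′ Λ i * p i t)
    expand t = trans (combination-congʳ μ′ q (λ j → combination (Λ j) p) (λ j t → sym (Λp≋q j t)) t)
                     (sum-assoc μ′ Λ (λ i → p i t))
    cases : Nonzero (combination μ′ q) → Nonzero (combination μ Λ)
    cases (t , h) =
      let (i , hᵢ) = #0-sum (λ i → combination μ′ Λ i * p i t) (#0-cong (expand t) h)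
      in cases′ i (#0-+ (#0-cong (column i) (#0-*ˡ hᵢ)))
      where
      cases′ : ∀ i → combination μ Λ i #0 ⊎ (- (s * Λ l i)) #0 → Nonzero (combination μ Λ)
      cases′ i (inj₁ h₁) = i , h₁
      cases′ i (inj₂ h₂) = #0-sum (combination μ Λ)
        (#0-cong (sym (sum-combination μ Λ ΣΛ≈1)) (#0-*ˡ (#0-cong (-‿involutive (s * Λ l i)) (#0-neg h₂))))

  -- The weights of the points `p` over `q` are independent rows of length `m`, and their distinct
  -- columns are an injection into `Fin m`.
  affinelyIndependent⇒≤ : ∀ {k m n} (p : Vector (Vector Carrier n) (suc (suc k))) (q : Vector (Vector Carrier n) m) →
    AffinelyIndependent p → (∀ i → aff q (p i)) → suc (suc k) ℕ.≤ m
  affinelyIndependent⇒≤ p q indep h =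
    let (e , inj , _) = columns (proj₁ ∘ h) (weights-independent q p (proj₁ ∘ h) (proj₁ ∘ proj₂ ∘ h) (proj₂ ∘ proj₂ ∘ h) indep)
    in injective⇒≤ {f = e} inj

  module _ {m k n} (p : Vector (Vector Carrier n) m) (q : Vector (Vector Carrier n) k) where

    private
      compose-point : (μ : Vector Carrier k) (Λ : Vector (Vector Carrier m) k) → (∀ j → combination (Λ j) p ≋ q j) →
                      ∀ {x} → combination μ q ≋ x → combination (combination μ Λ) p ≋ x
      compose-point μ Λ Λp≋q {x} μq≋x t = begin
        sum (λ i → combination μ Λ i * p i t)           ≈⟨ sum-assoc μ Λ (λ i → p i t) ⟨
        sum (λ b → μ b * sum (λ i → Λ b i * p i t))     ≈⟨ sum-cong (λ b → *-congˡ (Λp≋q b t)) ⟩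
        combination μ q t                               ≈⟨ μq≋x t ⟩
        x t                                             ∎

    conv-trans : (∀ j → conv p (q j)) → ∀ {x} → conv q x → conv p x
    conv-trans h (μ , 0≤μ , Σμ≈1 , μq≋x) = combination μ (proj₁ ∘ h) ,
      (λ i → nonneg-sum _ λ b → nonneg-* (0≤μ b) (proj₁ (proj₂ (h b)) i)) ,
      trans (sum-combination μ (proj₁ ∘ h) (proj₁ ∘ proj₂ ∘ proj₂ ∘ h)) Σμ≈1 ,
      compose-point μ (proj₁ ∘ h) (proj₂ ∘ proj₂ ∘ proj₂ ∘ h) μq≋x

  conv⇒aff : ∀ {m n} (p : Vector (Vector Carrier n) m) {x} → conv p x → aff p x
  conv⇒aff p (μ , _ , Σμ≈1 , μp≋x) = μ , Σμ≈1 , μp≋x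

  vertex∈conv : ∀ {m n} (p : Vector (Vector Carrier n) m) i → conv p (p i)
  vertex∈conv p i = unit i , unit-nonneg i , sum-unit i , λ t → dot-unit i (λ j → p j t)

  ∈conv-cong : ∀ {m n} (p : Vector (Vector Carrier n) m) {x y} → x ≋ y → conv p x → conv p y
  ∈conv-cong p x≋y (μ , 0≤μ , Σμ≈1 , μp≋x) = μ , 0≤μ , Σμ≈1 , λ t → trans (μp≋x t) (x≋y t)

  -- A generator of weight zero may be replaced by any point, here by `q zero`, whence the index
  -- `suc k`. Afterwards all generators lie in `conv q`.
  conv-restrict : ∀ {m k n} (p : Vector (Vector Carrier n) m) (q : Vector (Vector Carrier n) (suc k)) {x} →
    ((μ , _) : conv p x) → (∀ i → μ i ≈ 0# ⊎ conv q (p i)) → conv q x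
  conv-restrict p q {x} (μ , 0≤μ , Σμ≈1 , μp≋x) h =
    conv-trans q p′ (λ i → proj₂ (replace i (h i))) (μ , 0≤μ , Σμ≈1 , μp′≋x)
    where
    replace : ∀ i → μ i ≈ 0# ⊎ conv q (p i) → ∃ (conv q)
    replace i (inj₁ _) = q zero , vertex∈conv q zero
    replace i (inj₂ pᵢ∈) = p i , pᵢ∈
    p′ : Vector (Vector Carrier _) _
    p′ i = proj₁ (replace i (h i))
    same : ∀ i (c : μ i ≈ 0# ⊎ conv q (p i)) t → μ i * proj₁ (replace i c) t ≈ μ i * p i t
    same i (inj₁ μᵢ≈0) t = trans (*-congʳ μᵢ≈0) (trans (zeroˡ _) (sym (trans (*-congʳ μᵢ≈0) (zeroˡ _))))
    same i (inj₂ _) t = refl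
    μp′≋x : combination μ p′ ≋ x
    μp′≋x t = trans (sum-cong λ i → same i (h i) t) (μp≋x t)

  dot-conv : ∀ {m n} (p : Vector (Vector Carrier n) m) c {x} ((μ , _) : conv p x) →
             dot c x ≈ sum (λ i → μ i * dot c (p i))
  dot-conv p c (μ , _ , _ , μp≋x) = trans (dot-congʳ c (λ t → sym (μp≋x t))) (dot-combination c μ p)

  slack : ∀ {m n} (p : Vector (Vector Carrier n) m) c b {x} ((μ , _) : conv p x) →
          b + - dot c x ≈ sum (λ i → μ i * (b + - dot c (p i)))
  slack p c b {x} x∈@(μ , _ , Σμ≈1 , _) = begin
    b + - dot c x                                   ≈⟨ +-cong (trans (sym (*-identityʳ b)) (*-congˡ (sym Σμ≈1))) (-‿cong (dot-conv p c x∈)) ⟩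
    b * sum μ + - sum (λ i → μ i * dot c (p i))     ≈⟨ distribute μ (λ i → dot c (p i)) ⟩
    sum (λ i → μ i * (b + - dot c (p i)))           ∎
    where
    distribute : ∀ {m} (μ y : Vector Carrier m) → b * sum μ + - sum (λ i → μ i * y i) ≈ sum (λ i → μ i * (b + - y i))
    distribute {zero} μ y = trans (+-cong (zeroʳ b) -0#≈0#) (+-identityˡ 0#)
    distribute {suc m} μ y = trans
      (solve 5 (λ b m y s t → b :* (m :+ s) :+ :- (m :* y :+ t) := m :* (b :+ :- y) :+ (b :* s :+ :- t)) refl
        b (μ zero) (y zero) (sum (μ ∘ suc)) (sum λ i → μ (suc i) * y (suc i)))
      (+-congˡ (distribute (μ ∘ suc) (y ∘ suc)))

  conv-≤ : ∀ {m n} (p : Vector (Vector Carrier n) m) c b → (∀ i → dot c (p i) ≤ b) → ∀ x → conv p x → dot c x ≤ b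
  conv-≤ p c b h x x∈@(μ , 0≤μ , _) b<cx = nonneg-sum _ (λ i → nonneg-* (0≤μ i) (≤⇒nonneg-difference (h i)))
    (<-resp-≈ (trans eq (slack p c b x∈)) refl (pos⇒-<0 (<⇒pos-difference b<cx)))
    where
    eq : - (dot c x + - b) ≈ b + - dot c x
    eq = solve 2 (λ x b → :- (x :+ :- b) := b :+ :- x) refl (dot c x) b

  -- The slacks at the generators average to zero and are nonnegative, so a strict inequality at a
  -- generator of positive weight would make the average positive.
  complementary-slackness : ∀ {m n} (p : Vector (Vector Carrier n) m) c b → (∀ i → dot c (p i) ≤ b) →
    ∀ {x} ((μ , _) : conv p x) → dot c x ≈ b → ∀ i → 0# < μ i → dot c (p i) ≈ b
  complementary-slackness p c b h {x} x∈@(μ , 0≤μ , _) cx≈b i 0<μᵢ =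
    <-tight (λ cpᵢ<b → <-irrefl 0# (<-resp-≈ refl Σ≈0
      (pos-sum _ (λ i → nonneg-* (0≤μ i) (≤⇒nonneg-difference (h i))) i (*-pos 0<μᵢ (<⇒pos-difference cpᵢ<b)))))
      (h i)
    where
    Σ≈0 : sum (λ i → μ i * (b + - dot c (p i))) ≈ 0#
    Σ≈0 = trans (sym (slack p c b x∈)) (trans (+-congˡ (-‿cong cx≈b)) (-‿inverseʳ b))

  pos-weight : ∀ {m} (μ : Vector Carrier m) → (∀ i → 0# ≤ μ i) → sum μ ≈ 1# → ∃ λ i → 0# < μ i
  pos-weight μ 0≤μ Σμ≈1 with #0-sum μ (#0-cong (sym Σμ≈1) 1#0)
  ... | i , inj₁ μᵢ<0 = ⊥-elim (0≤μ i μᵢ<0)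
  ... | i , inj₂ 0<μᵢ = i , 0<μᵢ

  -- An entry of a weight matrix that is apart from zero must be positive, which is more than a test
  -- of `dot c (p i) ≈ b` could provide: it identifies a generator on the face without deciding an
  -- equation.
  vertices-on-face : ∀ {k m n} (p : Vector (Vector Carrier n) m) c b → (∀ i → dot c (p i) ≤ b) →
    (q : Vector (Vector Carrier n) (suc (suc k))) → (∀ j → conv p (q j) × dot c (q j) ≈ b) → AffinelyIndependent q →
    ∃ λ (e : Vector (Fin m) (suc (suc k))) → Injective _≡_ _≡_ e × (∀ j → dot c (p (e j)) ≈ b)
  vertices-on-face p c b valid q q∈ indep =
    let (e , inj , apart) = columns Λ (weights-independent p q Λ
          (λ j → proj₁ (proj₂ (proj₂ (proj₁ (q∈ j))))) (λ j → proj₂ (proj₂ (proj₂ (proj₁ (q∈ j))))) indep)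
    in e , inj , λ j → on-face (proj₁ (apart j)) (e j) (proj₂ (apart j))
    where
    Λ = λ j → proj₁ (proj₁ (q∈ j))
    on-face : ∀ j i → Λ j i #0 → dot c (p i) ≈ b
    on-face j i (inj₁ Λ<0) = ⊥-elim (proj₁ (proj₂ (proj₁ (q∈ j))) i Λ<0)
    on-face j i (inj₂ 0<Λ) = complementary-slackness p c b valid (proj₁ (q∈ j)) (proj₂ (q∈ j)) i 0<Λ

  -- By complementary slackness a generator off the face has weight zero, and `conv-restrict`
  -- discards it.
  face⊆conv : ∀ {k m n} (p : Vector (Vector Carrier n) m) c b → (∀ i → dot c (p i) ≤ b) →
    (e : Vector (Fin m) (suc k)) → (∀ i → (∃ λ j → e j ≡ i) ⊎ ¬ (dot c (p i) ≈ b)) →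
    ∀ x → conv p x → dot c x ≈ b → conv (p ∘ e) x
  face⊆conv p c b valid e h x x∈@(μ , 0≤μ , _) cx≈b = conv-restrict p (p ∘ e) x∈ λ i → cases i (h i)
    where
    cases : ∀ i → (∃ λ j → e j ≡ i) ⊎ ¬ (dot c (p i) ≈ b) → μ i ≈ 0# ⊎ conv (p ∘ e) (p i)
    cases i (inj₁ (j , ≡.refl)) = inj₂ (vertex∈conv (p ∘ e) j)
    cases i (inj₂ off) = inj₁ (≈0-stable λ
      { (inj₁ μᵢ<0) → 0≤μ i μᵢ<0
      ; (inj₂ 0<μᵢ) → off (complementary-slackness p c b valid x∈ cx≈b i 0<μᵢ) })

  conv⊆face : ∀ {k m n} (p : Vector (Vector Carrier n) m) c b (e : Vector (Fin m) k) →
    (∀ j → dot c (p (e j)) ≈ b) → ∀ x → conv (p ∘ e) x → conv p x × dot c x ≈ b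
  conv⊆face p c b e h x x∈@(μ , _ , Σμ≈1 , _) = conv-trans p (p ∘ e) (λ j → vertex∈conv p (e j)) x∈ , (begin
    dot c x                                   ≈⟨ dot-conv (p ∘ e) c x∈ ⟩
    sum (λ j → μ j * dot c (p (e j)))         ≈⟨ sum-cong (λ j → *-congˡ (h j)) ⟩
    sum (λ j → μ j * b)                       ≈⟨ *-distribʳ-sum b μ ⟨
    sum μ * b                                 ≈⟨ *-congʳ Σμ≈1 ⟩
    1# * b                                    ≈⟨ *-identityˡ b ⟩
    b                                         ∎)

  -- With a dual basis f whose diagonal entries dⱼ are invertible, the
  -- functional x ↦ Σⱼ dⱼ⁻¹ (fⱼ · x) vⱼₜ − xₜ kills a basis, so it is zero.
  dual-expansion : ∀ {n} (v f : Vector (Vector Carrier n) n) (d⁻¹ : Vector Carrier n) →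
    (∀ j → dot (f j) (v j) * d⁻¹ j ≈ 1#) → (∀ i j → i ≢ j → dot (f j) (v i) ≈ 0#) →
    ∀ x → combination (λ j → dot (f j) x * d⁻¹ j) v ≋ x
  dual-expansion {n} v f d⁻¹ diagonal off-diagonal x t = x-y≈0⇒x≈y (begin
      combination (λ j → dot (f j) x * d⁻¹ j) v t + - x t  ≈⟨ functional x ⟨
      dot g x                                             ≈⟨ sum-zero (λ s → trans (*-congʳ (g≈0 s)) (zeroˡ (x s))) ⟩
      0#                                                  ∎)
    where
    a : Vector Carrier n
    a j = d⁻¹ j * v j t
    g : Vector Carrier n
    g s = sum (λ j → a j * f j s) + - unit t s
    functional : ∀ x → dot g x ≈ combination (λ j → dot (f j) x * d⁻¹ j) v t + - x t
    functional x = begin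
      sum (λ s → (sum (λ j → a j * f j s) + - unit t s) * x s)
        ≈⟨ sum-cong (λ s → solve 3 (λ a b x → (a :+ :- b) :* x := a :* x :+ :- (b :* x)) refl
             (sum (λ j → a j * f j s)) (unit t s) (x s)) ⟩
      sum (λ s → sum (λ j → a j * f j s) * x s + - (unit t s * x s))
        ≈⟨ sum-minus (λ s → sum (λ j → a j * f j s) * x s) (λ s → unit t s * x s) ⟩
      sum (λ s → sum (λ j → a j * f j s) * x s) + - dot (unit t) x
        ≈⟨ +-cong (sym (sum-assoc a f x)) (-‿cong (dot-unit t x)) ⟩
      sum (λ j → a j * dot (f j) x) + - x t
        ≈⟨ +-congʳ (sum-cong λ j → solve 3 (λ d v y → d :* v :* y := y :* d :* v) refl (d⁻¹ j) (v j t) (dot (f j) x)) ⟩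
      combination (λ j → dot (f j) x * d⁻¹ j) v t + - x t ∎
    apart : ∀ j → dot (f j) (v j) #0
    apart j = #0-*ˡ (#0-cong (sym (diagonal j)) 1#0)
    kills : ∀ i → dot g (v i) ≈ 0#
    kills i = begin
      dot g (v i)                                              ≈⟨ functional (v i) ⟩
      sum (λ j → dot (f j) (v i) * d⁻¹ j * v j t) + - v i t    ≈⟨ +-congʳ (sum-cong term) ⟩
      dot (unit i) (λ j → v j t) + - v i t                     ≈⟨ +-congʳ (dot-unit i (λ j → v j t)) ⟩
      v i t + - v i t                                          ≈⟨ -‿inverseʳ (v i t) ⟩
      0#                                                       ∎
      where
      term : ∀ j → dot (f j) (v i) * d⁻¹ j * v j t ≈ unit i j * v j t
      term j with i ≟ᶠ j
      ... | yes ≡.refl = *-congʳ (trans (diagonal i) (sym (unit-≡ i)))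
      ... | no i≢j = *-congʳ (trans (trans (*-congʳ (off-diagonal i j i≢j)) (zeroˡ _)) (sym (unit-≢ i j i≢j)))
    g≈0 : ∀ s → g s ≈ 0#
    g≈0 = kernel-trivial v (dual⇒independent v f apart off-diagonal) g kills

-- Integer computations

infix 4 _≟ˢ_
_≟ˢ_ : ∀ {n} → DecidableEquality (Subset n)
_≟ˢ_ = Vec.≡-dec Bool._≟_

-- The recursion tracks the cardinality still required, so for `k = 4` and `n = 12` the predicate is
-- evaluated on 495 subsets and not on 4096.
∀-Subset? : ∀ {n} k {P : Subset n → Set} → (∀ S → Dec (P S)) → Dec (∀ S → ∣ S ∣ ≡ k → P S)
∀-Subset? {zero} zero P? = map′ (λ { p [] _ → p }) (λ h → h [] ≡.refl) (P? [])
∀-Subset? {zero} (suc k) P? = yes λ { [] () }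
∀-Subset? {suc n} zero P? = map′
  (λ { h (outside ∷ S) eq → h S eq })
  (λ h S eq → h (outside ∷ S) eq)
  (∀-Subset? zero (λ S → P? (outside ∷ S)))
∀-Subset? {suc n} (suc k) P? = map′
  (λ { (h , _) (outside ∷ S) eq → h S eq ; (_ , h) (inside ∷ S) eq → h S (ℕ.suc-injective eq) })
  (λ h → (λ S eq → h (outside ∷ S) eq) , λ S eq → h (inside ∷ S) (cong suc eq))
  (∀-Subset? (suc k) (λ S → P? (outside ∷ S)) ×-dec ∀-Subset? k (λ S → P? (inside ∷ S)))

image : ∀ {k n} → Vector (Fin n) k → Subset n
image e = Vector.foldr (λ i S → ⁅ i ⁆ ∪ S) ⊥ e

∈-image⁺ : ∀ {k n} (e : Vector (Fin n) k) j → e j ∈ₛ image e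
∈-image⁺ e zero    = x∈p∪q⁺ (inj₁ (x∈⁅x⁆ (e zero)))
∈-image⁺ e (suc j) = x∈p∪q⁺ {p = ⁅ e zero ⁆} (inj₂ (∈-image⁺ (e ∘ suc) j))

∈-image⁻ : ∀ {k n} (e : Vector (Fin n) k) {i} → i ∈ₛ image e → ∃ λ j → e j ≡ i
∈-image⁻ {zero} e i∈ = ⊥-elim (∉⊥ i∈)
∈-image⁻ {suc k} e i∈ with x∈p∪q⁻ ⁅ e zero ⁆ (image (e ∘ suc)) i∈
... | inj₁ i∈₀ = zero , ≡.sym (x∈⁅y⁆⇒x≡y (e zero) i∈₀)
... | inj₂ i∈₁ = let (j , eq) = ∈-image⁻ (e ∘ suc) i∈₁ in suc j , eq

∣⁅x⁆∪p∣ : ∀ {n} (x : Fin n) (p : Subset n) → x ∉ₛ p → ∣ ⁅ x ⁆ ∪ p ∣ ≡ suc ∣ p ∣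
∣⁅x⁆∪p∣ zero (inside ∷ p) x∉ = ⊥-elim (x∉ here)
∣⁅x⁆∪p∣ zero (outside ∷ p) x∉ = cong (suc ∘ ∣_∣) (∪-identityˡ p)
∣⁅x⁆∪p∣ (suc x) (inside ∷ p) x∉ = cong suc (∣⁅x⁆∪p∣ x p (x∉ ∘ there))
∣⁅x⁆∪p∣ (suc x) (outside ∷ p) x∉ = ∣⁅x⁆∪p∣ x p (x∉ ∘ there)

∣image∣ : ∀ {k n} (e : Vector (Fin n) k) → Injective _≡_ _≡_ e → ∣ image e ∣ ≡ k
∣image∣ {zero} {n} e inj = ∣⊥∣≡0 n
∣image∣ {suc k} e inj = ≡.trans
  (∣⁅x⁆∪p∣ (e zero) (image (e ∘ suc)) λ e₀∈ → let (j , eq) = ∈-image⁻ (e ∘ suc) e₀∈ in 0≢1+n (≡.sym (inj eq)))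
  (cong suc (∣image∣ (e ∘ suc) λ eq → suc-injective (inj eq)))

enumerate : ∀ {n} (S : Subset n) → ∃ λ (e : Vector (Fin n) ∣ S ∣) →
            Injective _≡_ _≡_ e × (∀ j → e j ∈ₛ S) × (∀ i → i ∈ₛ S → ∃ λ j → e j ≡ i)
enumerate [] = (λ ()) , (λ { {()} }) , (λ ()) , λ _ ()
enumerate (outside ∷ S) with enumerate S
... | e , inj , e∈ , onto = suc ∘ e , (λ { {i} {j} eq → inj (suc-injective eq) }) , (λ j → there (e∈ j)) ,
      λ { zero () ; (suc i) (there i∈) → let (j , eq) = onto i i∈ in j , cong suc eq }
enumerate {suc n} (inside ∷ S) with enumerate S
... | e , inj , e∈ , onto = e′ , e′-injective , e′∈ , onto′
  where
  e′ : Vector (Fin (suc n)) (suc ∣ S ∣)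
  e′ = zero Vector.∷ (suc ∘ e)
  e′-injective : Injective _≡_ _≡_ e′
  e′-injective {zero} {zero} _ = ≡.refl
  e′-injective {suc i} {suc j} eq = cong suc (inj (suc-injective eq))
  e′∈ : ∀ j → e′ j ∈ₛ inside ∷ S
  e′∈ zero = here
  e′∈ (suc j) = there (e∈ j)
  onto′ : ∀ i → i ∈ₛ inside ∷ S → ∃ λ j → e′ j ≡ i
  onto′ zero here = zero , ≡.refl
  onto′ (suc i) (there i∈) = let (j , eq) = onto i i∈ in suc j , cong suc eq

-- Breadth-first order: each set is adjacent to an earlier one.
otherRoot : Subset 12
otherRoot = word A B C G

otherRest : List (Subset 12)
otherRest =
  word A B C H ∷ word B C G J ∷ word A C H K ∷ word B G J L ∷ word C F G J ∷
  word A D H K ∷ word C H K L ∷ word B G I L ∷ word A D E H ∷ word A D F K ∷ word B E G I ∷ []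

otherFacets : List (Subset 12)
otherFacets = otherRoot ∷ otherRest

facetList : List (Subset 12)
facetList = pieceList ++ otherFacets

-- Hyperplanes through four of the points

infix 7 _·_
_·_ : ∀ {n} → Vec ℤ n → Vec ℤ n → ℤ
[]       · []       = 0ℤ
(a ∷ as) · (b ∷ bs) = a ℤ.* b ℤ.+ as · bs

homogeneousCoordinates : Vec (Vec ℤ 5) 12
homogeneousCoordinates = Vec.map (1ℤ ∷_) coordinates

select : ∀ {X : Set} {n} → Subset n → Vec X n → List X
select []            []       = []
select (inside ∷ S)  (x ∷ xs) = x ∷ select S xs
select (outside ∷ S) (x ∷ xs) = select S xs

-- The coefficient vector of x ↦ ± det (a, b, c, d, x), by Laplace expansion
-- along the first two rows.
cross : (a b c d : Vec ℤ 5) → Vec ℤ 5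
cross (a₀ ∷ a₁ ∷ a₂ ∷ a₃ ∷ a₄ ∷ []) (b₀ ∷ b₁ ∷ b₂ ∷ b₃ ∷ b₄ ∷ [])
      (c₀ ∷ c₁ ∷ c₂ ∷ c₃ ∷ c₄ ∷ []) (d₀ ∷ d₁ ∷ d₂ ∷ d₃ ∷ d₄ ∷ []) = combine
  (minor a₀ a₁ b₀ b₁) (minor a₀ a₂ b₀ b₂) (minor a₀ a₃ b₀ b₃) (minor a₀ a₄ b₀ b₄) (minor a₁ a₂ b₁ b₂)
  (minor a₁ a₃ b₁ b₃) (minor a₁ a₄ b₁ b₄) (minor a₂ a₃ b₂ b₃) (minor a₂ a₄ b₂ b₄) (minor a₃ a₄ b₃ b₄)
  (minor c₀ c₁ d₀ d₁) (minor c₀ c₂ d₀ d₂) (minor c₀ c₃ d₀ d₃) (minor c₀ c₄ d₀ d₄) (minor c₁ c₂ d₁ d₂)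
  (minor c₁ c₃ d₁ d₃) (minor c₁ c₄ d₁ d₄) (minor c₂ c₃ d₂ d₃) (minor c₂ c₄ d₂ d₄) (minor c₃ c₄ d₃ d₄)
  where
  minor : ℤ → ℤ → ℤ → ℤ → ℤ
  minor x y z w = x ℤ.* w ℤ.- y ℤ.* z
  laplace : (p₀₁ p₀₂ p₀₃ p₁₂ p₁₃ p₂₃ q₀₁ q₀₂ q₀₃ q₁₂ q₁₃ q₂₃ : ℤ) → ℤ
  laplace p₀₁ p₀₂ p₀₃ p₁₂ p₁₃ p₂₃ q₀₁ q₀₂ q₀₃ q₁₂ q₁₃ q₂₃ =
    p₀₁ ℤ.* q₂₃ ℤ.- p₀₂ ℤ.* q₁₃ ℤ.+ p₀₃ ℤ.* q₁₂ ℤ.+ p₁₂ ℤ.* q₀₃ ℤ.- p₁₃ ℤ.* q₀₂ ℤ.+ p₂₃ ℤ.* q₀₁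
  -- The twenty minors enter as arguments because all five coordinates share them.
  combine : (p₀₁ p₀₂ p₀₃ p₀₄ p₁₂ p₁₃ p₁₄ p₂₃ p₂₄ p₃₄ q₀₁ q₀₂ q₀₃ q₀₄ q₁₂ q₁₃ q₁₄ q₂₃ q₂₄ q₃₄ : ℤ) → Vec ℤ 5
  combine p₀₁ p₀₂ p₀₃ p₀₄ p₁₂ p₁₃ p₁₄ p₂₃ p₂₄ p₃₄ q₀₁ q₀₂ q₀₃ q₀₄ q₁₂ q₁₃ q₁₄ q₂₃ q₂₄ q₃₄ =
      laplace p₁₂ p₁₃ p₁₄ p₂₃ p₂₄ p₃₄ q₁₂ q₁₃ q₁₄ q₂₃ q₂₄ q₃₄
    ∷ ℤ.- laplace p₀₂ p₀₃ p₀₄ p₂₃ p₂₄ p₃₄ q₀₂ q₀₃ q₀₄ q₂₃ q₂₄ q₃₄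
    ∷ laplace p₀₁ p₀₃ p₀₄ p₁₃ p₁₄ p₃₄ q₀₁ q₀₃ q₀₄ q₁₃ q₁₄ q₃₄
    ∷ ℤ.- laplace p₀₁ p₀₂ p₀₄ p₁₂ p₁₄ p₂₄ q₀₁ q₀₂ q₀₄ q₁₂ q₁₄ q₂₄
    ∷ laplace p₀₁ p₀₂ p₀₃ p₁₂ p₁₃ p₂₃ q₀₁ q₀₂ q₀₃ q₁₂ q₁₃ q₂₃
    ∷ []

normal : Subset 12 → Vec ℤ 5
normal S with select S homogeneousCoordinates
... | a ∷ b ∷ c ∷ d ∷ [] = cross a b c d
-- The default for sets that do not have exactly four elements.
... | _                  = Vec.replicate 5 0ℤ

values : Vec ℤ 5 → Vec ℤ 12
values N = Vec.map (N ·_) homogeneousCoordinates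

HasZeroSet : Subset 12 → Vec ℤ 12 → Set
HasZeroSet S v = ∀ i → (i ∈ₛ S → lookup v i ≡ 0ℤ) × (i ∉ₛ S → lookup v i ≢ 0ℤ)

OneSided Mixed : Vec ℤ 12 → Set
OneSided v = (∀ i → 0ℤ ℤ.≤ lookup v i) ⊎ (∀ i → lookup v i ℤ.≤ 0ℤ)
Mixed v = (∃ λ i → 0ℤ ℤ.< lookup v i) × (∃ λ i → lookup v i ℤ.< 0ℤ)

-- `HasZeroSet` expresses general position. A set outside `facetList` comes with points on both
-- sides of its hyperplane, because a later argument evaluates functionals at these very points.
Classified : Subset 12 → Vec ℤ 12 → Set
Classified S v = HasZeroSet S v × (S ∈ facetList × OneSided v ⊎ ¬ (S ∈ facetList) × Mixed v)

_∈ˡ?_ : ∀ {n} (S : Subset n) Ss → Dec (S ∈ Ss)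
_∈ˡ?_ = DecMembership._∈?_ _≟ˢ_

classified? : ∀ S v → Dec (Classified S v)
classified? S v =
  all? (λ i → ((i ∈? S) →-dec (lookup v i ℤ.≟ 0ℤ)) ×-dec (¬? (i ∈? S) →-dec ¬? (lookup v i ℤ.≟ 0ℤ)))
  ×-dec
  ( (S ∈ˡ? facetList ×-dec (all? (λ i → 0ℤ ℤ.≤? lookup v i) ⊎-dec all? (λ i → lookup v i ℤ.≤? 0ℤ)))
  ⊎-dec (¬? (S ∈ˡ? facetList) ×-dec (any? (λ i → 0ℤ ℤ.<? lookup v i) ×-dec any? (λ i → lookup v i ℤ.<? 0ℤ))))

abstract
  -- General position and the completeness of the list of facets are settled by this one
  -- enumeration.
  classified : ∀ S → ∣ S ∣ ≡ 4 → Classified S (values (normal S))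
  classified = toWitness {a? = ∀-Subset? 4 λ S → classified? S (values (normal S))} tt

-- The faces of the polytope

value : Vec ℤ 5 → Fin 12 → ℤ
value N i = N · lookup homogeneousCoordinates i

lookup-values : ∀ N i → lookup (values N) i ≡ value N i
lookup-values N i = Vec.lookup-map i (N ·_) homogeneousCoordinates

normal-spans : ∀ S → ∣ S ∣ ≡ 4 → ∀ i → (i ∈ₛ S → value (normal S) i ≡ 0ℤ) × (i ∉ₛ S → value (normal S) i ≢ 0ℤ)
normal-spans S ∣S∣≡4 i = subst (λ v → (i ∈ₛ S → v ≡ 0ℤ) × (i ∉ₛ S → v ≢ 0ℤ)) (lookup-values (normal S) i)
  (proj₁ (classified S ∣S∣≡4) i)

Supports : Vec ℤ 5 → Subset 12 → Set
Supports N S = ∀ i → (i ∈ₛ S → value N i ≡ 0ℤ) × (i ∉ₛ S → 0ℤ ℤ.< value N i)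

nonneg∧≢0⇒pos : ∀ {i} → 0ℤ ℤ.≤ i → i ≢ 0ℤ → 0ℤ ℤ.< i
nonneg∧≢0⇒pos 0≤i i≢0 = ℤ.≤∧≢⇒< 0≤i (i≢0 ∘ ≡.sym)

·-neg : ∀ {n} (u v : Vec ℤ n) → Vec.map ℤ.-_ u · v ≡ ℤ.- (u · v)
·-neg []      []      = ≡.refl
·-neg (a ∷ u) (b ∷ v) = ≡.trans
  (cong₂ ℤ._+_ (≡.sym (ℤ.neg-distribˡ-* a b)) (·-neg u v))
  (≡.sym (ℤ.neg-distrib-+ (a ℤ.* b) (u · v)))

-- The orientation of the cross product is arbitrary, so a nonpositive normal is negated. Weak signs
-- become strict since the normal vanishes only on `S`.
facet-support : ∀ S → ∣ S ∣ ≡ 4 → S ∈ facetList → ∃ λ N → Supports N S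
facet-support S ∣S∣≡4 S∈ with proj₂ (classified S ∣S∣≡4)
... | inj₂ (S∉ , _) = ⊥-elim (S∉ S∈)
... | inj₁ (_ , inj₁ nonneg) = normal S , λ i →
      proj₁ (normal-spans S ∣S∣≡4 i) ,
      λ i∉ → nonneg∧≢0⇒pos (subst (0ℤ ℤ.≤_) (lookup-values (normal S) i) (nonneg i)) (proj₂ (normal-spans S ∣S∣≡4 i) i∉)
... | inj₁ (_ , inj₂ nonpos) = Vec.map ℤ.-_ (normal S) , λ i →
      (λ i∈ → ≡.trans (·-neg (normal S) (lookup homogeneousCoordinates i)) (cong ℤ.-_ (proj₁ (normal-spans S ∣S∣≡4 i) i∈))) ,
      λ i∉ → subst (0ℤ ℤ.<_) (≡.sym (·-neg (normal S) (lookup homogeneousCoordinates i)))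
        (nonneg∧≢0⇒pos (ℤ.neg-mono-≤ (subst (ℤ._≤ 0ℤ) (lookup-values (normal S) i) (nonpos i)))
          (λ eq → proj₂ (normal-spans S ∣S∣≡4 i) i∉ (ℤ.neg-injective eq)))

nonfacet-mixed : ∀ S → ∣ S ∣ ≡ 4 →
  S ∈ facetList ⊎ (∃ λ u → 0ℤ ℤ.< value (normal S) u) × (∃ λ w → value (normal S) w ℤ.< 0ℤ)
nonfacet-mixed S ∣S∣≡4 with proj₂ (classified S ∣S∣≡4)
... | inj₁ (S∈ , _) = inj₁ S∈
... | inj₂ (_ , (u , 0<u) , (w , w<0)) =
      inj₂ ((u , subst (0ℤ ℤ.<_) (lookup-values (normal S) u) 0<u) , (w , subst (ℤ._< 0ℤ) (lookup-values (normal S) w) w<0))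

-- Row `i` holds the constant term and the coefficients of a functional that exposes point `i`. For
-- instance, `G` has the least last coordinate, -139, and `H` the least first coordinate, -80.
vertexSupports : Vec (Vec ℤ 5) 12
vertexSupports =
  (  + 188 ∷   + 1 ∷   + 1 ∷ ℤ.- + 1 ∷ ℤ.- + 1 ∷ []) ∷
  (  + 95  ∷   + 1 ∷   + 1 ∷   + 0 ∷   + 0 ∷ []) ∷
  (  + 100 ∷   + 1 ∷   + 0 ∷ ℤ.- + 1 ∷ ℤ.- + 1 ∷ []) ∷
  (  + 145 ∷   + 0 ∷   + 1 ∷   + 0 ∷   + 0 ∷ []) ∷
  (  + 119 ∷   + 1 ∷   + 3 ∷   + 2 ∷   + 1 ∷ []) ∷
  (  + 109 ∷ ℤ.- + 1 ∷ ℤ.- + 1 ∷ ℤ.- + 1 ∷   + 0 ∷ []) ∷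
  (  + 139 ∷   + 0 ∷   + 0 ∷   + 0 ∷   + 1 ∷ []) ∷
  (  + 80  ∷   + 1 ∷   + 0 ∷   + 0 ∷   + 0 ∷ []) ∷
  (  + 252 ∷   + 4 ∷   + 3 ∷   + 1 ∷   + 0 ∷ []) ∷
  (  + 135 ∷   + 1 ∷ ℤ.- + 1 ∷ ℤ.- + 1 ∷ ℤ.- + 1 ∷ []) ∷
  (  + 143 ∷   + 1 ∷   + 0 ∷   + 0 ∷ ℤ.- + 1 ∷ []) ∷
  (  + 213 ∷   + 3 ∷ ℤ.- + 2 ∷ ℤ.- + 2 ∷ ℤ.- + 1 ∷ []) ∷ []

abstract
  vertex-support : ∀ i j → (i ≡ j → value (lookup vertexSupports i) j ≡ 0ℤ) × (i ≢ j → 0ℤ ℤ.< value (lookup vertexSupports i) j)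
  vertex-support = toWitness {a? = all? λ i → all? λ j →
    ((i ≟ᶠ j) →-dec (value (lookup vertexSupports i) j ℤ.≟ 0ℤ)) ×-dec
    (¬? (i ≟ᶠ j) →-dec (0ℤ ℤ.<? value (lookup vertexSupports i) j))} tt

-- Dual bases are available for five points, so a set of four is first completed by a fifth one.
fresh : (e : Vector (Fin 12) 4) → Injective _≡_ _≡_ e → ∃ λ u → u ∉ₛ image e
fresh e inj = ¬∀⟶∃¬ 12 (_∈ₛ image e) (_∈? image e) λ all →
  ℕ.<⇒≱ (ℕ.s≤s (ℕ.s≤s (ℕ.s≤s (ℕ.s≤s (ℕ.s≤s ℕ.z≤n)))))
    (subst (12 ℕ.≤_) (∣image∣ e inj) (p⊆q⇒∣p∣≤∣q∣ {p = Subset.⊤} {q = image e} (λ {i} _ → all i)))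

extend-injective : ∀ {k n} (e : Vector (Fin n) k) {u} → Injective _≡_ _≡_ e → u ∉ₛ image e →
                   Injective _≡_ _≡_ (u Vector.∷ e)
extend-injective e inj u∉ {zero}  {zero}  eq = ≡.refl
extend-injective e inj u∉ {zero}  {suc j} eq = ⊥-elim (u∉ (subst (_∈ₛ image e) (≡.sym eq) (∈-image⁺ e j)))
extend-injective e inj u∉ {suc i} {zero}  eq = ⊥-elim (u∉ (subst (_∈ₛ image e) eq (∈-image⁺ e i)))
extend-injective e inj u∉ {suc i} {suc j} eq = cong suc (inj eq)

module Geometry (𝓡 : OrderedRing) where

  open OrderedRing 𝓡 hiding (zero)
  open RingProperties ring using (-0#≈0#; -‿involutive)
  open SemiringSum semiring using (sum)
  open IsRingHomomorphism fromℤ-isHomomorphism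
  open IntegerCoefficients commutativeRing fromℤ fromℤ-isHomomorphism using (solve; _:+_; _:*_; :-_; _:=_)
  open LinearAlgebra 𝓡
  open import Relation.Binary.Reasoning.Setoid setoid

  point : Vector (Vector Carrier 4) 12
  point i k = fromℤ (lookup (lookup coordinates i) k)

  embed : ∀ {n} → Vec ℤ n → Vector Carrier n
  embed v k = fromℤ (lookup v k)

  dot-embed : ∀ {n} (u v : Vec ℤ n) → dot (embed u) (embed v) ≈ fromℤ (u · v)
  dot-embed [] [] = sym 0#-homo
  dot-embed (a ∷ u) (b ∷ v) = sym (trans (+-homo (a ℤ.* b) (u · v)) (+-cong (*-homo a b) (sym (dot-embed u v))))

  homogeneous : Vector (Vector Carrier 5) 12
  homogeneous i = homogenize (point i)

  homogeneous≋ : ∀ i → homogeneous i ≋ embed (lookup homogeneousCoordinates i)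
  homogeneous≋ i k = trans (head k) (reflexive (cong (λ v → fromℤ (lookup v k)) (≡.sym (Vec.lookup-map i (1ℤ ∷_) coordinates))))
    where
    head : ∀ k → homogeneous i k ≈ embed (1ℤ ∷ lookup coordinates i) k
    head zero    = sym 1#-homo
    head (suc k) = refl

  evaluate : ∀ N i → dot (embed N) (homogeneous i) ≈ fromℤ (value N i)
  evaluate N i = trans (dot-congʳ (embed N) (homogeneous≋ i)) (dot-embed N (lookup homogeneousCoordinates i))

  evaluate-≡0 : ∀ {N i} → value N i ≡ 0ℤ → dot (embed N) (homogeneous i) ≈ 0#
  evaluate-≡0 {N} {i} eq = trans (evaluate N i) (trans (reflexive (cong fromℤ eq)) 0#-homo)

  evaluate-≢0 : ∀ {N i} → value N i ≢ 0ℤ → dot (embed N) (homogeneous i) #0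
  evaluate-≢0 {N} {i} neq = #0-cong (sym (evaluate N i)) (fromℤ-#0 neq)

  evaluate-pos : ∀ {N i} → 0ℤ ℤ.< value N i → 0# < dot (embed N) (homogeneous i)
  evaluate-pos {N} {i} h = <-resp-≈ refl (sym (evaluate N i)) (fromℤ-pos h)

  dot-neg : ∀ {n} (c x : Vector Carrier n) → dot (λ k → - c k) x ≈ - dot c x
  dot-neg {zero} c x = sym -0#≈0#
  dot-neg {suc n} c x = trans (+-congˡ (dot-neg (c ∘ suc) (x ∘ suc)))
    (solve 3 (λ a b y → :- a :* b :+ :- y := :- (a :* b :+ y)) refl (c zero) (x zero) (dot (c ∘ suc) (x ∘ suc)))

  -- The affine functional b − c · x in homogeneous coordinates.
  functional : ∀ {n} → Vector Carrier n → Carrier → Vector Carrier (suc n)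
  functional c b = b Vector.∷ λ k → - c k

  dot-functional : ∀ {n} (c : Vector Carrier n) b x → dot (functional c b) (homogenize x) ≈ b + - dot c x
  dot-functional c b x = +-cong (*-identityʳ b) (dot-neg c x)

  -- The signs are chosen so that nonnegativity of `N` reads as `dot c x ≤ b`.
  hyperplane : Vec ℤ 5 → Vector Carrier 4 × Carrier
  hyperplane (N₀ ∷ N) = (λ k → - embed N k) , fromℤ N₀

  dot-hyperplane : ∀ N x → proj₂ (hyperplane N) + - dot (proj₁ (hyperplane N)) x ≈ dot (embed N) (homogenize x)
  dot-hyperplane (N₀ ∷ N) x = +-cong (sym (*-identityʳ (fromℤ N₀)))
    (trans (-‿cong (dot-neg (embed N) x)) (-‿involutive (dot (embed N) x)))

  others : Vector (Fin 12) 5 → Fin 5 → Subset 12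
  others e j = image (e ∘ punchIn j)

  -- The dual basis of the five homogeneous points: the normal through the other four vanishes at
  -- them and, by general position, not at `e j`.
  others-normal : Vector (Fin 12) 5 → Fin 5 → Vec ℤ 5
  others-normal e j = normal (others e j)

  module _ (e : Vector (Fin 12) 5) (inj : Injective _≡_ _≡_ e) where

    ∣others∣ : ∀ j → ∣ others e j ∣ ≡ 4
    ∣others∣ j = ∣image∣ (e ∘ punchIn j) (λ eq → punchIn-injective j _ _ (inj eq))

    others-diagonal : ∀ j → value (others-normal e j) (e j) ≢ 0ℤ
    others-diagonal j = proj₂ (normal-spans (others e j) (∣others∣ j) (e j)) λ e∈ →
      let (i , eq) = ∈-image⁻ (e ∘ punchIn j) e∈ in punchInᵢ≢i j i (inj eq)

    others-off-diagonal : ∀ i j → i ≢ j → value (others-normal e j) (e i) ≡ 0ℤ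
    others-off-diagonal i j i≢j = proj₁ (normal-spans (others e j) (∣others∣ j) (e i))
      (subst (λ i → e i ∈ₛ others e j) (punchIn-punchOut (i≢j ∘ ≡.sym))
        (∈-image⁺ (e ∘ punchIn j) (punchOut (i≢j ∘ ≡.sym))))

    independent₅ : LinearlyIndependent (homogeneous ∘ e)
    independent₅ = dual⇒independent (homogeneous ∘ e) (embed ∘ others-normal e)
      (λ j → evaluate-≢0 {others-normal e j} {e j} (others-diagonal j))
      (λ i j i≢j → evaluate-≡0 {others-normal e j} {e i} (others-off-diagonal i j i≢j))

    affinelyIndependent₅ : AffinelyIndependent (point ∘ e)
    affinelyIndependent₅ = independent⇒affinelyIndependent (point ∘ e) independent₅

    -- The diagonal values of the dual basis are nonzero integers, hence invertible. Coordinate zero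
    -- of the expansion says that the weights add up to one.
    spanning₅ : ∀ x → aff (point ∘ e) x
    spanning₅ x = w , trans (sum-cong λ j → sym (*-identityʳ (w j))) (expansion zero) , λ k → expansion (suc k)
      where
      inverse : ∀ j → ∃ λ y → fromℤ (value (others-normal e j) (e j)) * y ≈ 1#
      inverse j = fromℤ-inverse (others-diagonal j)
      w : Vector Carrier 5
      w j = dot (embed (others-normal e j)) (homogenize x) * proj₁ (inverse j)
      expansion : combination w (homogeneous ∘ e) ≋ homogenize x
      expansion = dual-expansion (homogeneous ∘ e) (embed ∘ others-normal e) (proj₁ ∘ inverse)
        (λ j → trans (*-congʳ (evaluate (others-normal e j) (e j))) (proj₂ (inverse j)))
        (λ i j i≢j → evaluate-≡0 {others-normal e j} {e i} (others-off-diagonal i j i≢j))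
        (homogenize x)

  independent-tail : ∀ {k n} (v : Vector (Vector Carrier n) (suc k)) → LinearlyIndependent v → LinearlyIndependent (v ∘ suc)
  independent-tail v indep μ (j , μⱼ#0) =
    let (t , h) = indep (0# Vector.∷ μ) (suc j , μⱼ#0)
    in t , #0-cong (trans (+-congʳ (zeroˡ (v zero t))) (+-identityˡ (combination μ (v ∘ suc) t))) h

  affinelyIndependent₄ : (e : Vector (Fin 12) 4) → Injective _≡_ _≡_ e → AffinelyIndependent (point ∘ e)
  affinelyIndependent₄ e inj = let (u , u∉) = fresh e inj in
    independent⇒affinelyIndependent (point ∘ e)
      (independent-tail (homogeneous ∘ (u Vector.∷ e)) (independent₅ (u Vector.∷ e) (extend-injective e inj u∉)))

  HasDimension : ∀ {n} → Pred (Vector Carrier n) 0ℓ → ℕ → Set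
  HasDimension {n} X d = Σ (Vector (Vector Carrier n) (suc d)) λ q →
    (∀ i → X (q i)) × AffinelyIndependent q × (∀ x → X x → aff q x)

  face : Vector Carrier 4 → Carrier → Pred (Vector Carrier 4) 0ℓ
  face c b x = conv point x × dot c x ≈ b

  Valid : Vector Carrier 4 → Carrier → Set
  Valid c b = ∀ x → conv point x → dot c x ≤ b

  conv-dimension : HasDimension (conv point) 4
  conv-dimension = point ∘ e , (λ j → vertex∈conv point (e j)) , affinelyIndependent₅ e inj , λ x _ → spanning₅ e inj x
    where
    e : Vector (Fin 12) 5
    -- The first five points; by general position any five would serve.
    e = _↑ˡ 7
    inj : Injective _≡_ _≡_ e
    inj {i} {j} = ↑ˡ-injective 7 i j

  record FacetStructure (c : Vector Carrier 4) (b : Carrier) : Set where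
    field
      e         : Vector (Fin 12) 4
      injective : Injective _≡_ _≡_ e
      isFacet   : image e ∈ facetList
      on-face   : ∀ j → dot c (point (e j)) ≈ b
      off-face  : ∀ i → i ∉ₛ image e → ¬ (dot c (point i) ≈ b)

    -- The real equation is not decidable, but membership in the finite set `image e` is, and it
    -- settles the alternative.
    inside-or-off : ∀ i → (∃ λ j → e j ≡ i) ⊎ ¬ (dot c (point i) ≈ b)
    inside-or-off i with i ∈? image e
    ... | yes i∈ = inj₁ (∈-image⁻ e i∈)
    ... | no i∉ = inj₂ (off-face i i∉)

  facet-structure : ∀ c b → Valid c b → HasDimension (face c b) 3 → FacetStructure c b
  facet-structure c b valid (q , q∈ , indep , spans) = record
    { e = e ; injective = inj ; isFacet = isFacet (nonfacet-mixed (image e) ∣e∣≡4) ; on-face = on-face ; off-face = off-face }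
    where
    valid′ : ∀ i → dot c (point i) ≤ b
    valid′ i = valid (point i) (vertex∈conv point i)
    vertices : ∃ λ (e : Vector (Fin 12) 4) → Injective _≡_ _≡_ e × (∀ j → dot c (point (e j)) ≈ b)
    vertices = vertices-on-face point c b valid′ q q∈ indep
    e : Vector (Fin 12) 4
    e = proj₁ vertices
    inj : Injective _≡_ _≡_ e
    inj = proj₁ (proj₂ vertices)
    on-face : ∀ j → dot c (point (e j)) ≈ b
    on-face = proj₂ (proj₂ vertices)
    ∣e∣≡4 : ∣ image e ∣ ≡ 4
    ∣e∣≡4 = ∣image∣ e inj
    off-face : ∀ u → u ∉ₛ image e → ¬ (dot c (point u) ≈ b)
    -- A fifth point on the face would give five affinely independent points in the affine hull of
    -- the four points `q`.
    off-face u u∉ cu≈b = ℕ.<-irrefl ≡.refl (affinelyIndependent⇒≤ (point ∘ e₅) q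
        (affinelyIndependent₅ e₅ (extend-injective e inj u∉)) (λ j → spans (point (e₅ j)) (vertex∈conv point (e₅ j) , on-face₅ j)))
      where
      e₅ : Vector (Fin 12) 5
      e₅ = u Vector.∷ e
      on-face₅ : ∀ j → dot c (point (e₅ j)) ≈ b
      on-face₅ zero    = cu≈b
      on-face₅ (suc j) = on-face j
    N : Vec ℤ 5
    N = normal (image e)
    h : Vector Carrier 5
    h = functional c b
    h-nonneg : ∀ i → 0# ≤ dot h (homogeneous i)
    h-nonneg i = ≤-resp-≈ refl (sym (dot-functional c b (point i))) (≤⇒nonneg-difference (valid′ i))
    h-zero : ∀ i → dot c (point i) ≈ b → dot h (homogeneous i) ≈ 0#
    h-zero i eq = trans (dot-functional c b (point i)) (trans (+-congˡ (-‿cong eq)) (-‿inverseʳ b))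
    h-zero⁻¹ : ∀ i → dot h (homogeneous i) ≈ 0# → dot c (point i) ≈ b
    h-zero⁻¹ i eq = sym (x-y≈0⇒x≈y (trans (sym (dot-functional c b (point i))) eq))
    -- h and N vanish at the four points e, so they are proportional; as h ≥ 0
    -- and N changes sign, h vanishes at a fifth vertex.
    isFacet : image e ∈ facetList ⊎ (∃ λ u → 0ℤ ℤ.< value N u) × (∃ λ w → value N w ℤ.< 0ℤ) → image e ∈ facetList
    isFacet (inj₁ e∈) = e∈
    isFacet (inj₂ ((u , 0<Nu) , (w , Nw<0))) = ⊥-elim (off-face u u∉ (h-zero⁻¹ u hu≈0))
      where
      u∉ : u ∉ₛ image e
      u∉ u∈ = ℤ.<-irrefl (≡.sym (proj₁ (normal-spans (image e) ∣e∣≡4 u) u∈)) 0<Nu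
      hu hw Nu Nw : Carrier
      hu = dot h (homogeneous u)
      hw = dot h (homogeneous w)
      Nu = dot (embed N) (homogeneous u)
      Nw = dot (embed N) (homogeneous w)
      -- The factors are balanced so that `g` vanishes at `u` as well. Five independent zeros make
      -- `g` zero, and its value at `w` then relates `hu` to `hw`.
      g : Vector Carrier 5
      g t = hu * embed N t + - (Nu * h t)
      dot-g : ∀ x → dot g x ≈ hu * dot (embed N) x + - (Nu * dot h x)
      dot-g x = dot-scaled hu Nu (embed N) h x
        where
        dot-scaled : ∀ {n} s r (a b x : Vector Carrier n) →
                     dot (λ t → s * a t + - (r * b t)) x ≈ s * dot a x + - (r * dot b x)
        dot-scaled {zero} s r a b x = sym (trans (+-cong (zeroʳ s) (trans (-‿cong (zeroʳ r)) -0#≈0#)) (+-identityˡ 0#))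
        dot-scaled {suc n} s r a b x = trans (+-congˡ (dot-scaled s r (a ∘ suc) (b ∘ suc) (x ∘ suc)))
          (solve 7 (λ s r a b x p q → (s :* a :+ :- (r :* b)) :* x :+ (s :* p :+ :- (r :* q))
                       := s :* (a :* x :+ p) :+ :- (r :* (b :* x :+ q))) refl
            s r (a zero) (b zero) (x zero) (dot (a ∘ suc) (x ∘ suc)) (dot (b ∘ suc) (x ∘ suc)))
      g-kills : ∀ j → dot g (homogeneous ((u Vector.∷ e) j)) ≈ 0#
      g-kills zero = trans (dot-g (homogeneous u)) (trans (+-congʳ (*-comm hu Nu)) (-‿inverseʳ (Nu * hu)))
      g-kills (suc j) = trans (dot-g (homogeneous (e j))) (trans
        (+-cong (trans (*-congˡ (evaluate-≡0 {N} {e j} (proj₁ (normal-spans (image e) ∣e∣≡4 (e j)) (∈-image⁺ e j)))) (zeroʳ hu))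
                (trans (-‿cong (trans (*-congˡ (h-zero (e j) (on-face j))) (zeroʳ Nu))) -0#≈0#))
        (+-identityˡ 0#))
      g≈0 : ∀ t → g t ≈ 0#
      g≈0 = kernel-trivial (homogeneous ∘ (u Vector.∷ e)) (independent₅ (u Vector.∷ e) (extend-injective e inj u∉)) g g-kills
      proportional : hu * Nw + - (Nu * hw) ≈ 0#
      proportional = trans (sym (dot-g (homogeneous w))) (sum-zero λ t → trans (*-congʳ (g≈0 t)) (zeroˡ (homogeneous w t)))
      Nw<0′ : Nw < 0#
      Nw<0′ = <-resp-≈ (trans (sym (-‿homo (ℤ.- value N w))) (trans (reflexive (cong fromℤ (ℤ.neg-involutive (value N w)))) (sym (evaluate N w)))) refl (pos⇒-<0 (fromℤ-pos (ℤ.neg-mono-< Nw<0)))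
      hu≈0 : hu ≈ 0#
      hu≈0 = ≈0-stable λ
        { (inj₁ hu<0) → h-nonneg u hu<0
        -- For positive `hu` the term `hu * - Nw` is positive and `Nu * hw` is nonnegative, but
        -- their sum is zero by `proportional`.
        ; (inj₂ 0<hu) → <-irrefl 0# (<-resp-≈ refl (trans regroup (trans (-‿cong proportional) -0#≈0#))
            (pos-+-nonneg (*-pos 0<hu (<0⇒-pos Nw<0′)) (nonneg-* (<⇒≤ (evaluate-pos {N} {u} 0<Nu)) (h-nonneg w)))) }
        where
        regroup : hu * - Nw + Nu * hw ≈ - (hu * Nw + - (Nu * hw))
        regroup = solve 4 (λ a b c d → a :* :- b :+ c :* d := :- (a :* b :+ :- (c :* d))) refl hu Nw Nu hw

  face⇔conv : ∀ c b (valid : Valid c b) (s : FacetStructure c b) → ∀ x → face c b x ⇔ conv (point ∘ FacetStructure.e s) x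
  face⇔conv c b valid s x = mk⇔
    (λ (x∈ , eq) → face⊆conv point c b (λ i → valid (point i) (vertex∈conv point i)) e inside-or-off x x∈ eq)
    (conv⊆face point c b e on-face x)
    where open FacetStructure s

  face-dimension : ∀ c b → Valid c b → FacetStructure c b → HasDimension (face c b) 3
  face-dimension c b valid s = point ∘ e , (λ j → vertex∈conv point (e j) , on-face j) , affinelyIndependent₄ e injective ,
    λ x x∈ → conv⇒aff (point ∘ e) (Equivalence.to (face⇔conv c b valid s x) x∈)
    where open FacetStructure s

  module _ (N : Vec ℤ 5) (S : Subset 12) (supports : Supports N S) where

    private
      c = proj₁ (hyperplane N)
      b = proj₂ (hyperplane N)

    hyperplane-on : ∀ i → i ∈ₛ S → dot c (point i) ≈ b
    hyperplane-on i i∈ = sym (x-y≈0⇒x≈y (trans (dot-hyperplane N (point i)) (evaluate-≡0 {N} {i} (proj₁ (supports i) i∈))))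

    hyperplane-below : ∀ i → i ∉ₛ S → dot c (point i) < b
    hyperplane-below i i∉ = pos-difference⇒< (<-resp-≈ refl (sym (dot-hyperplane N (point i))) (evaluate-pos {N} {i} (proj₂ (supports i) i∉)))

    hyperplane-off : ∀ i → i ∉ₛ S → ¬ (dot c (point i) ≈ b)
    hyperplane-off i i∉ eq = <-irrefl b (<-resp-≈ eq refl (hyperplane-below i i∉))

    hyperplane-valid′ : ∀ i → dot c (point i) ≤ b
    hyperplane-valid′ i with i ∈? S
    ... | yes i∈ = ≤-reflexive (hyperplane-on i i∈)
    ... | no i∉ = <⇒≤ (hyperplane-below i i∉)

    hyperplane-valid : Valid c b
    hyperplane-valid = conv-≤ point c b hyperplane-valid′

  FacetVertexSet : Subset 12 → Set
  FacetVertexSet S = ∃₂ λ c b → (Valid c b × HasDimension (face c b) 3) × (∀ i → i ∈ₛ S ⇔ face c b (point i))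

  facetVertexSet : ∀ S → ∣ S ∣ ≡ 4 → S ∈ facetList → FacetVertexSet S
  facetVertexSet S ∣S∣≡4 S∈ = c , b , (hyperplane-valid N S supports , face-dimension c b (hyperplane-valid N S supports) structure) ,
    λ i → mk⇔ (λ i∈ → vertex∈conv point i , hyperplane-on N S supports i i∈) (λ (_ , eq) → in-S i eq)
    where
    N = proj₁ (facet-support S ∣S∣≡4 S∈)
    supports = proj₂ (facet-support S ∣S∣≡4 S∈)
    c = proj₁ (hyperplane N)
    b = proj₂ (hyperplane N)
    in-S : ∀ i → dot c (point i) ≈ b → i ∈ₛ S
    in-S i eq = decidable-stable (i ∈? S) λ i∉ → hyperplane-off N S supports i i∉ eq
    enum : ∃ λ (e : Vector (Fin 12) 4) → Injective _≡_ _≡_ e × (∀ j → e j ∈ₛ S) × (∀ i → i ∈ₛ S → ∃ λ j → e j ≡ i)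
    enum = subst (λ k → ∃ λ (e : Vector (Fin 12) k) → Injective _≡_ _≡_ e × (∀ j → e j ∈ₛ S) × (∀ i → i ∈ₛ S → ∃ λ j → e j ≡ i))
             ∣S∣≡4 (enumerate S)
    e = proj₁ enum
    image≡S : image e ≡ S
    image≡S = ⊆-antisym
      (λ i∈ → let (j , eq) = ∈-image⁻ e i∈ in subst (_∈ₛ S) eq (proj₁ (proj₂ (proj₂ enum)) j))
      (λ {i} i∈ → let (j , eq) = proj₂ (proj₂ (proj₂ enum)) i i∈ in subst (_∈ₛ image e) eq (∈-image⁺ e j))
    structure : FacetStructure c b
    structure = record
      { e = e ; injective = proj₁ (proj₂ enum)
      ; isFacet = subst (_∈ facetList) (≡.sym image≡S) S∈
      ; on-face = λ j → hyperplane-on N S supports (e j) (proj₁ (proj₂ (proj₂ enum)) j)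
      ; off-face = λ i i∉ → hyperplane-off N S supports i (i∉ ∘ subst (i ∈ₛ_) (≡.sym image≡S))
      }

  vertexSet-unique : ∀ {c b} (s : FacetStructure c b) S → (∀ i → i ∈ₛ S ⇔ face c b (point i)) → image (FacetStructure.e s) ≡ S
  vertexSet-unique {c} {b} s S S⇔face = ⊆-antisym
    (λ i∈ → let (j , eq) = ∈-image⁻ e i∈ in
      subst (_∈ₛ S) eq (Equivalence.from (S⇔face (e j)) (vertex∈conv point (e j) , on-face j)))
    (λ {i} i∈ → decidable-stable (i ∈? image e) λ i∉ → off-face i i∉ (proj₂ (Equivalence.to (S⇔face i) i∈)))
    where open FacetStructure s

  facetVertexSet⁻¹ : ∀ S → FacetVertexSet S → S ∈ facetList
  facetVertexSet⁻¹ S (c , b , (valid , dim) , S⇔face) =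
    subst (_∈ facetList) (vertexSet-unique s S S⇔face) (FacetStructure.isFacet s)
    where
    s : FacetStructure c b
    s = facet-structure c b valid dim

  simplex : ∀ c b → Valid c b → HasDimension (face c b) 3 →
    ∃ λ d → Σ (Vector (Vector Carrier 4) (suc d)) λ q → AffinelyIndependent q × (∀ x → face c b x ⇔ conv q x)
  simplex c b valid dim = simplex′ (facet-structure c b valid dim)
    where
    simplex′ : FacetStructure c b →
      ∃ λ d → Σ (Vector (Vector Carrier 4) (suc d)) λ q → AffinelyIndependent q × (∀ x → face c b x ⇔ conv q x)
    simplex′ s = 3 , point ∘ e , affinelyIndependent₄ e injective , face⇔conv c b valid s
      where open FacetStructure s

  Vertex : Pred (Vector Carrier 4) 0ℓ
  Vertex v = ∃₂ λ c b → Valid c b × (∀ x → face c b x ⇔ x ≋ v)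

  -- A generator of positive weight in `v` lies on the face by complementary slackness, and the face
  -- consists of `v` alone.
  vertex⇒point : ∀ v → Vertex v → ∃ λ i → point i ≋ v
  vertex⇒point v (c , b , valid , face⇔v) =
    let ((μ , 0≤μ , Σμ≈1 , μp≋v) , cv≈b) = Equivalence.from (face⇔v v) (λ _ → refl)
        (i , 0<μᵢ) = pos-weight μ 0≤μ Σμ≈1
    in i , Equivalence.to (face⇔v (point i)) (vertex∈conv point i ,
         complementary-slackness point c b (λ i → valid (point i) (vertex∈conv point i)) (μ , 0≤μ , Σμ≈1 , μp≋v) cv≈b i 0<μᵢ)

  singleton : Fin 12 → Subset 12
  singleton i = image {1} (λ _ → i)

  vertex-supports : ∀ i → Supports (lookup vertexSupports i) (singleton i)
  vertex-supports i j =
    (λ j∈ → proj₁ (vertex-support i j) (proj₂ (∈-image⁻ {1} (λ _ → i) j∈))) ,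
    (λ j∉ → proj₂ (vertex-support i j) λ eq → j∉ (subst (_∈ₛ singleton i) eq (∈-image⁺ {1} (λ _ → i) zero)))

  point⇒vertex : ∀ v i → point i ≋ v → Vertex v
  point⇒vertex v i pᵢ≋v = c , b , hyperplane-valid N (singleton i) sup , λ x → mk⇔
    (λ (x∈ , cx≈b) → single x (face⊆conv point c b (hyperplane-valid′ N (singleton i) sup) (λ _ → i) on-or-off x x∈ cx≈b))
    (λ x≋v → ∈conv-cong point (λ k → trans (pᵢ≋v k) (sym (x≋v k))) (vertex∈conv point i) ,
             trans (dot-congʳ c (λ k → trans (x≋v k) (sym (pᵢ≋v k)))) (hyperplane-on N (singleton i) sup i (∈-image⁺ {1} (λ _ → i) zero)))
    where
    N = lookup vertexSupports i
    sup = vertex-supports i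
    c = proj₁ (hyperplane N)
    b = proj₂ (hyperplane N)
    on-or-off : ∀ j → (∃ λ (_ : Fin 1) → i ≡ j) ⊎ ¬ (dot c (point j) ≈ b)
    on-or-off j with j ∈? singleton i
    ... | yes j∈ = inj₁ (∈-image⁻ {1} (λ _ → i) j∈)
    ... | no j∉ = inj₂ (hyperplane-off N (singleton i) sup j j∉)
    single : ∀ x → conv {1} (λ _ → point i) x → x ≋ v
    single x (μ , _ , Σμ≈1 , μp≋x) k = begin
      x k                          ≈⟨ μp≋x k ⟨
      μ zero * point i k + 0#      ≈⟨ +-identityʳ (μ zero * point i k) ⟩
      μ zero * point i k           ≈⟨ *-congʳ (trans (sym (+-identityʳ (μ zero))) Σμ≈1) ⟩
      1# * point i k               ≈⟨ *-identityˡ (point i k) ⟩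
      point i k                    ≈⟨ pᵢ≋v k ⟩
      v k                          ∎

  -- The hyperplane that exposes point `i` misses all the others.
  point-injective : ∀ i j → point i ≋ point j → i ≡ j
  point-injective i j pᵢ≋pⱼ with i ≟ᶠ j
  ... | yes eq = eq
  ... | no i≢j = ⊥-elim (hyperplane-off N (singleton i) (vertex-supports i) j j∉
          (trans (dot-congʳ c (λ k → sym (pᵢ≋pⱼ k))) (hyperplane-on N (singleton i) (vertex-supports i) i (∈-image⁺ {1} (λ _ → i) zero))))
    where
    N = lookup vertexSupports i
    c = proj₁ (hyperplane N)
    j∉ : j ∉ₛ singleton i
    j∉ j∈ = i≢j (proj₂ (∈-image⁻ {1} (λ _ → i) j∈))

-- A straight-line drawing

-- A Tutte embedding, rounded to integers.
gridPoints : List (Vec ℤ 2)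
gridPoints =
  (  + 25 ∷ ℤ.- + 1  ∷ []) ∷ (  + 16 ∷   + 0  ∷ []) ∷ (  + 11 ∷   + 12 ∷ []) ∷ (  + 10 ∷ ℤ.- + 13 ∷ []) ∷
  (  + 16 ∷   + 19 ∷ []) ∷ (  + 12 ∷   + 5  ∷ []) ∷ (  + 15 ∷ ℤ.- + 20 ∷ []) ∷ (  + 12 ∷ ℤ.- + 6  ∷ []) ∷
  (  + 9  ∷   + 4  ∷ []) ∷ (  + 7  ∷   + 6  ∷ []) ∷ (  + 4  ∷   + 10 ∷ []) ∷ (  + 5  ∷   + 11 ∷ []) ∷
  (  + 0  ∷   + 12 ∷ []) ∷ (ℤ.- + 9 ∷   + 16 ∷ []) ∷ (ℤ.- + 5 ∷   + 25 ∷ []) ∷ (  + 9  ∷ ℤ.- + 5  ∷ []) ∷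
  (  + 7  ∷ ℤ.- + 6  ∷ []) ∷ (  + 3  ∷ ℤ.- + 10 ∷ []) ∷ (  + 4  ∷ ℤ.- + 12 ∷ []) ∷ (ℤ.- + 1 ∷ ℤ.- + 12 ∷ []) ∷
  (ℤ.- + 10 ∷ ℤ.- + 16 ∷ []) ∷ (ℤ.- + 6 ∷ ℤ.- + 24 ∷ []) ∷ (  + 8  ∷   + 2  ∷ []) ∷ (ℤ.- + 22 ∷   + 11 ∷ []) ∷
  (  + 8  ∷ ℤ.- + 3  ∷ []) ∷ (ℤ.- + 23 ∷ ℤ.- + 10 ∷ []) ∷ []

-- The points are those of pieceList in the same order; other sets go to the origin.
position : Subset 12 → Vec ℤ 2
position S = search pieceList gridPoints
  where
  search : List (Subset 12) → List (Vec ℤ 2) → Vec ℤ 2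
  search (T ∷ Ts) (p ∷ ps) with S ≟ˢ T
  ... | yes _ = p
  ... | no  _ = search Ts ps
  search _ _ = 0ℤ ∷ 0ℤ ∷ []

-- f = (α , β , γ) stands for the affine functional αx + βy + γ.
at : Vec ℤ 3 → Vec ℤ 2 → ℤ
at (α ∷ β ∷ γ ∷ []) (x ∷ y ∷ []) = α ℤ.* x ℤ.+ β ℤ.* y ℤ.+ γ

-- The signs at u, v, x, y of a functional that is positive inside the
-- segment uv and nonpositive on the segment xy.
Signs : (fu fv fx fy : ℤ) → Set
Signs fu fv fx fy = (0ℤ ℤ.≤ fu × 0ℤ ℤ.≤ fv) × (0ℤ ℤ.< fu ⊎ 0ℤ ℤ.< fv) × (fx ℤ.≤ 0ℤ × fy ℤ.≤ 0ℤ)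

signs? : ∀ fu fv fx fy → Dec (Signs fu fv fx fy)
signs? fu fv fx fy =
  ((0ℤ ℤ.≤? fu) ×-dec (0ℤ ℤ.≤? fv)) ×-dec ((0ℤ ℤ.<? fu) ⊎-dec (0ℤ ℤ.<? fv)) ×-dec ((fx ℤ.≤? 0ℤ) ×-dec (fy ℤ.≤? 0ℤ))

Separates : (u v x y : Vec ℤ 2) → Vec ℤ 3 → Set
Separates u v x y f = Signs (at f u) (at f v) (at f x) (at f y)

-- Disjoint segments in general position are separated by a line through an
-- endpoint of each; the two orthogonal lines separate a segment from its own
-- endpoints.
candidates : (u v x y : Vec ℤ 2) → List (Vec ℤ 3)
candidates u v x y = line u x ∷ line x u ∷ line u y ∷ line y u ∷ line v x ∷ line x v ∷ line v y ∷ line y v ∷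
                     orthogonal u v ∷ orthogonal v u ∷ []
  where
  through : ℤ → ℤ → Vec ℤ 2 → Vec ℤ 3
  through α β (x ∷ y ∷ []) = α ∷ β ∷ ℤ.- (α ℤ.* x ℤ.+ β ℤ.* y) ∷ []
  line orthogonal : Vec ℤ 2 → Vec ℤ 2 → Vec ℤ 3
  line p@(x₁ ∷ y₁ ∷ []) (x₂ ∷ y₂ ∷ []) = through (y₁ ℤ.- y₂) (x₂ ℤ.- x₁) p
  orthogonal p@(x₁ ∷ y₁ ∷ []) (x₂ ∷ y₂ ∷ []) = through (x₂ ℤ.- x₁) (y₂ ℤ.- y₁) p

Separable : (u v x y : Vec ℤ 2) → Set
Separable u v x y = Any (Separates u v x y) (candidates u v x y)

separable? : ∀ u v x y → Dec (Separable u v x y)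
separable? u v x y = Any.any? (λ f → signs? (at f u) (at f v) (at f x) (at f y)) (candidates u v x y)

-- Every edge occurs in both orientations, as a drawing has an arc for each of them.
edges : List (Subset 12 × Subset 12)
edges = filter (λ (S , T) → ∣ S ∩ T ∣ ℕ.≟ 3) (cartesianProduct pieceList pieceList)

∈-edges : ∀ {S T} → Piece S → Piece T → ∣ S ∩ T ∣ ≡ 3 → (S , T) ∈ edges
∈-edges S∈ T∈ eq = ∈-filter⁺ (λ (S , T) → ∣ S ∩ T ∣ ℕ.≟ 3) (∈-cartesianProduct⁺ S∈ T∈) eq

Segment : Set
Segment = (Subset 12 × Subset 12) × Vec ℤ 2 × Vec ℤ 2

draw : Subset 12 × Subset 12 → Segment
draw (S , T) = (S , T) , position S , position T

SameEdge : Subset 12 × Subset 12 → Subset 12 × Subset 12 → Set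
SameEdge (S , T) (S′ , T′) = (S ≡ S′ × T ≡ T′) ⊎ (S ≡ T′ × T ≡ S′)

sameEdge? : ∀ e e′ → Dec (SameEdge e e′)
sameEdge? (S , T) (S′ , T′) = ((S ≟ˢ S′) ×-dec (T ≟ˢ T′)) ⊎-dec ((S ≟ˢ T′) ×-dec (T ≟ˢ S′))

Disjoint : Segment → Segment → Set
Disjoint (e , u , v) (e′ , x , y) = SameEdge e e′ ⊎ Separable u v x y

disjoint? : ∀ s s′ → Dec (Disjoint s s′)
disjoint? (e , u , v) (e′ , x , y) = sameEdge? e e′ ⊎-dec separable? u v x y

-- The list is an argument in order to be evaluated only once.
pairwise? : ∀ {X Y : Set} {R : X → Y → Set} → (∀ x y → Dec (R x y)) → ∀ xs ys → Dec (All (λ x → All (R x) ys) xs)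
pairwise? R? xs ys = All.all? (λ x → All.all? (R? x) ys) xs

-- A Lipschitz constant for all drawn edges in each coordinate. Grid coordinates are at most 25 in
-- absolute value, so differences stay below 100.
lengthBound : ℤ
lengthBound = + 100

abstract
  edges-disjoint : ∀ {S T S′ T′} → (S , T) ∈ edges → (S′ , T′) ∈ edges → ¬ SameEdge (S , T) (S′ , T′) →
                   Separable (position S) (position T) (position S′) (position T′)
  edges-disjoint ST∈ S′T′∈ different = fromInj₂ (⊥-elim ∘ different)
    (All.lookup (All.lookup (toWitness {a? = square? (map draw edges)} tt) (∈-map⁺ draw ST∈)) (∈-map⁺ draw S′T′∈))
    where
    square? : ∀ xs → Dec (All (λ x → All (Disjoint x) xs) xs)
    square? xs = pairwise? disjoint? xs xs

  -- A point is treated as a degenerate segment. The endpoints of the edge itself are included,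
  -- since its interior must avoid them too.
  edges-avoid-points : ∀ {S T U} → (S , T) ∈ edges → Piece U → Separable (position S) (position T) (position U) (position U)
  edges-avoid-points ST∈ U∈ = All.lookup (All.lookup
    (toWitness {a? = pairwise? (λ (_ , u , v) x → separable? u v x x) (map draw edges) (map position pieceList)} tt)
    (∈-map⁺ draw ST∈)) (∈-map⁺ position U∈)

  -- The differing coordinate is recorded because it also makes the parametrised segment injective.
  positions-distinct : ∀ {S T} → Piece S → Piece T → S ≡ T ⊎ ∃ λ k → lookup (position T) k ℤ.- lookup (position S) k ≢ 0ℤ
  positions-distinct S∈ T∈ = All.lookup (All.lookup (toWitness {a? = All.all? (λ S → All.all? (λ T → (S ≟ˢ T) ⊎-dec
    any? (λ k → ¬? (lookup (position T) k ℤ.- lookup (position S) k ℤ.≟ 0ℤ))) pieceList) pieceList} tt) S∈) T∈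

  edges-short : ∀ {S T} → (S , T) ∈ edges → ∀ k →
    let d = lookup (position T) k ℤ.- lookup (position S) k in 0ℤ ℤ.< lengthBound ℤ.+ d × 0ℤ ℤ.< lengthBound ℤ.- d
  edges-short ST∈ = All.lookup (toWitness {a? = All.all? (λ e → all? λ k →
    let d = lookup (position (proj₂ e)) k ℤ.- lookup (position (proj₁ e)) k in
    (0ℤ ℤ.<? lengthBound ℤ.+ d) ×-dec (0ℤ ℤ.<? lengthBound ℤ.- d)) edges} tt) ST∈

module Drawing (𝓡 : OrderedRing) where

  open OrderedRing 𝓡 hiding (zero)
  open IsRingHomomorphism fromℤ-isHomomorphism
  open IntegerCoefficients commutativeRing fromℤ fromℤ-isHomomorphism using (solve; _:+_; _:*_; :-_; _:=_)
  open LinearAlgebra 𝓡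
  open import Relation.Binary.Reasoning.Setoid setoid

  interpolate : Carrier → Carrier → Carrier → Carrier
  interpolate a b t = a + t * (b + - a)

  convex-form : ∀ a b t → (1# + - t) * a + t * b ≈ interpolate a b t
  convex-form a b t = trans
    (solve 4 (λ o a b t → (o :+ :- t) :* a :+ t :* b := o :* a :+ t :* (b :+ :- a)) refl 1# a b t)
    (+-congʳ (*-identityˡ a))

  interpolate-nonneg : ∀ {a b t} → 0# ≤ t → t ≤ 1# → 0# ≤ a → 0# ≤ b → 0# ≤ interpolate a b t
  interpolate-nonneg {a} {b} {t} 0≤t t≤1 0≤a 0≤b = ≤-resp-≈ refl (convex-form a b t)
    (nonneg-+ (nonneg-* (≤⇒nonneg-difference t≤1) 0≤a) (nonneg-* 0≤t 0≤b))

  interpolate-pos : ∀ {a b t} → 0# < t → t < 1# → 0# ≤ a → 0# ≤ b → 0# < a ⊎ 0# < b → 0# < interpolate a b t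
  interpolate-pos {a} {b} {t} 0<t t<1 0≤a 0≤b (inj₁ 0<a) = <-resp-≈ refl (convex-form a b t)
    (pos-+-nonneg (*-pos (<⇒pos-difference t<1) 0<a) (nonneg-* (<⇒≤ 0<t) 0≤b))
  interpolate-pos {a} {b} {t} 0<t t<1 0≤a 0≤b (inj₂ 0<b) = <-resp-≈ refl (trans (+-comm _ _) (convex-form a b t))
    (pos-+-nonneg (*-pos 0<t 0<b) (nonneg-* (<⇒≤ (<⇒pos-difference t<1)) 0≤a))

  gridPoint : Vec ℤ 2 → Vector Carrier 2
  gridPoint p k = fromℤ (lookup p k)

  segment : Vec ℤ 2 → Vec ℤ 2 → Carrier → Vector Carrier 2
  segment p q t k = interpolate (gridPoint p k) (gridPoint q k) t

  evaluate : Vec ℤ 3 → Vector Carrier 2 → Carrier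
  evaluate (α ∷ β ∷ γ ∷ []) x = fromℤ α * x zero + fromℤ β * x (suc zero) + fromℤ γ

  evaluate-cong : ∀ f {x y} → x ≋ y → evaluate f x ≈ evaluate f y
  evaluate-cong (α ∷ β ∷ γ ∷ []) x≋y = +-congʳ (+-cong (*-congˡ (x≋y zero)) (*-congˡ (x≋y (suc zero))))

  evaluate-gridPoint : ∀ f p → evaluate f (gridPoint p) ≈ fromℤ (at f p)
  evaluate-gridPoint (α ∷ β ∷ γ ∷ []) (x ∷ y ∷ []) = sym (trans (+-homo (α ℤ.* x ℤ.+ β ℤ.* y) γ)
    (+-congʳ (trans (+-homo (α ℤ.* x) (β ℤ.* y)) (+-cong (*-homo α x) (*-homo β y)))))

  evaluate-segment : ∀ f p q t → evaluate f (segment p q t) ≈ interpolate (fromℤ (at f p)) (fromℤ (at f q)) t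
  evaluate-segment f@(α ∷ β ∷ γ ∷ []) p q t = trans
    (solve 8 (λ α β γ x₁ y₁ x₂ y₂ t → α :* (x₁ :+ t :* (x₂ :+ :- x₁)) :+ β :* (y₁ :+ t :* (y₂ :+ :- y₁)) :+ γ
                 := (α :* x₁ :+ β :* y₁ :+ γ) :+ t :* ((α :* x₂ :+ β :* y₂ :+ γ) :+ :- (α :* x₁ :+ β :* y₁ :+ γ))) refl
      (fromℤ α) (fromℤ β) (fromℤ γ) (gridPoint p zero) (gridPoint p (suc zero)) (gridPoint q zero) (gridPoint q (suc zero)) t)
    (+-cong (evaluate-gridPoint f p) (*-congˡ (+-cong (evaluate-gridPoint f q) (-‿cong (evaluate-gridPoint f p)))))

  fromℤ-neg-nonneg : ∀ {i} → i ℤ.≤ 0ℤ → 0# ≤ - fromℤ i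
  fromℤ-neg-nonneg {i} i≤0 = ≤-resp-≈ refl (-‿homo i) (fromℤ-nonneg (ℤ.neg-mono-≤ i≤0))

  -- Affine functionals commute with interpolation, so at a common point the separating one would be
  -- both positive and nonpositive. The values on `xy` are negated in order to use
  -- `interpolate-nonneg`.
  separable⇒disjoint : ∀ {u v x y} → Separable u v x y → ∀ {s t} → 0# < s → s < 1# → 0# ≤ t → t ≤ 1# →
                       ¬ (segment u v s ≋ segment x y t)
  separable⇒disjoint {u} {v} {x} {y} separable {s} {t} 0<s s<1 0≤t t≤1 same with find separable
  ... | f , _ , (0≤fu , 0≤fv) , 0<f , (fx≤0 , fy≤0) =
    interpolate-nonneg 0≤t t≤1 (fromℤ-neg-nonneg fx≤0) (fromℤ-neg-nonneg fy≤0)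
      (<-resp-≈ negate refl (pos⇒-<0 (interpolate-pos 0<s s<1 (fromℤ-nonneg 0≤fu) (fromℤ-nonneg 0≤fv) (positive 0<f))))
    where
    positive : 0ℤ ℤ.< at f u ⊎ 0ℤ ℤ.< at f v → 0# < fromℤ (at f u) ⊎ 0# < fromℤ (at f v)
    positive (inj₁ h) = inj₁ (fromℤ-pos h)
    positive (inj₂ h) = inj₂ (fromℤ-pos h)
    negate : - interpolate (fromℤ (at f u)) (fromℤ (at f v)) s ≈ interpolate (- fromℤ (at f x)) (- fromℤ (at f y)) t
    negate = begin
      - interpolate (fromℤ (at f u)) (fromℤ (at f v)) s      ≈⟨ -‿cong (evaluate-segment f u v s) ⟨
      - evaluate f (segment u v s)                           ≈⟨ -‿cong (evaluate-cong f same) ⟩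
      - evaluate f (segment x y t)                           ≈⟨ -‿cong (evaluate-segment f x y t) ⟩
      - interpolate (fromℤ (at f x)) (fromℤ (at f y)) t
        ≈⟨ solve 3 (λ a b t → :- (a :+ t :* (b :+ :- a)) := :- a :+ t :* (:- b :+ :- :- a)) refl (fromℤ (at f x)) (fromℤ (at f y)) t ⟩
      interpolate (- fromℤ (at f x)) (- fromℤ (at f y)) t    ∎

  segment-start : ∀ p q → segment p q 0# ≋ gridPoint p
  segment-start p q k = trans (+-congˡ (zeroˡ _)) (+-identityʳ _)

  segment-end : ∀ p q → segment p q 1# ≋ gridPoint q
  segment-end p q k = trans (+-congˡ (*-identityˡ _))
    (solve 2 (λ a b → a :+ (b :+ :- a) := b) refl (gridPoint p k) (gridPoint q k))

  segment-constant : ∀ p t → segment p p t ≋ gridPoint p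
  segment-constant p t k = trans (+-congˡ (trans (*-congˡ (-‿inverseʳ (gridPoint p k))) (zeroʳ t))) (+-identityʳ _)

  separable⇒avoids : ∀ {u v x} → Separable u v x x → ∀ {t} → 0# < t → t < 1# → ¬ (segment u v t ≋ gridPoint x)
  separable⇒avoids {x = x} separable 0<t t<1 same = separable⇒disjoint separable 0<t t<1 (<-irrefl 0#) (<⇒≤ 0<1#)
    λ k → trans (same k) (sym (segment-constant x 0# k))

  difference : ∀ p q k → gridPoint q k + - gridPoint p k ≈ fromℤ (lookup q k ℤ.- lookup p k)
  difference p q k = sym (trans (+-homo (lookup q k) (ℤ.- lookup p k)) (+-congˡ (-‿homo (lookup p k))))

  -- In coordinate `k` the difference of the two points is `s - t` times a nonzero integer.
  segment-injective : ∀ p q k → lookup q k ℤ.- lookup p k ≢ 0ℤ → ∀ {s t} → segment p q s ≋ segment p q t → s ≈ t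
  segment-injective p q k d≢0 {s} {t} same = x-y≈0⇒x≈y (*-zero-cancelʳ
      (trans (solve 4 (λ a d s t → (s :+ :- t) :* d := (a :+ s :* d) :+ :- (a :+ t :* d)) refl a d s t)
             (trans (+-congʳ (same k)) (-‿inverseʳ _)))
      (#0-cong (sym (difference p q k)) (fromℤ-#0 d≢0)))
    where
    a = gridPoint p k
    d = gridPoint q k + - gridPoint p k

  -- No division by two: cotransitivity places `x` in the interval from `0#` to `x + x`, and either
  -- outcome makes it positive.
  halve-pos : ∀ {x} → 0# < x + x → 0# < x
  halve-pos {x} h with <-cotrans h x
  ... | inj₁ 0<x = 0<x
  ... | inj₂ x<x+x = <-resp-≈ (-‿inverseʳ x) (solve 1 (λ x → x :+ x :+ :- x := x) refl x) (+-monoˡ-< (- x) x<x+x)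

  -- 2 (m δ + x d) = (δ + x)(m + d) + (δ − x)(m − d)
  lipschitz : ∀ {m d δ x} → 0# < m + d → 0# < m + - d → 0# < δ + x → 0# < δ + - x → 0# < m * δ + x * d
  lipschitz {m} {d} {δ} {x} h₁ h₂ h₃ h₄ = halve-pos (<-resp-≈ refl
    (solve 4 (λ m d δ x → (δ :+ x) :* (m :+ d) :+ (δ :+ :- x) :* (m :+ :- d) := m :* δ :+ x :* d :+ (m :* δ :+ x :* d)) refl m d δ x)
    (pos-+-nonneg (*-pos h₃ h₁) (<⇒≤ (*-pos h₄ h₂))))

  -- Each coordinate is Lipschitz with constant `lengthBound`, so `ε` divided by this constant
  -- serves at every `s`.
  segment-continuous : ∀ p q → (∀ k → let d = lookup q k ℤ.- lookup p k in 0ℤ ℤ.< lengthBound ℤ.+ d × 0ℤ ℤ.< lengthBound ℤ.- d) →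
    ∀ s ε → 0# < ε → ∃ λ δ → 0# < δ × (∀ t → s < t + δ × t < s + δ →
      ∀ k → segment p q s k < segment p q t k + ε × segment p q t k < segment p q s k + ε)
  segment-continuous p q short s ε 0<ε = δ , *-pos 0<ε 0<m⁻¹ , λ t (s<t+δ , t<s+δ) k →
      close s t (gridPoint p k) _ (bound k) (<⇒pos-difference s<t+δ) (<⇒pos-difference t<s+δ) ,
      close t s (gridPoint p k) _ (bound k) (<⇒pos-difference t<s+δ) (<⇒pos-difference s<t+δ)
    where
    m : Carrier
    m = fromℤ lengthBound
    inverse : ∃ λ y → m * y ≈ 1#
    inverse = fromℤ-inverse {lengthBound} λ ()
    0<m : 0# < m
    0<m = fromℤ-pos (ℤ.+<+ (ℕ.s≤s ℕ.z≤n))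
    0<m⁻¹ : 0# < proj₁ inverse
    0<m⁻¹ with #0-*ʳ (#0-cong (sym (proj₂ inverse)) 1#0)
    ... | inj₂ h = h
    ... | inj₁ h = ⊥-elim (<-irrefl 0# (<-trans 0<1# (<-resp-≈ (trans eq (proj₂ inverse)) refl (pos⇒-<0 (*-pos 0<m (<0⇒-pos h))))))
      where
      eq : - (m * - proj₁ inverse) ≈ m * proj₁ inverse
      eq = solve 2 (λ m y → :- (m :* :- y) := m :* y) refl m (proj₁ inverse)
    δ : Carrier
    δ = ε * proj₁ inverse
    mδ≈ε : m * δ ≈ ε
    mδ≈ε = trans (solve 3 (λ m e y → m :* (e :* y) := e :* (m :* y)) refl m ε (proj₁ inverse))
                 (trans (*-congˡ (proj₂ inverse)) (*-identityʳ ε))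
    Bounded : Carrier → Set
    Bounded d = 0# < m + d × 0# < m + - d
    bound : ∀ k → Bounded (gridPoint q k + - gridPoint p k)
    bound k = <-resp-≈ refl (trans (+-homo lengthBound d) (+-congˡ (sym (difference p q k)))) (fromℤ-pos (proj₁ (short k))) ,
              <-resp-≈ refl (trans (+-homo lengthBound (ℤ.- d)) (+-congˡ (trans (-‿homo d) (-‿cong (sym (difference p q k)))))) (fromℤ-pos (proj₂ (short k)))
      where d = lookup q k ℤ.- lookup p k
    close : ∀ s t a d → Bounded d → 0# < t + δ + - s → 0# < s + δ + - t → a + s * d < a + t * d + ε
    -- As `m * δ` is `ε`, the claim amounts to positivity of `m * δ + (t - s) * d`.
    close s t a d (h₁ , h₂) h₃ h₄ = pos-difference⇒< (<-resp-≈ refl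
      (trans (+-congʳ mδ≈ε) (solve 5 (λ e s t a d → e :+ (t :+ :- s) :* d := a :+ t :* d :+ e :+ :- (a :+ s :* d)) refl ε s t a d))
      (lipschitz h₁ h₂
        (<-resp-≈ refl (solve 3 (λ δ s t → t :+ δ :+ :- s := δ :+ (t :+ :- s)) refl δ s t) h₃)
        (<-resp-≈ refl (solve 3 (λ δ s t → s :+ δ :+ :- t := δ :+ :- (t :+ :- s)) refl δ s t) h₄)))

  gridPoint-injective : ∀ {p q} k → lookup q k ℤ.- lookup p k ≢ 0ℤ → ¬ (gridPoint p ≋ gridPoint q)
  gridPoint-injective {p} {q} k d≢0 same = ≈0⇒¬#0
    (trans (sym (difference p q k)) (trans (+-congʳ (sym (same k))) (-‿inverseʳ (gridPoint p k)))) (fromℤ-#0 d≢0)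

-- The ordered ring of real numbers

open import Defs
open ≡ using (refl; sym; trans)

private
  -- Every linear inequality below is the sum of the given ones up to a
  -- ring identity, which is how it reaches this lemma.
  from-difference : ∀ {a b} c d → a ℚ.≤ b → b ℚ.- a ≡ d ℚ.- c → c ℚ.≤ d
  from-difference {a} {b} c d a≤b eq = subst₂ ℚ._≤_ (left a c) right
    (ℚ.+-monoˡ-≤ (c ℚ.- a) a≤b)
    where
    open ℚ.+-*-Solver
    left : ∀ a c → a ℚ.+ (c ℚ.- a) ≡ c
    left = solve 2 (λ a c → a :+ (c :- a) := c) refl
    shuffle : ∀ a b c → b ℚ.+ (c ℚ.- a) ≡ c ℚ.+ (b ℚ.- a)
    shuffle = solve 3 (λ a b c → b :+ (c :- a) := c :+ (b :- a)) refl
    cancel : ∀ c d → c ℚ.+ (d ℚ.- c) ≡ d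
    cancel = solve 2 (λ c d → c :+ (d :- c) := d) refl
    right : b ℚ.+ (c ℚ.- a) ≡ d
    right = trans (shuffle a b c) (trans (cong (c ℚ.+_) eq) (cancel c d))

  -- Two approximations with error `δ` use up half of `ε`; the other half is the margin that strict
  -- inequalities need.
  quarter : ∀ ε → 0ℚ ℚ.< ε → ∃ λ δ → 0ℚ ℚ.< δ × δ ℚ.+ δ ℚ.+ (δ ℚ.+ δ) ≡ ε
  quarter ε 0<ε = ½ ℚ.* (½ ℚ.* ε) , half (half 0<ε) , eq ε
    where
    half : ∀ {q} → 0ℚ ℚ.< q → 0ℚ ℚ.< ½ ℚ.* q
    half {q} 0<q = subst (ℚ._< ½ ℚ.* q) (ℚ.*-zeroʳ ½) (ℚ.*-monoʳ-<-pos ½ 0<q)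
    open ℚ.+-*-Solver
    eq : ∀ ε → ½ ℚ.* (½ ℚ.* ε) ℚ.+ ½ ℚ.* (½ ℚ.* ε) ℚ.+ (½ ℚ.* (½ ℚ.* ε) ℚ.+ ½ ℚ.* (½ ℚ.* ε)) ≡ ε
    eq = solve 1 (λ e → con ½ :* (con ½ :* e) :+ con ½ :* (con ½ :* e)
                   :+ (con ½ :* (con ½ :* e) :+ con ½ :* (con ½ :* e)) := e) refl

  ∣∣<⇒≤ : ∀ a b {ε} → ℚ.∣ a ℚ.- b ∣ ℚ.< ε → a ℚ.≤ b ℚ.+ ε
  ∣∣<⇒≤ a b {ε} h = from-difference a (b ℚ.+ ε)
      (ℚ.≤-trans (p≤∣p∣ (a ℚ.- b)) (ℚ.<⇒≤ h)) (eq a b ε)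
    where
    open ℚ.+-*-Solver
    eq : ∀ a b e → e ℚ.- (a ℚ.- b) ≡ b ℚ.+ e ℚ.- a
    eq = solve 3 (λ a b e → e :- (a :- b) := b :+ e :- a) refl
    p≤∣p∣ : ∀ p → p ℚ.≤ ℚ.∣ p ∣
    p≤∣p∣ p with ℚ.≤-total 0ℚ p
    ... | inj₁ 0≤p = ℚ.≤-reflexive (sym (ℚ.0≤p⇒∣p∣≡p 0≤p))
    ... | inj₂ p≤0 = ℚ.≤-trans p≤0 (ℚ.0≤∣p∣ p)

  ∣-∣-sym : ∀ a b → ℚ.∣ a ℚ.- b ∣ ≡ ℚ.∣ b ℚ.- a ∣
  ∣-∣-sym a b = trans (cong ℚ.∣_∣ (eq a b)) (ℚ.∣-p∣≡∣p∣ (b ℚ.- a))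
    where
    open ℚ.+-*-Solver
    eq : ∀ a b → a ℚ.- b ≡ ℚ.- (b ℚ.- a)
    eq = solve 2 (λ a b → a :- b := :- (b :- a)) refl

  ∣∣<⇒≥ : ∀ a b {ε} → ℚ.∣ a ℚ.- b ∣ ℚ.< ε → b ℚ.≤ a ℚ.+ ε
  ∣∣<⇒≥ a b h = ∣∣<⇒≤ b a (subst (ℚ._< _) (∣-∣-sym a b) h)

  ≤⇒∣∣< : ∀ a b {δ ε} → 0ℚ ℚ.< δ → δ ℚ.+ δ ℚ.≤ ε → a ℚ.≤ b ℚ.+ δ → b ℚ.≤ a ℚ.+ δ → ℚ.∣ a ℚ.- b ∣ ℚ.< ε
  ≤⇒∣∣< a b {δ} {ε} 0<δ 2δ≤ε h k =
      ℚ.≤-<-trans bound′ (ℚ.<-≤-trans δ<2δ 2δ≤ε)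
    where
    open ℚ.+-*-Solver
    δ<2δ : δ ℚ.< δ ℚ.+ δ
    δ<2δ = subst (ℚ._< δ ℚ.+ δ) (ℚ.+-identityʳ δ) (ℚ.+-monoʳ-< δ 0<δ)
    e₁ : ∀ a b d → b ℚ.+ d ℚ.- a ≡ d ℚ.- (a ℚ.- b)
    e₁ = solve 3 (λ a b d → b :+ d :- a := d :- (a :- b)) refl
    e₂ : ∀ a b d → a ℚ.+ d ℚ.- b ≡ d ℚ.- ℚ.- (a ℚ.- b)
    e₂ = solve 3 (λ a b d → a :+ d :- b := d :- :- (a :- b)) refl
    bound′ : ℚ.∣ a ℚ.- b ∣ ℚ.≤ δ
    bound′ with ℚ.∣p∣≡p∨∣p∣≡-p (a ℚ.- b)
    ... | inj₁ eq = subst (ℚ._≤ δ) (sym eq) (from-difference (a ℚ.- b) δ h (e₁ a b δ))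
    ... | inj₂ eq = subst (ℚ._≤ δ) (sym eq) (from-difference (ℚ.- (a ℚ.- b)) δ k (e₂ a b δ))

≃-pointwise : ∀ {x y} → (∀ n → seq x n ≡ seq y n) → x ≃ y
≃-pointwise {x} {y} h ε 0<ε = 0 , λ n _ →
  subst (ℚ._< ε) (sym (cong ℚ.∣_∣ (trans (cong (ℚ._- seq y n) (h n)) (ℚ.+-inverseʳ (seq y n))))) 0<ε

≃-refl : ∀ {x} → x ≃ x
≃-refl {x} = ≃-pointwise {x} {x} λ _ → refl

≃-sym : ∀ {x y} → x ≃ y → y ≃ x
≃-sym {x} {y} h ε 0<ε = let (N , p) = h ε 0<ε in
  N , λ n N≤n → subst (ℚ._< ε) (∣-∣-sym (seq x n) (seq y n)) (p n N≤n)

private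
  close : ∀ {x y} → x ≃ y → ∀ δ → 0ℚ ℚ.< δ → ∃ λ N → ∀ n → N ℕ.≤ n →
          seq x n ℚ.≤ seq y n ℚ.+ δ × seq y n ℚ.≤ seq x n ℚ.+ δ
  close {x} {y} h δ 0<δ = let (N , p) = h δ 0<δ in
    N , λ n N≤n → ∣∣<⇒≤ (seq x n) (seq y n) (p n N≤n) , ∣∣<⇒≥ (seq x n) (seq y n) (p n N≤n)

  -- Absolute values are traded for two linear inequalities, which `from-difference` can handle. The
  -- doubled `δ` leaves room for the errors of two hypotheses.
  close⁻¹ : ∀ {x y} → (∀ δ → 0ℚ ℚ.< δ → ∃ λ N → ∀ n → N ℕ.≤ n →
            seq x n ℚ.≤ seq y n ℚ.+ (δ ℚ.+ δ) × seq y n ℚ.≤ seq x n ℚ.+ (δ ℚ.+ δ)) → x ≃ y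
  close⁻¹ {x} {y} h ε 0<ε =
    let (δ , 0<δ , eq) = quarter ε 0<ε
        (N , p) = h δ 0<δ
    in N , λ n N≤n → ≤⇒∣∣< (seq x n) (seq y n) (ℚ.+-mono-< 0<δ 0<δ) (ℚ.≤-reflexive eq)
                       (proj₁ (p n N≤n)) (proj₂ (p n N≤n))

≃-trans : ∀ {x y z} → x ≃ y → y ≃ z → x ≃ z
≃-trans {x} {y} {z} h k = close⁻¹ {x} {z} λ δ 0<δ →
  let (M , p) = close {x} {y} h δ 0<δ
      (N , q) = close {y} {z} k δ 0<δ
  in M ℕ.⊔ N , λ n l →
    let (p₁ , p₂) = p n (ℕ.m⊔n≤o⇒m≤o M N l)
        (q₁ , q₂) = q n (ℕ.m⊔n≤o⇒n≤o M N l)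
    in from-difference (seq x n) _ (ℚ.+-mono-≤ p₁ q₁) (eq (seq x n) (seq y n) (seq z n) δ) ,
       from-difference (seq z n) _ (ℚ.+-mono-≤ q₂ p₂) (eq (seq z n) (seq y n) (seq x n) δ)
  where
  open ℚ.+-*-Solver
  eq : ∀ x y z d → y ℚ.+ d ℚ.+ (z ℚ.+ d) ℚ.- (x ℚ.+ y) ≡ z ℚ.+ (d ℚ.+ d) ℚ.- x
  eq = solve 4 (λ x y z d → y :+ d :+ (z :+ d) :- (x :+ y) := z :+ (d :+ d) :- x) refl

+-cong : ∀ {x y u v} → x ≃ y → u ≃ v → x + u ≃ y + v
+-cong {x} {y} {u} {v} h k = close⁻¹ {x + u} {y + v} λ δ 0<δ →
  let (M , p) = close {x} {y} h δ 0<δ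
      (N , q) = close {u} {v} k δ 0<δ
  in M ℕ.⊔ N , λ n l →
    let (p₁ , p₂) = p n (ℕ.m⊔n≤o⇒m≤o M N l)
        (q₁ , q₂) = q n (ℕ.m⊔n≤o⇒n≤o M N l)
    in from-difference _ _ (ℚ.+-mono-≤ p₁ q₁) (eq (seq x n) (seq y n) (seq u n) (seq v n) δ) ,
       from-difference _ _ (ℚ.+-mono-≤ p₂ q₂) (eq (seq y n) (seq x n) (seq v n) (seq u n) δ)
  where
  open ℚ.+-*-Solver
  eq : ∀ x y u v d → y ℚ.+ d ℚ.+ (v ℚ.+ d) ℚ.- (x ℚ.+ u) ≡ y ℚ.+ v ℚ.+ (d ℚ.+ d) ℚ.- (x ℚ.+ u)
  eq = solve 5 (λ x y u v d → y :+ d :+ (v :+ d) :- (x :+ u) := y :+ v :+ (d :+ d) :- (x :+ u)) refl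

infix 8 -_
-_ : ℝ → ℝ
- x = mkℝ (λ n → ℚ.- seq x n) λ ε 0<ε → let (N , p) = cauchy x ε 0<ε in
  N , λ m n h k → subst (ℚ._< ε)
    (trans (∣-∣-sym (seq x m) (seq x n)) (cong ℚ.∣_∣ (eq (seq x m) (seq x n)))) (p m n h k)
  where
  open ℚ.+-*-Solver
  eq : ∀ a b → b ℚ.- a ≡ ℚ.- a ℚ.- ℚ.- b
  eq = solve 2 (λ a b → b :- a := :- a :- :- b) refl

-‿cong : ∀ {x y} → x ≃ y → - x ≃ - y
-‿cong {x} {y} h ε 0<ε = let (N , p) = h ε 0<ε in
  N , λ n l → subst (ℚ._< ε)
    (trans (∣-∣-sym (seq x n) (seq y n)) (cong ℚ.∣_∣ (eq (seq x n) (seq y n)))) (p n l)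
  where
  open ℚ.+-*-Solver
  eq : ∀ a b → b ℚ.- a ≡ ℚ.- a ℚ.- ℚ.- b
  eq = solve 2 (λ a b → b :- a := :- a :- :- b) refl

private
  divide : ∀ B ε → 0ℚ ℚ.< B → 0ℚ ℚ.< ε → ∃ λ δ → 0ℚ ℚ.< δ × B ℚ.* δ ≡ ε
  divide B ε 0<B 0<ε = (ℚ.1/ B) ℚ.* ε ,
      subst (ℚ._< (ℚ.1/ B) ℚ.* ε) (ℚ.*-zeroʳ (ℚ.1/ B)) (ℚ.*-monoʳ-<-pos (ℚ.1/ B) 0<ε) ,
      trans (sym (ℚ.*-assoc B (ℚ.1/ B) ε))
        (trans (cong (ℚ._* ε) (ℚ.*-inverseʳ B)) (ℚ.*-identityˡ ε))
    where
    instance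
      B>0 : ℚ.Positive B
      B>0 = ℚ.positive 0<B
      B≢0 : ℚ.NonZero B
      B≢0 = ℚ.pos⇒nonZero B
      1/B>0 : ℚ.Positive (ℚ.1/ B)
      1/B>0 = ℚ.1/pos⇒pos B

*-congˡ : ∀ {x u v} → u ≃ v → x * u ≃ x * v
*-congˡ {x} {u} {v} h ε 0<ε =
  let (B , M , 0<B , b) = bound x
      (δ , 0<δ , Bδ) = divide B ε 0<B 0<ε
      (N , q) = h δ 0<δ
  in M ℕ.⊔ N , λ n l → begin-strict
    ℚ.∣ seq x n ℚ.* seq u n ℚ.- seq x n ℚ.* seq v n ∣ ≡⟨ cong ℚ.∣_∣ (eq (seq x n) (seq u n) (seq v n)) ⟩
    ℚ.∣ seq x n ℚ.* (seq u n ℚ.- seq v n) ∣ ≡⟨ ℚ.∣p*q∣≡∣p∣*∣q∣ (seq x n) (seq u n ℚ.- seq v n) ⟩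
    ℚ.∣ seq x n ∣ ℚ.* ℚ.∣ seq u n ℚ.- seq v n ∣
      ≤⟨ ℚ.*-monoʳ-≤-nonNeg ℚ.∣ seq u n ℚ.- seq v n ∣ {{ℚ.nonNegative (ℚ.0≤∣p∣ (seq u n ℚ.- seq v n))}}
           (b n (ℕ.m⊔n≤o⇒m≤o M N l)) ⟩
    B ℚ.* ℚ.∣ seq u n ℚ.- seq v n ∣ <⟨ ℚ.*-monoʳ-<-pos B {{ℚ.positive 0<B}} (q n (ℕ.m⊔n≤o⇒n≤o M N l)) ⟩
    B ℚ.* δ ≡⟨ Bδ ⟩
    ε ∎
  where
  open ℚ.≤-Reasoning
  open ℚ.+-*-Solver
  eq : ∀ x u v → x ℚ.* u ℚ.- x ℚ.* v ≡ x ℚ.* (u ℚ.- v)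
  eq = solve 3 (λ x u v → x :* u :- x :* v := x :* (u :- v)) refl

*-comm : ∀ x y → x * y ≃ y * x
*-comm x y = ≃-pointwise {x * y} {y * x} λ n → ℚ.*-comm (seq x n) (seq y n)

*-cong : ∀ {x y u v} → x ≃ y → u ≃ v → x * u ≃ y * v
*-cong {x} {y} {u} {v} h k =
  ≃-trans {x * u} {x * v} {y * v} (*-congˡ {x} {u} {v} k)
  (≃-trans {x * v} {v * x} {y * v} (*-comm x v)
  (≃-trans {v * x} {v * y} {y * v} (*-congˡ {v} {x} {y} h) (*-comm v y)))

+-*-isCommutativeRing : IsCommutativeRing _≃_ _+_ _*_ -_ 0ℝ 1ℝ
+-*-isCommutativeRing = record
  { isRing = record
    { +-isAbelianGroup = record
      { isGroup = record
        { isMonoid = record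
          { isSemigroup = record
            { isMagma = record
              { isEquivalence = record
                { refl  = λ {x} → ≃-refl {x}
                ; sym   = λ {x} {y} → ≃-sym {x} {y}
                ; trans = λ {x} {y} {z} → ≃-trans {x} {y} {z}
                }
              ; ∙-cong = λ {x} {y} {u} {v} → +-cong {x} {y} {u} {v}
              }
            ; assoc = λ x y z → ≃-pointwise {x + y + z} {x + (y + z)}
                        λ n → ℚ.+-assoc (seq x n) (seq y n) (seq z n)
            }
          ; identity = (λ x → ≃-pointwise {0ℝ + x} {x} λ n → ℚ.+-identityˡ (seq x n))
                     , (λ x → ≃-pointwise {x + 0ℝ} {x} λ n → ℚ.+-identityʳ (seq x n))
          }
        ; inverse = (λ x → ≃-pointwise {(- x) + x} {0ℝ} λ n → ℚ.+-inverseˡ (seq x n))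
                  , (λ x → ≃-pointwise {x + (- x)} {0ℝ} λ n → ℚ.+-inverseʳ (seq x n))
        ; ⁻¹-cong = λ {x} {y} → -‿cong {x} {y}
        }
      ; comm = λ x y → ≃-pointwise {x + y} {y + x} λ n → ℚ.+-comm (seq x n) (seq y n)
      }
    ; *-cong = λ {x} {y} {u} {v} → *-cong {x} {y} {u} {v}
    ; *-assoc = λ x y z → ≃-pointwise {x * y * z} {x * (y * z)}
                  λ n → ℚ.*-assoc (seq x n) (seq y n) (seq z n)
    ; *-identity = (λ x → ≃-pointwise {1ℝ * x} {x} λ n → ℚ.*-identityˡ (seq x n))
                 , (λ x → ≃-pointwise {x * 1ℝ} {x} λ n → ℚ.*-identityʳ (seq x n))
    ; distrib = (λ x y z → ≃-pointwise {x * (y + z)} {x * y + x * z}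
                   λ n → ℚ.*-distribˡ-+ (seq x n) (seq y n) (seq z n))
              , (λ x y z → ≃-pointwise {(y + z) * x} {y * x + z * x}
                   λ n → ℚ.*-distribʳ-+ (seq x n) (seq y n) (seq z n))
    }
  ; *-comm = *-comm
  }

<-resp-≃ : ∀ {x y u v} → x ≃ y → u ≃ v → x < u → y < v
<-resp-≃ {x} {y} {u} {v} h k (ε , 0<ε , K , l) =
  let (δ , 0<δ , 4δ) = quarter ε 0<ε
      (M , p) = close {x} {y} h δ 0<δ
      (N , q) = close {u} {v} k δ 0<δ
  in δ ℚ.+ δ , ℚ.+-mono-< 0<δ 0<δ , K ℕ.⊔ (M ℕ.⊔ N) , λ n i →
    let K≤ = ℕ.m⊔n≤o⇒m≤o K (M ℕ.⊔ N) i
        MN≤ = ℕ.m⊔n≤o⇒n≤o K (M ℕ.⊔ N) i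
    in from-difference _ _
         (ℚ.+-mono-≤ (subst (λ e → seq x n ℚ.+ e ℚ.≤ seq u n) (sym 4δ) (l n K≤)) (ℚ.+-mono-≤ (proj₂ (p n (ℕ.m⊔n≤o⇒m≤o M N MN≤)))
                                          (proj₁ (q n (ℕ.m⊔n≤o⇒n≤o M N MN≤)))))
         (eq (seq x n) (seq y n) (seq u n) (seq v n) δ)
  where
  open ℚ.+-*-Solver
  eq : ∀ x y u v d → u ℚ.+ (x ℚ.+ d ℚ.+ (v ℚ.+ d)) ℚ.- (x ℚ.+ (d ℚ.+ d ℚ.+ (d ℚ.+ d)) ℚ.+ (y ℚ.+ u))
                   ≡ v ℚ.- (y ℚ.+ (d ℚ.+ d))
  eq = solve 5 (λ x y u v d → u :+ (x :+ d :+ (v :+ d)) :- (x :+ (d :+ d :+ (d :+ d)) :+ (y :+ u))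
                   := v :- (y :+ (d :+ d))) refl

<-irrefl : ∀ x → ¬ (x < x)
<-irrefl x (ε , 0<ε , N , l) = ℚ.<-irrefl refl
  (ℚ.<-≤-trans 0<ε (from-difference ε 0ℚ (l N ℕ.≤-refl) (eq (seq x N) ε)))
  where
  open ℚ.+-*-Solver
  eq : ∀ x e → x ℚ.- (x ℚ.+ e) ≡ 0ℚ ℚ.- e
  eq = solve 2 (λ x e → x :- (x :+ e) := con 0ℚ :- e) refl

<-trans : ∀ {x y z} → x < y → y < z → x < z
<-trans {x} {y} {z} (ε , 0<ε , M , p) (δ , 0<δ , N , q) = ε , 0<ε , M ℕ.⊔ N , λ n l →
  ℚ.≤-trans (p n (ℕ.m⊔n≤o⇒m≤o M N l))
    (ℚ.≤-trans (subst (ℚ._≤ seq y n ℚ.+ δ) (ℚ.+-identityʳ (seq y n)) (ℚ.+-monoʳ-≤ (seq y n) (ℚ.<⇒≤ 0<δ))) (q n (ℕ.m⊔n≤o⇒n≤o M N l)))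

+-monoˡ-< : ∀ {x y} z → x < y → x + z < y + z
+-monoˡ-< {x} {y} z (ε , 0<ε , N , p) = ε , 0<ε , N , λ n l →
  from-difference _ _ (p n l) (eq (seq x n) (seq y n) (seq z n) ε)
  where
  open ℚ.+-*-Solver
  eq : ∀ x y z e → y ℚ.- (x ℚ.+ e) ≡ y ℚ.+ z ℚ.- (x ℚ.+ z ℚ.+ e)
  eq = solve 4 (λ x y z e → y :- (x :+ e) := y :+ z :- (x :+ z :+ e)) refl

-- Rational order is total, so one late index `N` decides: with `4η = ε`, the term of `z` is
-- compared with that of `x` plus `2η`, half of the gap. Later terms move by at most `δ`, a quarter
-- of `η`, which leaves the margin `2η - 2δ`, that is, `η + 2δ`.
<-cotrans : ∀ {x y} → x < y → ∀ z → x < z ⊎ z < y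
<-cotrans {x} {y} (ε , 0<ε , K , l) z = decide (ℚ.≤-total (seq x N ℚ.+ (η ℚ.+ η)) (seq z N))
  where
  δ = proj₁ (quarter (proj₁ (quarter ε 0<ε)) (proj₁ (proj₂ (quarter ε 0<ε))))
  0<δ = proj₁ (proj₂ (quarter (proj₁ (quarter ε 0<ε)) (proj₁ (proj₂ (quarter ε 0<ε)))))
  η = δ ℚ.+ δ ℚ.+ (δ ℚ.+ δ)
  0<η : 0ℚ ℚ.< η
  0<η = ℚ.+-mono-< (ℚ.+-mono-< 0<δ 0<δ) (ℚ.+-mono-< 0<δ 0<δ)
  4η : η ℚ.+ η ℚ.+ (η ℚ.+ η) ≡ ε
  4η = subst (λ η → η ℚ.+ η ℚ.+ (η ℚ.+ η) ≡ ε)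
         (sym (proj₂ (proj₂ (quarter (proj₁ (quarter ε 0<ε)) (proj₁ (proj₂ (quarter ε 0<ε)))))))
         (proj₂ (proj₂ (quarter ε 0<ε)))
  open ℚ.+-*-Solver
  M₁ = proj₁ (cauchy x δ 0<δ)
  M₂ = proj₁ (cauchy y δ 0<δ)
  M₃ = proj₁ (cauchy z δ 0<δ)
  N = K ℕ.⊔ (M₁ ℕ.⊔ (M₂ ℕ.⊔ M₃))
  K≤ : ∀ {n} → N ℕ.≤ n → K ℕ.≤ n
  K≤ = ℕ.m⊔n≤o⇒m≤o K (M₁ ℕ.⊔ (M₂ ℕ.⊔ M₃))
  M₁≤ : ∀ {n} → N ℕ.≤ n → M₁ ℕ.≤ n
  M₁≤ i = ℕ.m⊔n≤o⇒m≤o M₁ (M₂ ℕ.⊔ M₃) (ℕ.m⊔n≤o⇒n≤o K (M₁ ℕ.⊔ (M₂ ℕ.⊔ M₃)) i)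
  M₂≤ : ∀ {n} → N ℕ.≤ n → M₂ ℕ.≤ n
  M₂≤ i = ℕ.m⊔n≤o⇒m≤o M₂ M₃ (ℕ.m⊔n≤o⇒n≤o M₁ (M₂ ℕ.⊔ M₃) (ℕ.m⊔n≤o⇒n≤o K (M₁ ℕ.⊔ (M₂ ℕ.⊔ M₃)) i))
  M₃≤ : ∀ {n} → N ℕ.≤ n → M₃ ℕ.≤ n
  M₃≤ i = ℕ.m⊔n≤o⇒n≤o M₂ M₃ (ℕ.m⊔n≤o⇒n≤o M₁ (M₂ ℕ.⊔ M₃) (ℕ.m⊔n≤o⇒n≤o K (M₁ ℕ.⊔ (M₂ ℕ.⊔ M₃)) i))
  eq₁ : ∀ x z xN zN d → let e = d ℚ.+ d ℚ.+ (d ℚ.+ d) in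
        zN ℚ.+ (xN ℚ.+ d ℚ.+ (z ℚ.+ d)) ℚ.- (xN ℚ.+ (e ℚ.+ e) ℚ.+ (x ℚ.+ zN)) ≡ z ℚ.- (x ℚ.+ (e ℚ.+ (d ℚ.+ d)))
  eq₁ = solve 5 (λ x z xN zN d → let e = d :+ d :+ (d :+ d) in
        zN :+ (xN :+ d :+ (z :+ d)) :- (xN :+ (e :+ e) :+ (x :+ zN)) := z :- (x :+ (e :+ (d :+ d)))) refl
  eq₂ : ∀ z y xN yN zN d → let e = d ℚ.+ d ℚ.+ (d ℚ.+ d) in
        xN ℚ.+ (e ℚ.+ e) ℚ.+ (yN ℚ.+ (zN ℚ.+ d ℚ.+ (y ℚ.+ d))) ℚ.-
          (zN ℚ.+ (xN ℚ.+ (e ℚ.+ e ℚ.+ (e ℚ.+ e)) ℚ.+ (z ℚ.+ yN))) ≡ y ℚ.- (z ℚ.+ (e ℚ.+ (d ℚ.+ d)))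
  eq₂ = solve 6 (λ z y xN yN zN d → let e = d :+ d :+ (d :+ d) in
        xN :+ (e :+ e) :+ (yN :+ (zN :+ d :+ (y :+ d))) :-
          (zN :+ (xN :+ (e :+ e :+ (e :+ e)) :+ (z :+ yN))) := y :- (z :+ (e :+ (d :+ d)))) refl
  up : ∀ w {W} (c : ∀ m n → W ℕ.≤ m → W ℕ.≤ n → ℚ.∣ seq w m ℚ.- seq w n ∣ ℚ.< δ) n →
       W ℕ.≤ n → W ℕ.≤ N → seq w n ℚ.≤ seq w N ℚ.+ δ
  up w c n h k = ∣∣<⇒≤ (seq w n) (seq w N) (c n N h k)
  down : ∀ w {W} (c : ∀ m n → W ℕ.≤ m → W ℕ.≤ n → ℚ.∣ seq w m ℚ.- seq w n ∣ ℚ.< δ) n →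
       W ℕ.≤ n → W ℕ.≤ N → seq w N ℚ.≤ seq w n ℚ.+ δ
  down w c n h k = ∣∣<⇒≥ (seq w n) (seq w N) (c n N h k)
  0<η+2δ : 0ℚ ℚ.< η ℚ.+ (δ ℚ.+ δ)
  0<η+2δ = ℚ.+-mono-< 0<η (ℚ.+-mono-< 0<δ 0<δ)
  decide : _ → x < z ⊎ z < y
  decide (inj₁ h) = inj₁ (η ℚ.+ (δ ℚ.+ δ) , 0<η+2δ , N , λ n i → from-difference _ _
    (ℚ.+-mono-≤ h (ℚ.+-mono-≤ (up x (proj₂ (cauchy x δ 0<δ)) n (M₁≤ i) (M₁≤ ℕ.≤-refl))
                              (down z (proj₂ (cauchy z δ 0<δ)) n (M₃≤ i) (M₃≤ ℕ.≤-refl))))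
    (eq₁ (seq x n) (seq z n) (seq x N) (seq z N) δ))
  decide (inj₂ h) = inj₂ (η ℚ.+ (δ ℚ.+ δ) , 0<η+2δ , N , λ n i → from-difference _ _
    (ℚ.+-mono-≤ h (ℚ.+-mono-≤ (subst (λ e → seq x N ℚ.+ e ℚ.≤ seq y N) (sym 4η) (l N (K≤ ℕ.≤-refl)))
      (ℚ.+-mono-≤ (up z (proj₂ (cauchy z δ 0<δ)) n (M₃≤ i) (M₃≤ ℕ.≤-refl))
                  (down y (proj₂ (cauchy y δ 0<δ)) n (M₂≤ i) (M₂≤ ℕ.≤-refl)))))
    (eq₂ (seq z n) (seq y n) (seq x N) (seq y N) (seq z N) δ))

*-pos : ∀ {x y} → 0ℝ < x → 0ℝ < y → 0ℝ < x * y
*-pos {x} {y} (ε , 0<ε , M , p) (δ , 0<δ , N , q) = ε ℚ.* δ , 0<εδ , M ℕ.⊔ N , λ n l →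
  let ε≤ = subst (ℚ._≤ seq x n) (ℚ.+-identityˡ ε) (p n (ℕ.m⊔n≤o⇒m≤o M N l))
      δ≤ = subst (ℚ._≤ seq y n) (ℚ.+-identityˡ δ) (q n (ℕ.m⊔n≤o⇒n≤o M N l))
      0≤x = ℚ.≤-trans (ℚ.<⇒≤ 0<ε) ε≤
  in subst (ℚ._≤ seq x n ℚ.* seq y n) (sym (ℚ.+-identityˡ (ε ℚ.* δ)))
       (ℚ.≤-trans (ℚ.*-monoʳ-≤-nonNeg δ {{ℚ.nonNegative (ℚ.<⇒≤ 0<δ)}} ε≤)
                  (ℚ.*-monoˡ-≤-nonNeg (seq x n) {{ℚ.nonNegative 0≤x}} δ≤))
  where
  0<εδ : 0ℚ ℚ.< ε ℚ.* δ
  0<εδ = subst (ℚ._< ε ℚ.* δ) (ℚ.*-zeroʳ ε) (ℚ.*-monoʳ-<-pos ε {{ℚ.positive 0<ε}} 0<δ)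

-- A large excess at one late index would persist, up to the Cauchy error, at all later ones and
-- prove a strict inequality. Totality of the rational order turns its refutation into a bound.
<-tight : ∀ {x y} → ¬ (x < y) → ¬ (y < x) → x ≃ y
<-tight {x} {y} x≮y y≮x = close⁻¹ {x} {y} approx
  where
  open ℚ.+-*-Solver
  gap : ∀ x y → ¬ (x < y) → ∀ δ → 0ℚ ℚ.< δ → ∃ λ N → ∀ n → N ℕ.≤ n → seq y n ℚ.≤ seq x n ℚ.+ (δ ℚ.+ δ)
  gap x y x≮y ε 0<ε = N , λ n l → decide n l (ℚ.≤-total (seq x n ℚ.+ (ε ℚ.+ ε)) (seq y n))
    where
    δ = proj₁ (quarter ε 0<ε)
    0<δ = proj₁ (proj₂ (quarter ε 0<ε))
    4δ = proj₂ (proj₂ (quarter ε 0<ε))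
    ε₄ = δ ℚ.+ δ ℚ.+ (δ ℚ.+ δ)
    0<ε₄ = subst (0ℚ ℚ.<_) (sym 4δ) 0<ε
    c = cauchy x δ 0<δ
    d = cauchy y δ 0<δ
    N = proj₁ c ℕ.⊔ proj₁ d
    M₁≤ : ∀ {n} → N ℕ.≤ n → proj₁ c ℕ.≤ n
    M₁≤ = ℕ.m⊔n≤o⇒m≤o (proj₁ c) (proj₁ d)
    M₂≤ : ∀ {n} → N ℕ.≤ n → proj₁ d ℕ.≤ n
    M₂≤ = ℕ.m⊔n≤o⇒n≤o (proj₁ c) (proj₁ d)
    eq : ∀ x y xN yN d → let e = d ℚ.+ d ℚ.+ (d ℚ.+ d) in
         yN ℚ.+ (xN ℚ.+ d ℚ.+ (y ℚ.+ d)) ℚ.- (xN ℚ.+ (e ℚ.+ e) ℚ.+ (x ℚ.+ yN)) ≡ y ℚ.- (x ℚ.+ (e ℚ.+ (d ℚ.+ d)))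
    eq = solve 5 (λ x y xN yN d → let e = d :+ d :+ (d :+ d) in
         yN :+ (xN :+ d :+ (y :+ d)) :- (xN :+ (e :+ e) :+ (x :+ yN)) := y :- (x :+ (e :+ (d :+ d)))) refl
    decide : ∀ n → N ℕ.≤ n → _ → seq y n ℚ.≤ seq x n ℚ.+ (ε ℚ.+ ε)
    decide n l (inj₂ h) = h
    decide n l (inj₁ h) = ⊥-elim (x≮y (ε₄ ℚ.+ (δ ℚ.+ δ) , ℚ.+-mono-< 0<ε₄ (ℚ.+-mono-< 0<δ 0<δ) , N , λ m k →
      from-difference _ _
        (ℚ.+-mono-≤ (subst (λ e → seq x n ℚ.+ (e ℚ.+ e) ℚ.≤ seq y n) (sym 4δ) h) (ℚ.+-mono-≤ (∣∣<⇒≤ (seq x m) (seq x n) (proj₂ c m n (M₁≤ k) (M₁≤ l)))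
                                  (∣∣<⇒≥ (seq y m) (seq y n) (proj₂ d m n (M₂≤ k) (M₂≤ l)))))
        (eq (seq x m) (seq y m) (seq x n) (seq y n) δ)))
  approx : ∀ δ → 0ℚ ℚ.< δ → ∃ λ N → ∀ n → N ℕ.≤ n →
           seq x n ℚ.≤ seq y n ℚ.+ (δ ℚ.+ δ) × seq y n ℚ.≤ seq x n ℚ.+ (δ ℚ.+ δ)
  approx δ 0<δ =
    let (M , p) = gap x y x≮y δ 0<δ
        (N , q) = gap y x y≮x δ 0<δ
    in M ℕ.⊔ N , λ n l → q n (ℕ.m⊔n≤o⇒n≤o M N l) , p n (ℕ.m⊔n≤o⇒m≤o M N l)

-- With `β` an eventual bound for the absolute value of `y`, a product of at least `ε` forces the
-- absolute value of `x` to be at least `δ = ε / β`.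
*-apartˡ : ∀ {x y} → 0ℝ < x * y → x < 0ℝ ⊎ 0ℝ < x
*-apartˡ {x} {y} (ε , 0<ε , K , l) = decide (large N (K≤ ℕ.≤-refl) (M≤ ℕ.≤-refl))
  where
  β = proj₁ (bound y)
  M = proj₁ (proj₂ (bound y))
  0<β = proj₁ (proj₂ (proj₂ (bound y)))
  b = proj₂ (proj₂ (proj₂ (bound y)))
  δ = proj₁ (divide β ε 0<β 0<ε)
  0<δ = proj₁ (proj₂ (divide β ε 0<β 0<ε))
  βδ = proj₂ (proj₂ (divide β ε 0<β 0<ε))
  c = cauchy x δ 0<δ
  N = K ℕ.⊔ (M ℕ.⊔ proj₁ c)
  K≤ : ∀ {n} → N ℕ.≤ n → K ℕ.≤ n
  K≤ = ℕ.m⊔n≤o⇒m≤o K (M ℕ.⊔ proj₁ c)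
  M≤ : ∀ {n} → N ℕ.≤ n → M ℕ.≤ n
  M≤ i = ℕ.m⊔n≤o⇒m≤o M (proj₁ c) (ℕ.m⊔n≤o⇒n≤o K (M ℕ.⊔ proj₁ c) i)
  c≤ : ∀ {n} → N ℕ.≤ n → proj₁ c ℕ.≤ n
  c≤ i = ℕ.m⊔n≤o⇒n≤o M (proj₁ c) (ℕ.m⊔n≤o⇒n≤o K (M ℕ.⊔ proj₁ c) i)
  open ℚ.≤-Reasoning
  open ℚ.+-*-Solver
  xy≤∣x∣β : ∀ n → M ℕ.≤ n → ε ℚ.≤ seq x n ℚ.* seq y n → β ℚ.* δ ℚ.≤ β ℚ.* ℚ.∣ seq x n ∣
  xy≤∣x∣β n M≤n h = begin
    β ℚ.* δ                       ≡⟨ βδ ⟩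
    ε                             ≤⟨ h ⟩
    seq x n ℚ.* seq y n           ≡⟨ ℚ.0≤p⇒∣p∣≡p (ℚ.≤-trans (ℚ.<⇒≤ 0<ε) h) ⟨
    ℚ.∣ seq x n ℚ.* seq y n ∣     ≡⟨ ℚ.∣p*q∣≡∣p∣*∣q∣ (seq x n) (seq y n) ⟩
    ℚ.∣ seq x n ∣ ℚ.* ℚ.∣ seq y n ∣ ≤⟨ ℚ.*-monoˡ-≤-nonNeg ℚ.∣ seq x n ∣ {{ℚ.nonNegative (ℚ.0≤∣p∣ (seq x n))}} (b n M≤n) ⟩
    ℚ.∣ seq x n ∣ ℚ.* β           ≡⟨ ℚ.*-comm ℚ.∣ seq x n ∣ β ⟩
    β ℚ.* ℚ.∣ seq x n ∣ ∎
  δ≤∣x∣ : ∀ n → K ℕ.≤ n → M ℕ.≤ n → δ ℚ.≤ ℚ.∣ seq x n ∣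
  δ≤∣x∣ n h k = ℚ.*-cancelˡ-≤-pos β {{ℚ.positive 0<β}}
    (xy≤∣x∣β n k (subst (ℚ._≤ seq x n ℚ.* seq y n) (ℚ.+-identityˡ ε) (l n h)))
  signed : ∀ {p} → δ ℚ.≤ ℚ.∣ p ∣ → ℚ.∣ p ∣ ≡ p ⊎ ℚ.∣ p ∣ ≡ ℚ.- p → δ ℚ.≤ p ⊎ p ℚ.+ δ ℚ.≤ 0ℚ
  signed h (inj₁ eq) = inj₁ (subst (δ ℚ.≤_) eq h)
  signed {p} h (inj₂ eq) = inj₂ (from-difference (p ℚ.+ δ) 0ℚ (subst (δ ℚ.≤_) eq h) (e p δ))
    where
    e : ∀ x d → ℚ.- x ℚ.- d ≡ 0ℚ ℚ.- (x ℚ.+ d)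
    e = solve 2 (λ x d → :- x :- d := con 0ℚ :- (x :+ d)) refl
  large : ∀ n → K ℕ.≤ n → M ℕ.≤ n → δ ℚ.≤ seq x n ⊎ seq x n ℚ.+ δ ℚ.≤ 0ℚ
  large n h k = signed (δ≤∣x∣ n h k) (ℚ.∣p∣≡p∨∣p∣≡-p (seq x n))
  -- Later terms are as large in absolute value but less than δ away, so they keep the sign.
  decide : δ ℚ.≤ seq x N ⊎ seq x N ℚ.+ δ ℚ.≤ 0ℚ → x < 0ℝ ⊎ 0ℝ < x
  decide (inj₁ h) = inj₂ (δ , 0<δ , N , λ n i → positive n i (large n (K≤ i) (M≤ i)))
    where
    e : ∀ x xN d → xN ℚ.+ (x ℚ.+ d ℚ.+ 0ℚ) ℚ.- (d ℚ.+ (xN ℚ.+ (x ℚ.+ d))) ≡ 0ℚ ℚ.- d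
    e = solve 3 (λ x xN d → xN :+ (x :+ d :+ con 0ℚ) :- (d :+ (xN :+ (x :+ d))) := con 0ℚ :- d) refl
    positive : ∀ n → N ℕ.≤ n → δ ℚ.≤ seq x n ⊎ seq x n ℚ.+ δ ℚ.≤ 0ℚ → 0ℚ ℚ.+ δ ℚ.≤ seq x n
    positive n i (inj₁ k) = subst (ℚ._≤ seq x n) (sym (ℚ.+-identityˡ δ)) k
    positive n i (inj₂ k) = ⊥-elim (ℚ.<-irrefl refl (ℚ.<-≤-trans 0<δ (from-difference δ 0ℚ
      (ℚ.+-mono-≤ h (ℚ.+-mono-≤ (∣∣<⇒≥ (seq x n) (seq x N) (proj₂ c n N (c≤ i) (c≤ ℕ.≤-refl))) k))
      (e (seq x n) (seq x N) δ))))
  decide (inj₂ h) = inj₁ (δ , 0<δ , N , λ n i → negative n i (large n (K≤ i) (M≤ i)))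
    where
    e : ∀ x xN d → 0ℚ ℚ.+ (xN ℚ.+ d ℚ.+ x) ℚ.- (xN ℚ.+ d ℚ.+ (x ℚ.+ d)) ≡ 0ℚ ℚ.- d
    e = solve 3 (λ x xN d → con 0ℚ :+ (xN :+ d :+ x) :- (xN :+ d :+ (x :+ d)) := con 0ℚ :- d) refl
    negative : ∀ n → N ℕ.≤ n → δ ℚ.≤ seq x n ⊎ seq x n ℚ.+ δ ℚ.≤ 0ℚ → seq x n ℚ.+ δ ℚ.≤ 0ℚ
    negative n i (inj₂ k) = k
    negative n i (inj₁ k) = ⊥-elim (ℚ.<-irrefl refl (ℚ.<-≤-trans 0<δ (from-difference δ 0ℚ
      (ℚ.+-mono-≤ h (ℚ.+-mono-≤ (∣∣<⇒≤ (seq x n) (seq x N) (proj₂ c n N (c≤ i) (c≤ ℕ.≤-refl))) k))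
      (e (seq x n) (seq x N) δ))))

-- Division in ℚ reduces the fraction, which does not compute for a variable numerator. Unnormalised
-- fractions can be compared directly; `mkℚᵘ i 0` has denominator one, since the stored number is
-- one less.
/1-+ : ∀ i j → (i ℤ.+ j) ℚ./ 1 ≡ i ℚ./ 1 ℚ.+ j ℚ./ 1
/1-+ i j = ℚ.toℚᵘ-injective (begin-equality
  ℚ.toℚᵘ ((i ℤ.+ j) ℚ./ 1)           ≃⟨ ℚ.toℚᵘ-fromℚᵘ (mkℚᵘ (i ℤ.+ j) 0) ⟩
  mkℚᵘ (i ℤ.+ j) 0                    ≃⟨ ℚᵘ.*≡* (eq i j) ⟩
  mkℚᵘ i 0 ℚᵘ.+ mkℚᵘ j 0              ≃⟨ ℚᵘ.+-cong (ℚ.toℚᵘ-fromℚᵘ (mkℚᵘ i 0)) (ℚ.toℚᵘ-fromℚᵘ (mkℚᵘ j 0)) ⟨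
  ℚ.toℚᵘ (i ℚ./ 1) ℚᵘ.+ ℚ.toℚᵘ (j ℚ./ 1) ≃⟨ ℚ.toℚᵘ-homo-+ (i ℚ./ 1) (j ℚ./ 1) ⟨
  ℚ.toℚᵘ (i ℚ./ 1 ℚ.+ j ℚ./ 1) ∎)
  where
  open ℚᵘ.≤-Reasoning
  open ℤ.+-*-Solver
  eq : ∀ i j → (i ℤ.+ j) ℤ.* + 1 ≡ (i ℤ.* + 1 ℤ.+ j ℤ.* + 1) ℤ.* + 1
  eq = solve 2 (λ i j → (i :+ j) :* con (+ 1) := (i :* con (+ 1) :+ j :* con (+ 1)) :* con (+ 1)) refl

/1-* : ∀ i j → (i ℤ.* j) ℚ./ 1 ≡ i ℚ./ 1 ℚ.* (j ℚ./ 1)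
/1-* i j = ℚ.toℚᵘ-injective (begin-equality
  ℚ.toℚᵘ ((i ℤ.* j) ℚ./ 1)           ≃⟨ ℚ.toℚᵘ-fromℚᵘ (mkℚᵘ (i ℤ.* j) 0) ⟩
  mkℚᵘ i 0 ℚᵘ.* mkℚᵘ j 0              ≃⟨ ℚᵘ.*-cong (ℚ.toℚᵘ-fromℚᵘ (mkℚᵘ i 0)) (ℚ.toℚᵘ-fromℚᵘ (mkℚᵘ j 0)) ⟨
  ℚ.toℚᵘ (i ℚ./ 1) ℚᵘ.* ℚ.toℚᵘ (j ℚ./ 1) ≃⟨ ℚ.toℚᵘ-homo-* (i ℚ./ 1) (j ℚ./ 1) ⟨
  ℚ.toℚᵘ (i ℚ./ 1 ℚ.* (j ℚ./ 1)) ∎)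
  where
  open ℚᵘ.≤-Reasoning

/1-neg : ∀ i → (ℤ.- i) ℚ./ 1 ≡ ℚ.- (i ℚ./ 1)
/1-neg i = ℚ.toℚᵘ-injective (begin-equality
  ℚ.toℚᵘ ((ℤ.- i) ℚ./ 1)  ≃⟨ ℚ.toℚᵘ-fromℚᵘ (mkℚᵘ (ℤ.- i) 0) ⟩
  ℚᵘ.- mkℚᵘ i 0            ≃⟨ ℚᵘ.-‿cong (ℚ.toℚᵘ-fromℚᵘ (mkℚᵘ i 0)) ⟨
  ℚᵘ.- ℚ.toℚᵘ (i ℚ./ 1)    ≃⟨ ℚ.toℚᵘ-homo‿- (i ℚ./ 1) ⟨
  ℚ.toℚᵘ (ℚ.- (i ℚ./ 1))   ∎)
  where
  open ℚᵘ.≤-Reasoning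

+-*-commutativeRing : CommutativeRing 0ℓ 0ℓ
+-*-commutativeRing = record { isCommutativeRing = +-*-isCommutativeRing }

fromℤ-isHomomorphism : IsRingHomomorphism ℤ.+-*-rawRing (CommutativeRing.rawRing +-*-commutativeRing) fromℤ
fromℤ-isHomomorphism = record
  { isSemiringHomomorphism = record
    { isNearSemiringHomomorphism = record
      { +-isMonoidHomomorphism = record
        { isMagmaHomomorphism = record
          { isRelHomomorphism = record { cong = λ { {i} refl → ≃-refl {fromℤ i} } }
          ; homo = λ i j → ≃-pointwise {fromℤ (i ℤ.+ j)} {fromℤ i + fromℤ j} λ _ → /1-+ i j
          }
        ; ε-homo = ≃-refl {0ℝ}
        }
      ; *-homo = λ i j → ≃-pointwise {fromℤ (i ℤ.* j)} {fromℤ i * fromℤ j} λ _ → /1-* i j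
      }
    ; 1#-homo = ≃-refl {1ℝ}
    }
  ; -‿homo = λ i → ≃-pointwise {fromℤ (ℤ.- i)} { - fromℤ i} λ _ → /1-neg i
  }

/1-pos : ∀ n → ℚ.Positive (+ suc n ℚ./ 1)
/1-pos n = ℚ.normalize-pos (suc n) 1

fromℤ-pos : ∀ {i} → 0ℤ ℤ.< i → 0ℝ < fromℤ i
fromℤ-pos {+ suc n} _ = + suc n ℚ./ 1 , ℚ.positive⁻¹ (+ suc n ℚ./ 1) {{/1-pos n}} , 0 ,
  λ _ _ → ℚ.≤-reflexive (ℚ.+-identityˡ (+ suc n ℚ./ 1))
fromℤ-pos {+ zero} (ℤ.+<+ ())

fromℤ-inverse : ∀ {i} → i ≢ 0ℤ → ∃ λ x → fromℤ i * x ≃ 1ℝ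
fromℤ-inverse {+ zero} i≢0 = ⊥-elim (i≢0 refl)
fromℤ-inverse {+ suc n} _ = fromℚ (ℚ.1/ q) , ≃-pointwise {fromℚ q * fromℚ (ℚ.1/ q)} {1ℝ} λ _ → ℚ.*-inverseʳ q
  where
  q = + suc n ℚ./ 1
  instance
    q≢0 : ℚ.NonZero q
    q≢0 = ℚ.pos⇒nonZero q {{/1-pos n}}
fromℤ-inverse { -[1+ n ]} _ = fromℚ (ℚ.- (ℚ.1/ q)) , ≃-pointwise {fromℚ (ℚ.- q) * fromℚ (ℚ.- (ℚ.1/ q))} {1ℝ}
  λ _ → trans (neg*neg q (ℚ.1/ q)) (ℚ.*-inverseʳ q)
  where
  q = + suc n ℚ./ 1
  instance
    q≢0 : ℚ.NonZero q
    q≢0 = ℚ.pos⇒nonZero q {{/1-pos n}}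
  open ℚ.+-*-Solver using (solve; _:*_; :-_; _:=_)
  neg*neg : ∀ a b → ℚ.- a ℚ.* ℚ.- b ≡ a ℚ.* b
  neg*neg = solve 2 (λ a b → :- a :* :- b := a :* b) refl

ℝ-orderedRing : OrderedRing
ℝ-orderedRing = record
  { commutativeRing = +-*-commutativeRing
  ; _<_ = _<_
  ; <-resp-≈ = λ {x} {y} {u} {v} → <-resp-≃ {x} {y} {u} {v}
  ; <-irrefl = <-irrefl
  ; <-trans = λ {x} {y} {z} → <-trans {x} {y} {z}
  ; <-cotrans = λ {x} {y} → <-cotrans {x} {y}
  ; <-tight = λ {x} {y} → <-tight {x} {y}
  ; +-monoˡ-< = λ {x} {y} → +-monoˡ-< {x} {y}
  ; *-pos = λ {x} {y} → *-pos {x} {y}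
  ; *-apartˡ = λ {x} {y} → *-apartˡ {x} {y}
  ; fromℤ = fromℤ
  ; fromℤ-isHomomorphism = fromℤ-isHomomorphism
  ; fromℤ-pos = fromℤ-pos
  ; fromℤ-inverse = fromℤ-inverse
  }

-- The polytope over the real numbers

module 𝓖 = Geometry ℝ-orderedRing

simplicial : IsSimplicialPolytope points
simplicial = 𝓖.conv-dimension , λ c b (valid , dim) → 𝓖.simplex c b valid dim

vertices : ∀ v → IsVertex points v ⇔ ∃ λ i → points i ≋ v
vertices v = mk⇔ (𝓖.vertex⇒point v) λ (i , eq) → 𝓖.point⇒vertex v i eq

points-distinct : ∀ i j → points i ≋ points j → i ≡ j
points-distinct = 𝓖.point-injective

facetVertexSets : ∀ S → ∣ S ∣ ≡ 4 → S ∈ facetList → IsFacetVertexSet points S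
facetVertexSets = 𝓖.facetVertexSet

facetVertexSets⁻¹ : ∀ S → IsFacetVertexSet points S → S ∈ facetList
facetVertexSets⁻¹ = 𝓖.facetVertexSet⁻¹

-- The boundary complex

⊆∧≥⇒≡ : ∀ {n} {S T : Subset n} → S ⊆ T → ∣ T ∣ ℕ.≤ ∣ S ∣ → S ≡ T
⊆∧≥⇒≡ {S = S} {T} S⊆T ∣T∣≤∣S∣ = ⊆-antisym S⊆T λ {x} x∈T →
  decidable-stable (x ∈? S) λ x∉S → ℕ.<⇒≱ (p⊂q⇒∣p∣<∣q∣ (S⊆T , x , x∈T , x∉S)) ∣T∣≤∣S∣

∣p-x∣ : ∀ {n} (p : Subset n) x → x ∈ₛ p → suc ∣ p - x ∣ ≡ ∣ p ∣
∣p-x∣ (inside ∷ p) zero here = cong (suc ∘ ∣_∣) (p─⊥≡p p)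
∣p-x∣ (inside ∷ p) (suc x) (there x∈) = cong suc (∣p-x∣ p x x∈)
∣p-x∣ (outside ∷ p) (suc x) (there x∈) = ∣p-x∣ p x x∈

codimension-one : ∀ {n} {R S : Subset n} → R ⊆ S → suc ∣ R ∣ ≡ ∣ S ∣ → ∃ λ j → j ∈ₛ S × R ≡ S - j
codimension-one {R = R} {S} R⊆S eq with any? (λ j → (j ∈? S) ×-dec ¬? (j ∈? R))
... | no none = contradiction (p⊆q⇒∣p∣≤∣q∣ {p = S} {q = R} λ {x} x∈S → decidable-stable (x ∈? R) λ x∉R → none (x , x∈S , x∉R))
                  (ℕ.<⇒≱ (ℕ.≤-reflexive eq))
... | yes (j , j∈S , j∉R) = j , j∈S , ⊆∧≥⇒≡
        (λ {x} x∈R → x∈p∧x≢y⇒x∈p-y (R⊆S x∈R) λ { refl → j∉R x∈R })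
        (ℕ.≤-reflexive (ℕ.suc-injective (trans (∣p-x∣ S j j∈S) (sym eq))))

-- Sets of equal size do not properly contain each other, so the generators are exactly the facets.
-- The family is a parameter because both the boundary complex and the piece are of this kind.
module Pure {n} (F : Pred (Subset n) 0ℓ) (∣F∣ : ∀ S → F S → ∣ S ∣ ≡ 4) where

  open Graph (facetRidgeGraph (generated F))

  facet⁺ : ∀ {S} → F S → Facet (generated F) S
  facet⁺ {S} S∈F = (S , S∈F , ⊆-refl) , λ T (U , U∈F , T⊆U) S⊆T →
    ⊆∧≥⇒≡ S⊆T (subst (∣ T ∣ ℕ.≤_) (trans (∣F∣ U U∈F) (sym (∣F∣ S S∈F))) (p⊆q⇒∣p∣≤∣q∣ T⊆U))

  facet⁻ : ∀ {S} → Facet (generated F) S → F S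
  facet⁻ {S} ((T , T∈F , S⊆T) , maximal) = subst F (sym (maximal T (T , T∈F , ⊆-refl) S⊆T)) T∈F

  adjacent⁺ : ∀ {S T} → F S → F T → ∣ S ∩ T ∣ ≡ 3 → S ~ T
  adjacent⁺ {S} {T} S∈F T∈F ∣S∩T∣≡3 = facet⁺ S∈F , facet⁺ T∈F , S≢T ,
    S ∩ T , ((S , S∈F , p∩q⊆p S T) , ∣S∩T∣≡3) , p∩q⊆p S T , p∩q⊆q S T
    where
    S≢T : S ≢ T
    S≢T refl = contradiction (trans (sym ∣S∩T∣≡3) (trans (cong ∣_∣ (∩-idem S)) (∣F∣ S S∈F))) λ ()

  -- The common ridge gives at least three common elements; with four, the intersection would equal
  -- both sets.
  adjacent⁻ : ∀ {S T} → S ~ T → ∣ S ∩ T ∣ ≡ 3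
  adjacent⁻ {S} {T} (S∈ , T∈ , S≢T , R , (_ , ∣R∣≡3) , R⊆S , R⊆T) = ℕ.≤-antisym
    (ℕ.≮⇒≥ λ 3<∣S∩T∣ → S≢T (trans (sym (whole (p∩q⊆p S T) (∣F∣ S (facet⁻ S∈)) 3<∣S∩T∣))
                                   (whole (p∩q⊆q S T) (∣F∣ T (facet⁻ T∈)) 3<∣S∩T∣)))
    (subst (ℕ._≤ ∣ S ∩ T ∣) ∣R∣≡3 (p⊆q⇒∣p∣≤∣q∣ {p = R} {q = S ∩ T} λ x∈R → x∈p∩q⁺ (R⊆S x∈R , R⊆T x∈R)))
    where
    whole : ∀ {U} → S ∩ T ⊆ U → ∣ U ∣ ≡ 4 → 4 ℕ.≤ ∣ S ∩ T ∣ → S ∩ T ≡ U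
    whole ⊆U ∣U∣≡4 4≤ = ⊆∧≥⇒≡ ⊆U (subst (ℕ._≤ ∣ S ∩ T ∣) (sym ∣U∣≡4) 4≤)

-- Attaching each set to an earlier one describes a spanning tree, which reduces connectedness to a
-- finite check.
Linked : ∀ {n} → List (Subset n) → List (Subset n) → Set
Linked seen []       = ⊤
Linked seen (S ∷ Ss) = Any (λ T → ∣ T ∩ S ∣ ≡ 3) seen × Linked (S ∷ seen) Ss

linked? : ∀ {n} (seen Ss : List (Subset n)) → Dec (Linked seen Ss)
linked? seen []       = yes tt
linked? seen (S ∷ Ss) = Any.any? (λ T → ∣ T ∩ S ∣ ℕ.≟ 3) seen ×-dec linked? (S ∷ seen) Ss

linked⇒reachable : ∀ {n} (_~_ : Rel (Subset n) 0ℓ) (P : Pred (Subset n) 0ℓ) →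
  (∀ {S T} → P S → P T → ∣ S ∩ T ∣ ≡ 3 → S ~ T) → ∀ root {seen Ss} → All P seen → All P Ss → Linked seen Ss →
  (∀ {S} → S ∈ seen → Star _~_ root S) → ∀ {S} → S ∈ Ss → Star _~_ root S
linked⇒reachable _~_ P edge root {seen} {S ∷ Ss} Pseen (PS ∷ PSs) (link , linked) reach = λ
  { (here refl) → reach-S
  ; (there U∈)  → linked⇒reachable _~_ P edge root (PS ∷ Pseen) PSs linked
                    (λ { (here refl) → reach-S ; (there T∈) → reach T∈ }) U∈ }
  where
  reach-S : Star _~_ root S
  reach-S = let (T , T∈ , ∣T∩S∣≡3) = find link in
    reach T∈ ◅◅ edge (All.lookup Pseen T∈) PS ∣T∩S∣≡3 ◅ Closure.ε

linked⇒connected : ∀ {n} (Γ : Graph (Subset n)) root Ss → let open Graph Γ in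
  All Vertex (root ∷ Ss) → (∀ {S T} → Vertex S → Vertex T → ∣ S ∩ T ∣ ≡ 3 → S ~ T) →
  Linked (root ∷ []) Ss → (∀ {S} → Vertex S → S ∈ root ∷ Ss) → Connected Γ
linked⇒connected Γ root Ss (Vroot ∷ VSs) edge linked complete = (root , Vroot) , λ u v u∈ v∈ →
  reverse ~-sym (reach (complete u∈)) ◅◅ reach (complete v∈)
  where
  open Graph Γ
  reach : ∀ {S} → S ∈ root ∷ Ss → Star _~_ root S
  reach (here refl) = Closure.ε
  reach (there S∈) = linked⇒reachable _~_ Vertex edge root (Vroot ∷ []) VSs linked (λ { (here refl) → Closure.ε }) S∈

abstract
  ∣facet∣ : ∀ {S} → S ∈ facetList → ∣ S ∣ ≡ 4
  ∣facet∣ = All.lookup (toWitness {a? = All.all? (λ S → ∣ S ∣ ℕ.≟ 4) facetList} tt)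

  other∉piece : ∀ {S} → S ∈ otherFacets → S ∉ pieceList
  other∉piece = All.lookup (toWitness {a? = All.all? (λ S → ¬? (S ∈ˡ? pieceList)) otherFacets} tt)

piece⊆facets : ∀ {S} → Piece S → S ∈ facetList
piece⊆facets = ∈-++⁺ˡ

∣piece∣ : ∀ S → Piece S → ∣ S ∣ ≡ 4
∣piece∣ S S∈ = ∣facet∣ (piece⊆facets S∈)

∣facetVertexSet∣ : ∀ S → IsFacetVertexSet points S → ∣ S ∣ ≡ 4
∣facetVertexSet∣ S S∈ = ∣facet∣ (facetVertexSets⁻¹ S S∈)

piece⇒facetVertexSet : ∀ S → Piece S → IsFacetVertexSet points S
piece⇒facetVertexSet S S∈ = facetVertexSets S (∣piece∣ S S∈) (piece⊆facets S∈)

module Δ = Pure (IsFacetVertexSet points) ∣facetVertexSet∣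
module 𝒫 = Pure Piece ∣piece∣

pieceRoot : Subset 12
pieceRoot = word G H K L

-- Reordered breadth-first from `pieceRoot`, because `pieceList` itself is not linked: its third set
-- meets each of the first two in only two elements.
pieceRest : List (Subset 12)
pieceRest =
  word D G H K ∷ word G J K L ∷ word G H I L ∷ word D F G K ∷ word D E G H ∷
  word F G J K ∷ word B J K L ∷ word E G H I ∷ word C H I L ∷ word C D F G ∷
  word B D E G ∷ word A F J K ∷ word B C J K ∷ word B C K L ∷ word A E H I ∷
  word B C H I ∷ word B C I L ∷ word A C D F ∷ word A C D G ∷ word A B D E ∷
  word A B D G ∷ word A C F J ∷ word A C J K ∷ word A B E I ∷ word A B H I ∷ []

abstract
  pieceRest⊆piece : All Piece (pieceRoot ∷ pieceRest)
  pieceRest⊆piece = toWitness {a? = All.all? (_∈ˡ? pieceList) (pieceRoot ∷ pieceRest)} tt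

  piece⊆pieceRest : ∀ {S} → Piece S → S ∈ pieceRoot ∷ pieceRest
  piece⊆pieceRest = All.lookup (toWitness {a? = All.all? (_∈ˡ? (pieceRoot ∷ pieceRest)) pieceList} tt)

  piece-linked : Linked (pieceRoot ∷ []) pieceRest
  piece-linked = toWitness {a? = linked? (pieceRoot ∷ []) pieceRest} tt

  other-linked : Linked (otherRoot ∷ []) otherRest
  other-linked = toWitness {a? = linked? (otherRoot ∷ []) otherRest} tt

piece-connected : Connected (facetRidgeGraph (generated Piece))
piece-connected = linked⇒connected (facetRidgeGraph (generated Piece)) pieceRoot pieceRest
  (All.map 𝒫.facet⁺ pieceRest⊆piece)
  (λ S∈ T∈ → 𝒫.adjacent⁺ (𝒫.facet⁻ S∈) (𝒫.facet⁻ T∈))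
  piece-linked
  (λ S∈ → piece⊆pieceRest (𝒫.facet⁻ S∈))

nonSeparating : NonSeparating (boundaryComplex points) Piece
nonSeparating = linked⇒connected (delete (facetRidgeGraph (boundaryComplex points)) Piece) otherRoot otherRest
  (All.tabulate λ {S} S∈ → Δ.facet⁺ (facetVertexSets S (∣facet∣ (other⊆facets S∈)) (other⊆facets S∈)) , other∉piece S∈)
  (λ (S∈ , S∉) (T∈ , T∉) eq → Δ.adjacent⁺ (Δ.facet⁻ S∈) (Δ.facet⁻ T∈) eq , S∉ , T∉)
  other-linked
  (λ {S} (S∈ , S∉) → fromInj₂ (⊥-elim ∘ S∉) (∈-++⁻ pieceList (facetVertexSets⁻¹ S (Δ.facet⁻ S∈))))
  where
  other⊆facets : ∀ {S} → S ∈ otherFacets → S ∈ facetList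
  other⊆facets = ∈-++⁺ʳ pieceList

-- A ridge of `S` is named by the opposite vertex: the one opposite `i` lies in no other set of the
-- piece, and the remaining three are shared.
FreeAt : Subset 12 → Fin 12 → Set
FreeAt S i = i ∈ₛ S × All (λ T → S - i ⊆ T → T ≡ S) pieceList ×
  (∀ j → j ∈ₛ S → j ≢ i → Any (λ T → S - j ⊆ T × T ≢ S) pieceList)

abstract
  free : ∀ {S} → Piece S → ∃ (FreeAt S)
  free = All.lookup (toWitness {a? = All.all? (λ S → any? λ i → (i ∈? S) ×-dec
      All.all? (λ T → (S - i ⊆? T) →-dec (T ≟ˢ S)) pieceList ×-dec
      all? (λ j → (j ∈? S) →-dec ¬? (j ≟ᶠ i) →-dec Any.any? (λ T → (S - j ⊆? T) ×-dec ¬? (T ≟ˢ S)) pieceList))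
    pieceList} tt)

one-boundaryRidge : ∀ S → Piece S → ∃! _≡_ λ R → BoundaryRidge (generated Piece) R × R ⊆ S
one-boundaryRidge S S∈ = from-free (free S∈)
  where
  from-free : ∃ (FreeAt S) → ∃! _≡_ λ R → BoundaryRidge (generated Piece) R × R ⊆ S
  from-free (i , i∈S , alone , shared) = S - i , (boundary , p─q⊆p S ⁅ i ⁆) , unique
    where
    boundary : BoundaryRidge (generated Piece) (S - i)
    boundary = ((S , S∈ , p─q⊆p S ⁅ i ⁆) , ℕ.suc-injective (trans (∣p-x∣ S i i∈S) (∣piece∣ S S∈))) ,
      S , (𝒫.facet⁺ S∈ , p─q⊆p S ⁅ i ⁆) , λ (T∈ , ⊆T) → sym (All.lookup alone (𝒫.facet⁻ T∈) ⊆T)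
    unique : ∀ {R} → BoundaryRidge (generated Piece) R × R ⊆ S → S - i ≡ R
    -- `R` omits a single vertex `j` of `S`. If `j` is not `i`, a second set of the piece contains
    -- `R`, against its being a boundary ridge.
    unique {R} (((_ , ∣R∣≡3) , T , _ , only-T) , R⊆S) with codimension-one R⊆S (trans (cong suc ∣R∣≡3) (sym (∣piece∣ S S∈)))
    ... | j , j∈S , refl with j ≟ᶠ i
    ...   | yes refl = refl
    ...   | no j≢i = let (U , U∈ , ⊆U , U≢S) = find (shared j j∈S j≢i) in
              ⊥-elim (U≢S (trans (sym (only-T (𝒫.facet⁺ U∈ , ⊆U))) (only-T (𝒫.facet⁺ S∈ , R⊆S))))

perlesPiece : IsPerlesPiece (boundaryComplex points) Piece
perlesPiece = record
  { facets = λ S S∈ → Δ.facet⁺ (piece⇒facetVertexSet S S∈)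
  ; connected = piece-connected
  ; one-boundaryRidge = one-boundaryRidge
  }

adjacent⇔ : ∀ S T → Piece S → Piece T → Graph._~_ (facetRidgeGraph (generated Piece)) S T ⇔ ∣ S ∩ T ∣ ≡ 3
adjacent⇔ S T S∈ T∈ = mk⇔ 𝒫.adjacent⁻ (𝒫.adjacent⁺ S∈ T∈)

abstract
  avoids-vertex : ∀ v → Any (v ∉ₛ_) pieceList
  avoids-vertex = toWitness {a? = all? λ v → Any.any? (λ S → ¬? (v ∈? S)) pieceList} tt

-- No vertex belongs to all 26 sets. A set of the piece that misses `v` would lie in a facet
-- containing `v`, and by maximality would equal it.
not-star : ¬ (∃ λ v → boundaryComplex points ⁅ v ⁆ × (∀ σ → generated Piece σ ⇔ star (boundaryComplex points) v σ))
not-star (v , _ , same) =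
  let (S , S∈ , v∉S) = find (avoids-vertex v)
      (T , (T∈ , v∈T) , S⊆T) = Equivalence.to (same S) (S , S∈ , ⊆-refl)
      S≡T = proj₂ (Δ.facet⁺ (piece⇒facetVertexSet S S∈)) T (proj₁ T∈) S⊆T
  in v∉S (subst (v ∈ₛ_) (sym S≡T) v∈T)

planar : Planar (facetRidgeGraph (generated Piece))
planar = record
  { point = λ S → gridPoint (position S)
  ; arc = λ S T → segment (position S) (position T)
  ; point-injective = λ S T S∈ T∈ same → [ id , (λ (k , d≢0) → ⊥-elim (gridPoint-injective {position S} {position T} k d≢0 same)) ]′
      (positions-distinct (𝒫.facet⁻ S∈) (𝒫.facet⁻ T∈))
  ; arc-isArc = λ S T ST → record
    { continuous = λ s _ ε 0<ε →
        let (δ , 0<δ , close) = segment-continuous (position S) (position T) (edges-short (drawn ST)) s ε 0<ε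
        in δ , 0<δ , λ t _ → close t
    ; injective = λ s t _ _ →
        let (k , d≢0) = distinct ST in segment-injective (position S) (position T) k d≢0 {s} {t}
    ; start = segment-start (position S) (position T)
    ; end = segment-end (position S) (position T)
    }
  ; avoids-points = λ S T U ST U∈ t 0<t t<1 same →
      separable⇒avoids (edges-avoid-points (drawn ST) (𝒫.facet⁻ U∈)) {t} 0<t t<1 same
  ; avoids-arcs = λ S T S′ T′ ST S′T′ different s t 0<s s<1 (0≤t , t≤1) →
      separable⇒disjoint (edges-disjoint (drawn ST) (drawn S′T′) different) {s} {t} 0<s s<1 0≤t t≤1
  }
  where
  open Drawing ℝ-orderedRing
  open Graph (facetRidgeGraph (generated Piece))
  drawn : ∀ {S T} → S ~ T → (S , T) ∈ edges
  drawn ST@(S∈ , T∈ , _) = ∈-edges (𝒫.facet⁻ S∈) (𝒫.facet⁻ T∈) (𝒫.adjacent⁻ ST)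
  distinct : ∀ {S T} → S ~ T → _
  distinct (S∈ , T∈ , S≢T , _) = fromInj₂ (⊥-elim ∘ S≢T) (positions-distinct (𝒫.facet⁻ S∈) (𝒫.facet⁻ T∈))

proposition6p4 : IsSimplicialPolytope points
    × ((∀ v → IsVertex points v ⇔ ∃ λ i → points i ≋ v) × (∀ i j → points i ≋ points j → i ≡ j))
    × (∀ S → Piece S → ∣ S ∣ ≡ 4 × IsFacetVertexSet points S)
    × (IsPerlesPiece (boundaryComplex points) Piece × NonSeparating (boundaryComplex points) Piece)
    × (∀ S T → Piece S → Piece T → Graph._~_ (facetRidgeGraph (generated Piece)) S T ⇔ ∣ S ∩ T ∣ ≡ 3)
    × Planar (facetRidgeGraph (generated Piece))
    × ¬ (∃ λ v → boundaryComplex points ⁅ v ⁆ × (∀ σ → generated Piece σ ⇔ star (boundaryComplex points) v σ))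
proposition6p4 =
  simplicial ,
  (vertices , points-distinct) ,
  (λ S S∈ → ∣piece∣ S S∈ , piece⇒facetVertexSet S S∈) ,
  (perlesPiece , nonSeparating) ,
  adjacent⇔ ,
  planar ,
  not-star
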